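{- Let $q$ be a prime power, $k=\mathbb{F}_q$, $n\ge 1$ an integer, $\lambda$ a nontrivial additive character of $k$, and $\chi$ a multiplicative character of $k^*$. Let $U\in \mathrm{M}_n(k)$ be a nonzero matrix and let $u$ be the rank of $U$. Then $$G_{\mathrm{GL}_n(k)}(U,\chi,\lambda)=\begin{cases}\bar{\chi}(\det U)\,q^{\binom{n}{2}}\,G(\chi,\lambda)^n & \text{if } u=n,\\[4pt] (-1)^u q^{\binom{n}{2}}\displaystyle\prod_{i=1}^{n-u}(q^i-1) & \text{if } \chi=1,\\[4pt] 0 & \text{if } u<n \text{ and } \chi\neq 1.\end{cases}$$
   Context: $\mathrm{M}_n(k)$ is the set of $n\times n$ matrices over $k$. For $U=(u_{ij}),V=(v_{ij})\in \mathrm{M}_n(k)$, put $U\cdot V=\sum_{1\le i,j\le n}u_{ij}v_{ij}\in k$ (entrywise product summed, not matrix multiplication). Additive characters are homomorphisms $(k,+)\to\mathbb{C}^*$, multiplicative characters are homomorphisms $k^*\to\mathbb{C}^*$; $\chi=1$ denotes the trivial multiplicative character and $\bar\chi$ the complex conjugate of $\chi$. Define $$G_{\mathrm{GL}_n(k)}(U,\chi,\lambda)=\sum_{X\in \mathrm{GL}_n(k)}\chi(\det X)\,\lambda(U\cdot X),$$ and let $$G(\chi,\lambda)=\sum_{x\in k^*}\chi(x)\lambda(x)$$ be the classical Gauss sum. Empty products equal $1$. -}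

module Defs where

open import Algebra.Apartness.Bundles using (HeytingField; HeytingCommutativeRing)
open import Algebra.Bundles using (CommutativeRing; Monoid; Semiring; Group; RawGroup)
import Algebra.Definitions as AlgebraDefinitions
import Algebra.Definitions.RawMonoid as RawMonoidDefinitions
import Algebra.Definitions.RawSemiring as RawSemiringDefinitions
open import Algebra.Morphism.Bundles using (GroupHomomorphism)
import Algebra.Properties.CommutativeSemigroup as CommutativeSemigroupProperties
import Algebra.Properties.Monoid.Sum as MonoidSum
import Algebra.Properties.Ring as RingProperties
open import Algebra.Structures using (IsCommutativeRing)
import Data.Fin.Properties as Fin
open import Data.Fin.Base using (Fin; zero; suc; toℕ)
open import Data.List.Base as List using (List; cartesianProductWith; filter; foldr)
open import Data.List.Relation.Unary.Any as Any using (Any)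
import Data.List.Relation.Unary.Any.Properties as Any
open import Data.Nat.Base as ℕ using (ℕ; zero; suc)
import Data.Nat.Properties as ℕ
open import Data.Nat.Primality using (Prime)
open import Data.Product.Base using (Σ; ∃; ∃-syntax; _×_; _,_; proj₁; proj₂)
open import Data.Rational.Base as ℚ using (ℚ; 0ℚ; 1ℚ; ∣_∣)
import Data.Rational.Properties as ℚ
open import Data.Rational.Solver using (module +-*-Solver)
open import Data.Vec.Functional as Vector using (Vector; removeAt)
open import Function.Base using (_∘_; flip)
open import Function.Bundles using (Inverse)
open import Function.Properties.Inverse using (Inverse⇒Injection)
import Function.Construct.Symmetry as Symmetry
open import Level using (Level; 0ℓ; _⊔_)
open import Relation.Binary.Definitions using (Decidable)
open import Relation.Binary.PropositionalEquality as ≡ using (_≡_)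
import Relation.Binary.Reasoning.Setoid as SetoidReasoning
open import Relation.Nullary.Decidable using (Dec; yes; no; map′; via-injection; _×-dec_)
open import Relation.Nullary.Negation using (¬_)
open import Relation.Unary as Unary using (Pred)

private
  variable
    a b c ℓ ℓ₁ ℓ₂ p : Level

------------------------------------------------------------------------
-- Real numbers

Cauchy : (ℕ → ℚ) → Set
Cauchy x = ∀ ε → 0ℚ ℚ.< ε →
  ∃[ N ] ∀ m n → N ℕ.≤ m → N ℕ.≤ n → ∣ x m ℚ.- x n ∣ ℚ.< ε

-- Real numbers are Cauchy sequences of rationals, two of them being equal
-- when their difference tends to 0.
record ℝ : Set where
  no-eta-equality
  field
    seq    : ℕ → ℚ
    cauchy : Cauchy seq

open ℝ public

infix 4 _≈ᵣ_

record _≈ᵣ_ (x y : ℝ) : Set where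
  constructor mk≈ᵣ
  field
    close : ∀ ε → 0ℚ ℚ.< ε →
      ∃[ N ] ∀ n → N ℕ.≤ n → ∣ seq x n ℚ.- seq y n ∣ ℚ.< ε

open _≈ᵣ_ public

module RealLemmas where

  module _ where
    open +-*-Solver
    open ≡.≡-Reasoning

    abs-swap : ∀ p q → ∣ p ℚ.- q ∣ ≡ ∣ q ℚ.- p ∣
    abs-swap p q = begin
      ∣ p ℚ.- q ∣         ≡⟨ ≡.cong ∣_∣ (solve 2 (λ p q → p :- q := :- (q :- p)) ≡.refl p q) ⟩
      ∣ ℚ.- (q ℚ.- p) ∣   ≡⟨ ℚ.∣-p∣≡∣p∣ (q ℚ.- p) ⟩
      ∣ q ℚ.- p ∣         ∎

    half+half : ∀ ε → ε ℚ.* ℚ.½ ℚ.+ ε ℚ.* ℚ.½ ≡ ε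
    half+half ε = begin
      ε ℚ.* ℚ.½ ℚ.+ ε ℚ.* ℚ.½  ≡⟨ ℚ.*-distribˡ-+ ε ℚ.½ ℚ.½ ⟨
      ε ℚ.* 1ℚ                 ≡⟨ ℚ.*-identityʳ ε ⟩
      ε                        ∎

    split-trans : ∀ p q r → p ℚ.- r ≡ (p ℚ.- q) ℚ.+ (q ℚ.- r)
    split-trans = solve 3 (λ p q r → p :- r := (p :- q) :+ (q :- r)) ≡.refl

    split-+ : ∀ p q r s → (p ℚ.+ q) ℚ.- (r ℚ.+ s) ≡ (p ℚ.- r) ℚ.+ (q ℚ.- s)
    split-+ = solve 4 (λ p q r s → (p :+ q) :- (r :+ s) := (p :- r) :+ (q :- s)) ≡.refl

    split-* : ∀ p q r s → p ℚ.* q ℚ.- r ℚ.* s ≡ p ℚ.* (q ℚ.- s) ℚ.+ (p ℚ.- r) ℚ.* s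
    split-* = solve 4 (λ p q r s → p :* q :- r :* s := p :* (q :- s) :+ (p :- r) :* s) ≡.refl

    split-neg : ∀ p q → ℚ.- p ℚ.- ℚ.- q ≡ q ℚ.- p
    split-neg = solve 2 (λ p q → :- p :- :- q := q :- p) ≡.refl

    split-bound : ∀ p q → p ≡ q ℚ.+ (p ℚ.- q)
    split-bound = solve 2 (λ p q → p := q :+ (p :- q)) ≡.refl

  0<1 : 0ℚ ℚ.< 1ℚ
  0<1 = ℚ.positive⁻¹ 1ℚ

  half : ∀ {ε} → 0ℚ ℚ.< ε → 0ℚ ℚ.< ε ℚ.* ℚ.½
  half {ε} 0<ε = ℚ.positive⁻¹ (ε ℚ.* ℚ.½)
    where instance
      _ = ℚ.positive 0<ε
      _ = ℚ.pos*pos⇒pos ε ℚ.½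

  -- If B > 0 and ε > 0 then some δ > 0 satisfies B δ + δ B = ε.
  shrink : ∀ {B ε} → 0ℚ ℚ.< B → 0ℚ ℚ.< ε →
           ∃[ δ ] 0ℚ ℚ.< δ × B ℚ.* δ ℚ.+ δ ℚ.* B ≡ ε
  shrink {B} {ε} 0<B 0<ε = δ , 0<δ , eq
    where
    instance
      B-pos = ℚ.positive 0<B
      B-nonZero = ℚ.pos⇒nonZero B
      _ = ℚ.1/pos⇒pos B
      _ = ℚ.positive (half 0<ε)
    δ = ε ℚ.* ℚ.½ ℚ.* ℚ.1/ B
    0<δ : 0ℚ ℚ.< δ
    0<δ = ℚ.positive⁻¹ δ {{ℚ.pos*pos⇒pos (ε ℚ.* ℚ.½) (ℚ.1/ B)}}
    δB : δ ℚ.* B ≡ ε ℚ.* ℚ.½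
    δB = ≡.trans (ℚ.*-assoc (ε ℚ.* ℚ.½) (ℚ.1/ B) B)
           (≡.trans (≡.cong (ε ℚ.* ℚ.½ ℚ.*_) (ℚ.*-inverseˡ B)) (ℚ.*-identityʳ _))
    eq : B ℚ.* δ ℚ.+ δ ℚ.* B ≡ ε
    eq = ≡.trans (≡.cong (ℚ._+ δ ℚ.* B) (ℚ.*-comm B δ))
           (≡.trans (≡.cong₂ ℚ._+_ δB δB) (half+half ε))

  abs-+-< : ∀ {p q r s ε} → p ≡ q ℚ.+ r → ∣ q ∣ ℚ.< s → ∣ r ∣ ℚ.< ε → ∣ p ∣ ℚ.< s ℚ.+ ε
  abs-+-< {p} {q} {r} {s} {ε} eq q<s r<ε = begin-strict
    ∣ p ∣            ≡⟨ ≡.cong ∣_∣ eq ⟩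
    ∣ q ℚ.+ r ∣      ≤⟨ ℚ.∣p+q∣≤∣p∣+∣q∣ q r ⟩
    ∣ q ∣ ℚ.+ ∣ r ∣  <⟨ ℚ.+-mono-< q<s r<ε ⟩
    s ℚ.+ ε          ∎
    where open ℚ.≤-Reasoning

  abs-*-< : ∀ {p q r s B δ} → 0ℚ ℚ.< B → 0ℚ ℚ.< δ →
            ∣ p ∣ ℚ.< B → ∣ s ∣ ℚ.< B → ∣ p ℚ.- r ∣ ℚ.< δ → ∣ q ℚ.- s ∣ ℚ.< δ →
            ∣ p ℚ.* q ℚ.- r ℚ.* s ∣ ℚ.< B ℚ.* δ ℚ.+ δ ℚ.* B
  abs-*-< {p} {q} {r} {s} {B} {δ} 0<B 0<δ p<B s<B pr<δ qs<δ =
    abs-+-< (split-* p q r s) (mul p<B qs<δ 0<B 0<δ) (mul pr<δ s<B 0<δ 0<B)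
    where
    open ℚ.≤-Reasoning
    mul : ∀ {x y C D} → ∣ x ∣ ℚ.< C → ∣ y ∣ ℚ.< D → 0ℚ ℚ.< C → 0ℚ ℚ.< D →
          ∣ x ℚ.* y ∣ ℚ.< C ℚ.* D
    mul {x} {y} {C} {D} x<C y<D 0<C 0<D = begin-strict
      ∣ x ℚ.* y ∣      ≡⟨ ℚ.∣p*q∣≡∣p∣*∣q∣ x y ⟩
      ∣ x ∣ ℚ.* ∣ y ∣  ≤⟨ ℚ.*-monoʳ-≤-nonNeg ∣ y ∣ {{ℚ.∣-∣-nonNeg y}} (ℚ.<⇒≤ x<C) ⟩
      C ℚ.* ∣ y ∣      <⟨ ℚ.*-monoʳ-<-pos C {{ℚ.positive 0<C}} y<D ⟩
      C ℚ.* D          ∎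

  bounded : ∀ x → ∃[ B ] 0ℚ ℚ.< B × ∃[ N ] ∀ n → N ℕ.≤ n → ∣ seq x n ∣ ℚ.< B
  bounded x = B , 0<B , N , bound
    where
    N = proj₁ (cauchy x 1ℚ 0<1)
    A = ∣ seq x N ∣ ℚ.+ 1ℚ
    B = A ℚ.+ 1ℚ
    near : ∣ seq x N ∣ ℚ.< A
    near = ≡.subst (ℚ._< A) (ℚ.+-identityʳ _) (ℚ.+-monoʳ-< ∣ seq x N ∣ 0<1)
    bound : ∀ n → N ℕ.≤ n → ∣ seq x n ∣ ℚ.< B
    bound n N≤n = abs-+-< (split-bound (seq x n) (seq x N)) near
      (proj₂ (cauchy x 1ℚ 0<1) n N N≤n ℕ.≤-refl)
    0<B : 0ℚ ℚ.< B
    0<B = ℚ.≤-<-trans (ℚ.0≤∣p∣ (seq x N)) (bound N ℕ.≤-refl)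

  ≤⊔ˡ : ∀ {m n o} → m ℕ.⊔ n ℕ.≤ o → m ℕ.≤ o
  ≤⊔ˡ {m} {n} = ℕ.m⊔n≤o⇒m≤o m n

  ≤⊔ʳ : ∀ {m n o} → m ℕ.⊔ n ℕ.≤ o → n ℕ.≤ o
  ≤⊔ʳ {m} {n} = ℕ.m⊔n≤o⇒n≤o m n

  ≗⇒≈ᵣ : ∀ {x y} → (∀ n → seq x n ≡ seq y n) → x ≈ᵣ y
  ≗⇒≈ᵣ {x} {y} eq = mk≈ᵣ λ ε 0<ε → 0 , λ n _ → ≡.subst (ℚ._< ε)
    (≡.cong ∣_∣ (≡.sym (≡.trans (≡.cong (ℚ._- seq y n) (eq n)) (ℚ.+-inverseʳ (seq y n))))) 0<ε

  ≈ᵣ-sym : ∀ {x y} → x ≈ᵣ y → y ≈ᵣ x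
  ≈ᵣ-sym {x} {y} x≈y = mk≈ᵣ λ ε 0<ε → let N , h = close x≈y ε 0<ε in
    N , λ n N≤n → ≡.subst (ℚ._< ε) (abs-swap (seq x n) (seq y n)) (h n N≤n)

  ≈ᵣ-trans : ∀ {x y z} → x ≈ᵣ y → y ≈ᵣ z → x ≈ᵣ z
  ≈ᵣ-trans {x} {y} {z} x≈y y≈z = mk≈ᵣ λ ε 0<ε →
    let M , f = close x≈y (ε ℚ.* ℚ.½) (half 0<ε)
        N , g = close y≈z (ε ℚ.* ℚ.½) (half 0<ε)
    in M ℕ.⊔ N , λ n h → ≡.subst (∣ seq x n ℚ.- seq z n ∣ ℚ.<_) (half+half ε)
         (abs-+-< (split-trans (seq x n) (seq y n) (seq z n)) (f n (≤⊔ˡ h)) (g n (≤⊔ʳ {M} h)))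

open RealLemmas

infixl 6 _+ᵣ_
infixl 7 _*ᵣ_
infix  8 -ᵣ_

constᵣ : ℚ → ℝ
seq    (constᵣ p) _ = p
cauchy (constᵣ p) ε 0<ε = 0 , λ _ _ _ _ →
  ≡.subst (ℚ._< ε) (≡.cong ∣_∣ (≡.sym (ℚ.+-inverseʳ p))) 0<ε

_+ᵣ_ : ℝ → ℝ → ℝ
seq    (x +ᵣ y) n = seq x n ℚ.+ seq y n
cauchy (x +ᵣ y) ε 0<ε =
  let M , f = cauchy x (ε ℚ.* ℚ.½) (half 0<ε)
      N , g = cauchy y (ε ℚ.* ℚ.½) (half 0<ε)
  in M ℕ.⊔ N , λ m n h k → ≡.subst (_ ℚ.<_) (half+half ε)
       (abs-+-< (split-+ (seq x m) (seq y m) (seq x n) (seq y n))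
         (f m n (≤⊔ˡ h) (≤⊔ˡ k)) (g m n (≤⊔ʳ {M} h) (≤⊔ʳ {M} k)))

-ᵣ_ : ℝ → ℝ
seq    (-ᵣ x) n = ℚ.- seq x n
cauchy (-ᵣ x) ε 0<ε =
  let N , f = cauchy x ε 0<ε
  in N , λ m n h k → ≡.subst (ℚ._< ε)
       (≡.cong ∣_∣ (≡.sym (split-neg (seq x m) (seq x n)))) (f n m k h)

private
  -- A common eventual bound for two Cauchy sequences.
  bounded₂ : ∀ x y → ∃[ B ] 0ℚ ℚ.< B × ∃[ N ] ∀ n → N ℕ.≤ n →
             ∣ seq x n ∣ ℚ.< B × ∣ seq y n ∣ ℚ.< B
  bounded₂ x y =
    let A , 0<A , M , f = bounded x
        B , 0<B , N , g = bounded y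
        A<A+B = ≡.subst (ℚ._< A ℚ.+ B) (ℚ.+-identityʳ A) (ℚ.+-monoʳ-< A 0<B)
        B<A+B = ≡.subst (ℚ._< A ℚ.+ B) (ℚ.+-identityˡ B) (ℚ.+-monoˡ-< B 0<A)
    in A ℚ.+ B , ℚ.<-trans 0<A A<A+B , M ℕ.⊔ N , λ n h →
       ℚ.<-trans (f n (≤⊔ˡ h)) A<A+B , ℚ.<-trans (g n (≤⊔ʳ {M} h)) B<A+B

_*ᵣ_ : ℝ → ℝ → ℝ
seq    (x *ᵣ y) n = seq x n ℚ.* seq y n
cauchy (x *ᵣ y) ε 0<ε =
  let B , 0<B , L , bd = bounded₂ x y
      δ , 0<δ , eq = shrink 0<B 0<ε
      M , f = cauchy x δ 0<δ
      N , g = cauchy y δ 0<δ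
  in L ℕ.⊔ (M ℕ.⊔ N) , λ m n h k → ≡.subst (_ ℚ.<_) eq
       (abs-*-< 0<B 0<δ (proj₁ (bd m (≤⊔ˡ h))) (proj₂ (bd n (≤⊔ˡ k)))
         (f m n (≤⊔ˡ (≤⊔ʳ {L} h)) (≤⊔ˡ (≤⊔ʳ {L} k)))
         (g m n (≤⊔ʳ {M} (≤⊔ʳ {L} h)) (≤⊔ʳ {M} (≤⊔ʳ {L} k))))

private
  +ᵣ-cong : ∀ {x x′ y y′} → x ≈ᵣ x′ → y ≈ᵣ y′ → x +ᵣ y ≈ᵣ x′ +ᵣ y′
  +ᵣ-cong {x} {x′} {y} {y′} x≈x′ y≈y′ = mk≈ᵣ λ ε 0<ε →
    let M , f = close x≈x′ (ε ℚ.* ℚ.½) (half 0<ε)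
        N , g = close y≈y′ (ε ℚ.* ℚ.½) (half 0<ε)
    in M ℕ.⊔ N , λ n h → ≡.subst (_ ℚ.<_) (half+half ε)
         (abs-+-< (split-+ (seq x n) (seq y n) (seq x′ n) (seq y′ n))
           (f n (≤⊔ˡ h)) (g n (≤⊔ʳ {M} h)))

  *ᵣ-cong : ∀ {x x′ y y′} → x ≈ᵣ x′ → y ≈ᵣ y′ → x *ᵣ y ≈ᵣ x′ *ᵣ y′
  *ᵣ-cong {x} {x′} {y} {y′} x≈x′ y≈y′ = mk≈ᵣ λ ε 0<ε →
    let B , 0<B , L , bd = bounded₂ x y′
        δ , 0<δ , eq = shrink 0<B 0<ε
        M , f = close x≈x′ δ 0<δ
        N , g = close y≈y′ δ 0<δ
    in L ℕ.⊔ (M ℕ.⊔ N) , λ n h → ≡.subst (_ ℚ.<_) eq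
         (abs-*-< 0<B 0<δ (proj₁ (bd n (≤⊔ˡ h))) (proj₂ (bd n (≤⊔ˡ h)))
           (f n (≤⊔ˡ (≤⊔ʳ {L} h))) (g n (≤⊔ʳ {M} (≤⊔ʳ {L} h))))

  -ᵣ-cong : ∀ {x y} → x ≈ᵣ y → -ᵣ x ≈ᵣ -ᵣ y
  -ᵣ-cong {x} {y} x≈y = mk≈ᵣ λ ε 0<ε →
    let N , f = close (≈ᵣ-sym x≈y) ε 0<ε
    in N , λ n h → ≡.subst (ℚ._< ε) (≡.cong ∣_∣ (≡.sym (split-neg (seq x n) (seq y n)))) (f n h)

  ℝ-isCommutativeRing : IsCommutativeRing _≈ᵣ_ _+ᵣ_ _*ᵣ_ -ᵣ_ (constᵣ 0ℚ) (constᵣ 1ℚ)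
  ℝ-isCommutativeRing = record
    { isRing = record
      { +-isAbelianGroup = record
        { isGroup = record
          { isMonoid = record
            { isSemigroup = record
              { isMagma = record
                { isEquivalence = record
                  { refl = ≗⇒≈ᵣ λ _ → ≡.refl ; sym = ≈ᵣ-sym ; trans = ≈ᵣ-trans }
                ; ∙-cong = +ᵣ-cong
                }
              ; assoc = λ x y z → ≗⇒≈ᵣ λ n → ℚ.+-assoc (seq x n) (seq y n) (seq z n)
              }
            ; identity = (λ x → ≗⇒≈ᵣ λ n → ℚ.+-identityˡ (seq x n))
                       , (λ x → ≗⇒≈ᵣ λ n → ℚ.+-identityʳ (seq x n))
            }
          ; inverse = (λ x → ≗⇒≈ᵣ λ n → ℚ.+-inverseˡ (seq x n))
                    , (λ x → ≗⇒≈ᵣ λ n → ℚ.+-inverseʳ (seq x n))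
          ; ⁻¹-cong = -ᵣ-cong
          }
        ; comm = λ x y → ≗⇒≈ᵣ λ n → ℚ.+-comm (seq x n) (seq y n)
        }
      ; *-cong = *ᵣ-cong
      ; *-assoc = λ x y z → ≗⇒≈ᵣ λ n → ℚ.*-assoc (seq x n) (seq y n) (seq z n)
      ; *-identity = (λ x → ≗⇒≈ᵣ λ n → ℚ.*-identityˡ (seq x n))
                   , (λ x → ≗⇒≈ᵣ λ n → ℚ.*-identityʳ (seq x n))
      ; distrib = (λ x y z → ≗⇒≈ᵣ λ n → ℚ.*-distribˡ-+ (seq x n) (seq y n) (seq z n))
                , (λ x y z → ≗⇒≈ᵣ λ n → ℚ.*-distribʳ-+ (seq x n) (seq y n) (seq z n))
      }
    ; *-comm = λ x y → ≗⇒≈ᵣ λ n → ℚ.*-comm (seq x n) (seq y n)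
    }

ℝ-commutativeRing : CommutativeRing 0ℓ 0ℓ
ℝ-commutativeRing = record { isCommutativeRing = ℝ-isCommutativeRing }

------------------------------------------------------------------------
-- Complex numbers

record ℂ : Set where
  no-eta-equality
  field
    re im : ℝ

open ℂ public

infix 4 _≈_

record _≈_ (z w : ℂ) : Set where
  constructor _,_
  field
    re≈ : re z ≈ᵣ re w
    im≈ : im z ≈ᵣ im w

open _≈_ public

infixl 6 _+_
infixl 7 _*_
infix  8 -_

0ℂ 1ℂ : ℂ
re 0ℂ = constᵣ 0ℚ
im 0ℂ = constᵣ 0ℚ
re 1ℂ = constᵣ 1ℚ
im 1ℂ = constᵣ 0ℚ

_+_ _*_ : ℂ → ℂ → ℂ
re (z + w) = re z +ᵣ re w
im (z + w) = im z +ᵣ im w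
re (z * w) = re z *ᵣ re w +ᵣ -ᵣ (im z *ᵣ im w)
im (z * w) = re z *ᵣ im w +ᵣ im z *ᵣ re w

-_ conj : ℂ → ℂ
re (- z) = -ᵣ re z
im (- z) = -ᵣ im z
re (conj z) = re z
im (conj z) = -ᵣ im z

private
  module ℝ-ring = CommutativeRing ℝ-commutativeRing

  module Identities (R : CommutativeRing c ℓ) where
    open CommutativeRing R
      renaming (_≈_ to _≈ₖ_; _+_ to _⊞_; _*_ to _⊠_; -_ to ⊟_)
    open RingProperties ring using (-‿distribˡ-*; -‿distribʳ-*; -‿+-comm)
    open CommutativeSemigroupProperties +-commutativeSemigroup using (interchange)
    open SetoidReasoning setoid

    rearrange : ∀ w x y z → (w ⊞ x) ⊞ (y ⊞ z) ≈ₖ (w ⊞ y) ⊞ (z ⊞ x)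
    rearrange w x y z = trans (interchange w x y z) (+-congˡ (+-comm x z))

    distribʳ-sub : ∀ x y z → (x ⊞ (⊟ y)) ⊠ z ≈ₖ (x ⊠ z) ⊞ (⊟ (y ⊠ z))
    distribʳ-sub x y z = trans (distribʳ z x (⊟ y)) (+-congˡ (sym (-‿distribˡ-* y z)))

    distribˡ-sub : ∀ x y z → x ⊠ (y ⊞ (⊟ z)) ≈ₖ (x ⊠ y) ⊞ (⊟ (x ⊠ z))
    distribˡ-sub x y z = trans (distribˡ x y (⊟ z)) (+-congˡ (sym (-‿distribʳ-* x z)))

    neg-distribʳ : ∀ x y z → ⊟ ((x ⊞ y) ⊠ z) ≈ₖ (⊟ (x ⊠ z)) ⊞ (⊟ (y ⊠ z))
    neg-distribʳ x y z = trans (-‿cong (distribʳ z x y)) (sym (-‿+-comm (x ⊠ z) (y ⊠ z)))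

    neg-distribˡ : ∀ x y z → ⊟ (x ⊠ (y ⊞ z)) ≈ₖ (⊟ (x ⊠ y)) ⊞ (⊟ (x ⊠ z))
    neg-distribˡ x y z = trans (-‿cong (distribˡ x y z)) (sym (-‿+-comm (x ⊠ y) (x ⊠ z)))

    assoc-re : ∀ a b c d e f →
      (((a ⊠ c) ⊞ (⊟ (b ⊠ d))) ⊠ e) ⊞ (⊟ (((a ⊠ d) ⊞ (b ⊠ c)) ⊠ f)) ≈ₖ
      (a ⊠ ((c ⊠ e) ⊞ (⊟ (d ⊠ f)))) ⊞ (⊟ (b ⊠ ((c ⊠ f) ⊞ (d ⊠ e))))
    assoc-re a b c d e f = begin
      (((a ⊠ c) ⊞ (⊟ (b ⊠ d))) ⊠ e) ⊞ (⊟ (((a ⊠ d) ⊞ (b ⊠ c)) ⊠ f))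
        ≈⟨ +-cong (distribʳ-sub (a ⊠ c) (b ⊠ d) e) (neg-distribʳ (a ⊠ d) (b ⊠ c) f) ⟩
      (((a ⊠ c) ⊠ e) ⊞ (⊟ ((b ⊠ d) ⊠ e))) ⊞ ((⊟ ((a ⊠ d) ⊠ f)) ⊞ (⊟ ((b ⊠ c) ⊠ f)))
        ≈⟨ +-cong (+-cong (*-assoc a c e) (-‿cong (*-assoc b d e)))
                  (+-cong (-‿cong (*-assoc a d f)) (-‿cong (*-assoc b c f))) ⟩
      ((a ⊠ (c ⊠ e)) ⊞ (⊟ (b ⊠ (d ⊠ e)))) ⊞ ((⊟ (a ⊠ (d ⊠ f))) ⊞ (⊟ (b ⊠ (c ⊠ f))))
        ≈⟨ rearrange _ _ _ _ ⟩
      ((a ⊠ (c ⊠ e)) ⊞ (⊟ (a ⊠ (d ⊠ f)))) ⊞ ((⊟ (b ⊠ (c ⊠ f))) ⊞ (⊟ (b ⊠ (d ⊠ e))))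
        ≈⟨ +-cong (distribˡ-sub a (c ⊠ e) (d ⊠ f)) (neg-distribˡ b (c ⊠ f) (d ⊠ e)) ⟨
      (a ⊠ ((c ⊠ e) ⊞ (⊟ (d ⊠ f)))) ⊞ (⊟ (b ⊠ ((c ⊠ f) ⊞ (d ⊠ e)))) ∎

    assoc-im : ∀ a b c d e f →
      (((a ⊠ c) ⊞ (⊟ (b ⊠ d))) ⊠ f) ⊞ (((a ⊠ d) ⊞ (b ⊠ c)) ⊠ e) ≈ₖ
      (a ⊠ ((c ⊠ f) ⊞ (d ⊠ e))) ⊞ (b ⊠ ((c ⊠ e) ⊞ (⊟ (d ⊠ f))))
    assoc-im a b c d e f = begin
      (((a ⊠ c) ⊞ (⊟ (b ⊠ d))) ⊠ f) ⊞ (((a ⊠ d) ⊞ (b ⊠ c)) ⊠ e)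
        ≈⟨ +-cong (distribʳ-sub (a ⊠ c) (b ⊠ d) f) (distribʳ e (a ⊠ d) (b ⊠ c)) ⟩
      (((a ⊠ c) ⊠ f) ⊞ (⊟ ((b ⊠ d) ⊠ f))) ⊞ (((a ⊠ d) ⊠ e) ⊞ ((b ⊠ c) ⊠ e))
        ≈⟨ +-cong (+-cong (*-assoc a c f) (-‿cong (*-assoc b d f)))
                  (+-cong (*-assoc a d e) (*-assoc b c e)) ⟩
      ((a ⊠ (c ⊠ f)) ⊞ (⊟ (b ⊠ (d ⊠ f)))) ⊞ ((a ⊠ (d ⊠ e)) ⊞ (b ⊠ (c ⊠ e)))
        ≈⟨ rearrange _ _ _ _ ⟩
      ((a ⊠ (c ⊠ f)) ⊞ (a ⊠ (d ⊠ e))) ⊞ ((b ⊠ (c ⊠ e)) ⊞ (⊟ (b ⊠ (d ⊠ f))))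
        ≈⟨ +-cong (distribˡ a (c ⊠ f) (d ⊠ e)) (distribˡ-sub b (c ⊠ e) (d ⊠ f)) ⟨
      (a ⊠ ((c ⊠ f) ⊞ (d ⊠ e))) ⊞ (b ⊠ ((c ⊠ e) ⊞ (⊟ (d ⊠ f)))) ∎

    comm-re : ∀ a b c d → (a ⊠ c) ⊞ (⊟ (b ⊠ d)) ≈ₖ (c ⊠ a) ⊞ (⊟ (d ⊠ b))
    comm-re a b c d = +-cong (*-comm a c) (-‿cong (*-comm b d))

    comm-im : ∀ a b c d → (a ⊠ d) ⊞ (b ⊠ c) ≈ₖ (c ⊠ b) ⊞ (d ⊠ a)
    comm-im a b c d = trans (+-comm (a ⊠ d) (b ⊠ c)) (+-cong (*-comm b c) (*-comm a d))

    distrib-re : ∀ a b c d e f →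
      (a ⊠ (c ⊞ e)) ⊞ (⊟ (b ⊠ (d ⊞ f))) ≈ₖ
      ((a ⊠ c) ⊞ (⊟ (b ⊠ d))) ⊞ ((a ⊠ e) ⊞ (⊟ (b ⊠ f)))
    distrib-re a b c d e f =
      trans (+-cong (distribˡ a c e) (neg-distribˡ b d f)) (interchange _ _ _ _)

    distrib-im : ∀ a b c d e f →
      (a ⊠ (d ⊞ f)) ⊞ (b ⊠ (c ⊞ e)) ≈ₖ
      ((a ⊠ d) ⊞ (b ⊠ c)) ⊞ ((a ⊠ f) ⊞ (b ⊠ e))
    distrib-im a b c d e f =
      trans (+-cong (distribˡ a d f) (distribˡ b c e)) (interchange _ _ _ _)

    one-re : ∀ a b → (1# ⊠ a) ⊞ (⊟ (0# ⊠ b)) ≈ₖ a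
    one-re a b = begin
      (1# ⊠ a) ⊞ (⊟ (0# ⊠ b))  ≈⟨ +-cong (*-identityˡ a) (-‿cong (zeroˡ b)) ⟩
      a ⊞ (⊟ 0#)               ≈⟨ +-congˡ (+-identityˡ (⊟ 0#)) ⟨
      a ⊞ (0# ⊞ (⊟ 0#))        ≈⟨ +-congˡ (-‿inverseʳ 0#) ⟩
      a ⊞ 0#                   ≈⟨ +-identityʳ a ⟩
      a                        ∎

    one-im : ∀ a b → (1# ⊠ b) ⊞ (0# ⊠ a) ≈ₖ b
    one-im a b = trans (+-cong (*-identityˡ b) (zeroˡ a)) (+-identityʳ b)

  open Identities ℝ-commutativeRing

  *-assoc : ∀ x y z → (x * y) * z ≈ x * (y * z)
  *-assoc x y z = assoc-re (re x) (im x) (re y) (im y) (re z) (im z)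
                , assoc-im (re x) (im x) (re y) (im y) (re z) (im z)

  *-comm : ∀ x y → x * y ≈ y * x
  *-comm x y = comm-re (re x) (im x) (re y) (im y) , comm-im (re x) (im x) (re y) (im y)

  *-distribˡ-+ : ∀ x y z → x * (y + z) ≈ x * y + x * z
  *-distribˡ-+ x y z = distrib-re (re x) (im x) (re y) (im y) (re z) (im z)
                     , distrib-im (re x) (im x) (re y) (im y) (re z) (im z)

  *-identityˡ : ∀ x → 1ℂ * x ≈ x
  *-identityˡ x = one-re (re x) (im x) , one-im (re x) (im x)

  ≈-refl : ∀ {z} → z ≈ z
  ≈-refl = ℝ-ring.refl , ℝ-ring.refl

  ≈-sym : ∀ {z w} → z ≈ w → w ≈ z
  ≈-sym (p , q) = ℝ-ring.sym p , ℝ-ring.sym q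

  ≈-trans : ∀ {z w v} → z ≈ w → w ≈ v → z ≈ v
  ≈-trans (p , q) (r , s) = ℝ-ring.trans p r , ℝ-ring.trans q s

  +-cong : ∀ {x x′ y y′} → x ≈ x′ → y ≈ y′ → x + y ≈ x′ + y′
  +-cong (p , q) (r , s) = ℝ-ring.+-cong p r , ℝ-ring.+-cong q s

  *-cong : ∀ {x x′ y y′} → x ≈ x′ → y ≈ y′ → x * y ≈ x′ * y′
  *-cong (p , q) (r , s) =
      ℝ-ring.+-cong (ℝ-ring.*-cong p r) (ℝ-ring.-‿cong (ℝ-ring.*-cong q s))
    , ℝ-ring.+-cong (ℝ-ring.*-cong p s) (ℝ-ring.*-cong q r)

  *-distribʳ-+ : ∀ x y z → (y + z) * x ≈ y * x + z * x
  *-distribʳ-+ x y z = ≈-trans (*-comm (y + z) x)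
    (≈-trans (*-distribˡ-+ x y z) (+-cong (*-comm x y) (*-comm x z)))

  ℂ-isCommutativeRing : IsCommutativeRing _≈_ _+_ _*_ -_ 0ℂ 1ℂ
  ℂ-isCommutativeRing = record
    { isRing = record
      { +-isAbelianGroup = record
        { isGroup = record
          { isMonoid = record
            { isSemigroup = record
              { isMagma = record
                { isEquivalence = record { refl = ≈-refl ; sym = ≈-sym ; trans = ≈-trans }
                ; ∙-cong = +-cong
                }
              ; assoc = λ x y z → ℝ-ring.+-assoc (re x) (re y) (re z)
                                , ℝ-ring.+-assoc (im x) (im y) (im z)
              }
            ; identity = (λ x → ℝ-ring.+-identityˡ (re x) , ℝ-ring.+-identityˡ (im x))
                       , (λ x → ℝ-ring.+-identityʳ (re x) , ℝ-ring.+-identityʳ (im x))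
            }
          ; inverse = (λ x → ℝ-ring.-‿inverseˡ (re x) , ℝ-ring.-‿inverseˡ (im x))
                    , (λ x → ℝ-ring.-‿inverseʳ (re x) , ℝ-ring.-‿inverseʳ (im x))
          ; ⁻¹-cong = λ (p , q) → ℝ-ring.-‿cong p , ℝ-ring.-‿cong q
          }
        ; comm = λ x y → ℝ-ring.+-comm (re x) (re y) , ℝ-ring.+-comm (im x) (im y)
        }
      ; *-cong = *-cong
      ; *-assoc = *-assoc
      ; *-identity = *-identityˡ , λ x → ≈-trans (*-comm x 1ℂ) (*-identityˡ x)
      ; distrib = *-distribˡ-+ , *-distribʳ-+
      }
    ; *-comm = *-comm
    }

ℂ-commutativeRing : CommutativeRing 0ℓ 0ℓ
ℂ-commutativeRing = record { isCommutativeRing = ℂ-isCommutativeRing }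

private
  module ℂ-ring = CommutativeRing ℂ-commutativeRing

infixr 8 _^_
infixl 6 _-_

_-_ : ℂ → ℂ → ℂ
_-_ = ℂ-ring._-_

_^_ : ℂ → ℕ → ℂ
_^_ = RawSemiringDefinitions._^_ (Semiring.rawSemiring ℂ-ring.semiring)

fromℕ : ℕ → ℂ
fromℕ n = RawSemiringDefinitions._×_ (Semiring.rawSemiring ℂ-ring.semiring) n 1ℂ

∑ : {A : Set a} → List A → (A → ℂ) → ℂ
∑ xs f = foldr (λ x s → f x + s) 0ℂ xs

∏ : ∀ {n} → Vector ℂ n → ℂ
∏ = RawMonoidDefinitions.sum (Monoid.rawMonoid ℂ-ring.*-monoid)

------------------------------------------------------------------------
-- Groups of units and characters

module _ (M : Monoid c ℓ) where
  open Monoid M renaming (_≈_ to _≈ₘ_)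
  open AlgebraDefinitions _≈ₘ_ using (Invertible)
  open SetoidReasoning setoid

  private
    cancel : ∀ x x⁻¹ y y⁻¹ → x ∙ x⁻¹ ≈ₘ ε → y ∙ y⁻¹ ≈ₘ ε → (x ∙ y) ∙ (y⁻¹ ∙ x⁻¹) ≈ₘ ε
    cancel x x⁻¹ y y⁻¹ p q = begin
      (x ∙ y) ∙ (y⁻¹ ∙ x⁻¹)  ≈⟨ assoc x y (y⁻¹ ∙ x⁻¹) ⟩
      x ∙ (y ∙ (y⁻¹ ∙ x⁻¹))  ≈⟨ ∙-congˡ (assoc y y⁻¹ x⁻¹) ⟨
      x ∙ ((y ∙ y⁻¹) ∙ x⁻¹)  ≈⟨ ∙-congˡ (∙-congʳ q) ⟩
      x ∙ (ε ∙ x⁻¹)          ≈⟨ ∙-congˡ (identityˡ x⁻¹) ⟩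
      x ∙ x⁻¹                ≈⟨ p ⟩
      ε                      ∎

  unitGroup : Group (c ⊔ ℓ) ℓ
  unitGroup = record
    { Carrier = Σ Carrier (Invertible ε _∙_)
    ; _≈_ = λ (x , _) (y , _) → x ≈ₘ y
    ; _∙_ = λ (x , x⁻¹ , p , p′) (y , y⁻¹ , q , q′) →
        x ∙ y , y⁻¹ ∙ x⁻¹ , cancel y⁻¹ y x⁻¹ x q p , cancel x x⁻¹ y y⁻¹ p′ q′
    ; ε = ε , ε , identityˡ ε , identityˡ ε
    ; _⁻¹ = λ (x , x⁻¹ , p , p′) → x⁻¹ , x , p′ , p
    ; isGroup = record
      { isMonoid = record
        { isSemigroup = record
          { isMagma = record
            { isEquivalence = record { refl = refl ; sym = sym ; trans = trans }
            ; ∙-cong = ∙-cong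
            }
          ; assoc = λ (x , _) (y , _) (z , _) → assoc x y z
          }
        ; identity = (λ (x , _) → identityˡ x) , (λ (x , _) → identityʳ x)
        }
      ; inverse = (λ (_ , _ , p , _) → p) , (λ (_ , _ , _ , p′) → p′)
      ; ⁻¹-cong = λ {(x , x⁻¹ , p , _)} {(y , y⁻¹ , _ , q′)} x≈y → begin
          x⁻¹               ≈⟨ identityʳ x⁻¹ ⟨
          x⁻¹ ∙ ε           ≈⟨ ∙-congˡ q′ ⟨
          x⁻¹ ∙ (y ∙ y⁻¹)   ≈⟨ ∙-congˡ (∙-congʳ x≈y) ⟨
          x⁻¹ ∙ (x ∙ y⁻¹)   ≈⟨ assoc x⁻¹ x y⁻¹ ⟨
          (x⁻¹ ∙ x) ∙ y⁻¹   ≈⟨ ∙-congʳ p ⟩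
          ε ∙ y⁻¹           ≈⟨ identityˡ y⁻¹ ⟩
          y⁻¹               ∎
      }
    }

infix 30 _ˣ

_ˣ : CommutativeRing c ℓ → Group (c ⊔ ℓ) ℓ
R ˣ = unitGroup (CommutativeRing.*-monoid R)

AdditiveCharacter : CommutativeRing c ℓ → Set (c ⊔ ℓ)
AdditiveCharacter R = GroupHomomorphism
  (Group.rawGroup (CommutativeRing.+-group R)) (Group.rawGroup (ℂ-commutativeRing ˣ))

MultiplicativeCharacter : CommutativeRing c ℓ → Set (c ⊔ ℓ)
MultiplicativeCharacter R = GroupHomomorphism
  (Group.rawGroup (R ˣ)) (Group.rawGroup (ℂ-commutativeRing ˣ))

IsTrivial : {G : RawGroup a ℓ₁} {H : RawGroup b ℓ₂} → GroupHomomorphism G H → Set (a ⊔ ℓ₂)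
IsTrivial {H = H} φ = ∀ x → RawGroup._≈_ H (GroupHomomorphism.⟦_⟧ φ x) (RawGroup.ε H)

------------------------------------------------------------------------
-- Linear algebra

module LinearAlgebra (R : CommutativeRing c ℓ) where
  open CommutativeRing R using (0#; 1#; +-monoid; semiring)
    renaming (Carrier to k; _≈_ to _≈ₖ_; _+_ to _+ₖ_; _*_ to _*ₖ_; -_ to -ₖ_)
  open RawMonoidDefinitions (Monoid.rawMonoid +-monoid) using (sum)
  open RawSemiringDefinitions (Semiring.rawSemiring semiring) using () renaming (_^_ to _^ₖ_)

  Matrix : ℕ → ℕ → Set c
  Matrix m n = Vector (Vector k n) m

  infix 4 _≈ᵥ_ _≈ₘ_

  _≈ᵥ_ : ∀ {n} → Vector k n → Vector k n → Set ℓ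
  v ≈ᵥ w = ∀ i → v i ≈ₖ w i

  _≈ₘ_ : ∀ {m n} → Matrix m n → Matrix m n → Set ℓ
  A ≈ₘ B = ∀ i j → A i j ≈ₖ B i j

  0ᵥ : ∀ {n} → Vector k n
  0ᵥ _ = 0#

  0ₘ : ∀ {m n} → Matrix m n
  0ₘ _ _ = 0#

  1ₘ : ∀ {n} → Matrix n n
  1ₘ zero    zero    = 1#
  1ₘ zero    (suc _) = 0#
  1ₘ (suc _) zero    = 0#
  1ₘ (suc i) (suc j) = 1ₘ i j

  infixl 7 _*ₘ_ _·_

  _*ₘ_ : ∀ {l m n} → Matrix l m → Matrix m n → Matrix l n
  (A *ₘ B) i j = sum λ s → A i s *ₖ B s j

  _·_ : ∀ {m n} → Matrix m n → Matrix m n → k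
  U · V = sum λ i → sum λ j → U i j *ₖ V i j

  -- Laplace expansion along the first row.
  det : ∀ {n} → Matrix n n → k
  det {zero}  A = 1#
  det {suc n} A = sum λ j →
    (-ₖ 1#) ^ₖ toℕ j *ₖ (A zero j *ₖ det λ i → removeAt (A (suc i)) j)

  IsInvertible : ∀ {n} → Matrix n n → Set (c ⊔ ℓ)
  IsInvertible = AlgebraDefinitions.Invertible _≈ₘ_ 1ₘ _*ₘ_

  combination : ∀ {d n} → Vector k d → Vector (Vector k n) d → Vector k n
  combination a b j = sum λ i → a i *ₖ b i j

  Span : ∀ {d n} → Vector (Vector k n) d → Pred (Vector k n) (c ⊔ ℓ)
  Span b v = ∃[ a ] v ≈ᵥ combination a b

  LinearlyIndependent : ∀ {d n} → Vector (Vector k n) d → Set (c ⊔ ℓ)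
  LinearlyIndependent b = ∀ a → combination a b ≈ᵥ 0ᵥ → a ≈ᵥ 0ᵥ

  HasDimension : ∀ {n} → Pred (Vector k n) p → ℕ → Set (c ⊔ ℓ ⊔ p)
  HasDimension S d = ∃[ b ]
    (∀ (i : Fin d) → S (b i)) × LinearlyIndependent b × (∀ v → S v → Span b v)

  columnSpace : ∀ {m n} → Matrix m n → Pred (Vector k m) (c ⊔ ℓ)
  columnSpace A = Span (flip A)

  HasRank : ∀ {m n} → Matrix m n → ℕ → Set (c ⊔ ℓ)
  HasRank A = HasDimension (columnSpace A)

------------------------------------------------------------------------
-- Finite fields and Gauss sums

IsPrimePower : ℕ → Set
IsPrimePower q = ∃[ p ] ∃[ m ] Prime p × 1 ℕ.≤ m × q ≡ p ℕ.^ m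

fieldRing : HeytingField c ℓ₁ ℓ₂ → CommutativeRing c ℓ₁
fieldRing K = HeytingCommutativeRing.commutativeRing (HeytingField.heytingCommutativeRing K)

-- The bijection makes _≈_ decidable, so that the apartness _#_ is its negation
-- and K is a finite field in the usual sense.
HasOrder : HeytingField c ℓ₁ ℓ₂ → ℕ → Set (c ⊔ ℓ₁)
HasOrder K q = Inverse (≡.setoid (Fin q)) (CommutativeRing.setoid (fieldRing K))

module GaussSums (K : HeytingField c ℓ₁ ℓ₂) {q : ℕ} (enumeration : HasOrder K q) where
  private
    R : CommutativeRing c ℓ₁
    R = fieldRing K

  open CommutativeRing R using (1#)
    renaming (Carrier to k; _≈_ to _≈ₖ_; _*_ to _*ₖ_)
  open LinearAlgebra R public

  elements : List k
  elements = List.tabulate (Inverse.to enumeration)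

  vectors : {A : Set a} → List A → ∀ n → List (Vector A n)
  vectors xs zero    = List.[ Vector.[] ]
  vectors xs (suc n) = cartesianProductWith Vector._∷_ xs (vectors xs n)

  matrices : ∀ m n → List (Matrix m n)
  matrices m n = vectors (vectors elements n) m

  IsUnit : Pred k (c ⊔ ℓ₁)
  IsUnit = AlgebraDefinitions.Invertible _≈ₖ_ 1# _*ₖ_

  private
    module R = CommutativeRing R

  infix 4 _≟_ _≟ₘ_

  _≟_ : Decidable _≈ₖ_
  _≟_ = via-injection (Inverse⇒Injection (Symmetry.inverse enumeration)) Fin._≟_

  elements-complete : ∀ x → Any (x ≈ₖ_) elements
  elements-complete x = Any.tabulate⁺ (Inverse.from enumeration x)
    (R.sym (Inverse.strictlyInverseˡ enumeration x))

  vectors-complete : {A : Set a} {_∼_ : A → A → Set ℓ} {xs : List A} →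
    (∀ x → Any (x ∼_) xs) →
    ∀ {n} (v : Vector A n) → Any (λ w → ∀ i → v i ∼ w i) (vectors xs n)
  vectors-complete complete {zero}  v = Any.here λ ()
  vectors-complete complete {suc n} v = Any.cartesianProductWith⁺ Vector._∷_
    (λ { p q zero → p ; p q (suc i) → q i })
    (complete (v zero)) (vectors-complete complete (v ∘ suc))

  matrices-complete : ∀ {m n} (A : Matrix m n) → Any (A ≈ₘ_) (matrices m n)
  matrices-complete = vectors-complete (vectors-complete elements-complete)

  search : {A : Set a} {_∼_ : A → A → Set ℓ} {P : Pred A p} {xs : List A} →
    (∀ x → Any (x ∼_) xs) → (∀ {x y} → x ∼ y → P x → P y) →
    Unary.Decidable P → Dec (∃ P)
  search {xs = xs} complete resp P? = map′ Any.satisfied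
    (λ (x , px) → Any.map (λ x∼y → resp x∼y px) (complete x)) (Any.any? P? xs)

  _≟ₘ_ : ∀ {m n} (A B : Matrix m n) → Dec (A ≈ₘ B)
  A ≟ₘ B = Fin.all? λ i → Fin.all? λ j → A i j ≟ B i j

  *ₘ-congˡ : ∀ {l m n} (A : Matrix l m) {B C : Matrix m n} → B ≈ₘ C → (A *ₘ B) ≈ₘ (A *ₘ C)
  *ₘ-congˡ A B≈C i j = MonoidSum.sum-cong-≋ R.+-monoid λ s → R.*-congˡ (B≈C s j)

  *ₘ-congʳ : ∀ {l m n} {A B : Matrix l m} (C : Matrix m n) → A ≈ₘ B → (A *ₘ C) ≈ₘ (B *ₘ C)
  *ₘ-congʳ C A≈B i j = MonoidSum.sum-cong-≋ R.+-monoid λ s → R.*-congʳ (A≈B i s)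

  isUnit? : Unary.Decidable IsUnit
  isUnit? x = search elements-complete
    (λ y≈z (p , q) → R.trans (R.*-congʳ (R.sym y≈z)) p , R.trans (R.*-congˡ (R.sym y≈z)) q)
    (λ y → (y *ₖ x ≟ 1#) ×-dec (x *ₖ y ≟ 1#))

  isInvertible? : ∀ {n} → Unary.Decidable (IsInvertible {n})
  isInvertible? X = search matrices-complete
    (λ {Y} {Z} Y≈Z (p , q) →
        (λ i j → R.trans (*ₘ-congʳ X (λ i j → R.sym (Y≈Z i j)) i j) (p i j))
      , (λ i j → R.trans (*ₘ-congˡ X (λ i j → R.sym (Y≈Z i j)) i j) (q i j)))
    (λ Y → (Y *ₘ X ≟ₘ 1ₘ) ×-dec (X *ₘ Y ≟ₘ 1ₘ))

  GL : ∀ n → List (Matrix n n)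
  GL n = filter isInvertible? (matrices n n)

  units : List k
  units = filter isUnit? elements

  Additive Multiplicative : Set (c ⊔ ℓ₁)
  Additive       = AdditiveCharacter R
  Multiplicative = MultiplicativeCharacter R

  infix 9 _⟨_⟩₊ _⟨_⟩ₓ

  _⟨_⟩₊ : Additive → k → ℂ
  ψ ⟨ x ⟩₊ = proj₁ (GroupHomomorphism.⟦_⟧ ψ x)

  extend : Multiplicative → ∀ x → Dec (IsUnit x) → ℂ
  extend χ x (yes u) = proj₁ (GroupHomomorphism.⟦_⟧ χ (x , u))
  extend χ x (no _)  = 0ℂ

  -- Agrees with χ on the units. The value 0 elsewhere only serves to make this
  -- total: it is applied to units and to determinants of invertible matrices.
  _⟨_⟩ₓ : Multiplicative → k → ℂ
  χ ⟨ x ⟩ₓ = extend χ x (isUnit? x)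

  gaussSum : Multiplicative → Additive → ℂ
  gaussSum χ ψ = ∑ units λ x → χ ⟨ x ⟩ₓ * ψ ⟨ x ⟩₊

  gaussSumGL : ∀ {n} → Matrix n n → Multiplicative → Additive → ℂ
  gaussSumGL {n} U χ ψ = ∑ (GL n) λ X → χ ⟨ det X ⟩ₓ * ψ ⟨ U · X ⟩₊

{-# OPTIONS --safe #-}
module Submission where

-- Extend χ by 0 to nonunits and write S(U) for the sum of χ(det X) ψ(U · X) over all matrices X;
-- by Cramer's rule this is the sum over GL. Adding a multiple of a row of U to another
-- row amounts to a row operation on X that preserves det X, so S is invariant under
-- transvections of rows and, by transposition, of columns, and a nonzero U may be
-- replaced by a block sum a ⊕ U′ with a ≠ 0. Averaging S(a ⊕ U′) over the addition to the
-- first row of X of all combinations of its other rows kills the terms in which X has a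
-- nonzero entry below its corner, and leaves S(a ⊕ U′) = χ̄(a) G(χ, ψ) qⁿ S(U′).
-- It remains to evaluate S(0). If χ ≠ 1, scaling the first row of X gives S(0) = χ(c) S(0).
-- If χ = 1, sum S over the matrices that vanish outside of their first row v: by
-- orthogonality the total is 0, and the terms with v ≠ 0 are the known value in rank one.
-- Ranks are compared through the preorder: A ≼ B if A = P B Q for some P and Q.

open import Defs
open import Algebra.Apartness.Bundles using (HeytingField)
open import Data.Fin.Base using (toℕ)
open import Data.Nat.Base using (ℕ; suc; _≤_; _<_; _∸_)
open import Data.Nat.Combinatorics using (_C_)
open import Data.Product.Base using (_×_)
open import Relation.Binary.PropositionalEquality.Core using (_≡_)
open import Relation.Nullary.Negation using (¬_)

open import Algebra.Bundles using (CommutativeRing; Group; Semiring)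
import Algebra.Definitions.RawSemiring as RawSemiringDefinitions
open import Algebra.Morphism.Bundles using (GroupHomomorphism)
import Algebra.Properties.CommutativeSemigroup as CommutativeSemigroupProperties
import Algebra.Properties.CommutativeSemiring.Exp as CommutativeSemiringExp
import Algebra.Properties.Group as GroupProperties
import Algebra.Properties.Monoid.Sum as MonoidSum
import Algebra.Properties.Ring as RingProperties
import Algebra.Properties.Semiring.Exp as SemiringExp
import Algebra.Properties.Semiring.Sum as SemiringSum
import Algebra.Solver.Ring.NaturalCoefficients.Default as SemiringSolver
open import Data.Empty using (⊥-elim)
open import Data.Fin.Base using (Fin; zero; suc; combine; finToFun; funToFin; lift; punchIn)
import Data.Fin.Properties as Fin
open import Data.List.Base as List using (List; []; _∷_; _++_; cartesianProductWith; filter; tabulate)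
open import Data.List.Membership.Propositional using (_∈_)
open import Data.List.Membership.Propositional.Properties using (∈-allFin)
open import Data.List.Relation.Unary.Any using (here; there)
open import Data.Nat.Base as ℕ using (zero; s≤s; z≤n)
open import Data.Nat.Combinatorics using (nC1≡n; nCk+nC[k+1]≡[n+1]C[k+1])
import Data.Nat.Properties as ℕ
open import Data.Product.Base using (∃-syntax; ∃₂; _,_; proj₁; proj₂)
open import Data.Rational.Base as ℚ using (ℚ; 0ℚ; 1ℚ; ∣_∣)
import Data.Rational.Properties as ℚ
open import Data.Rational.Solver using (module +-*-Solver)
open import Data.Sum.Base using (inj₁; inj₂)
open import Data.Unit.Polymorphic.Base using (⊤)
open import Data.Vec.Functional as Vector using (Vector; removeAt; updateAt)
open import Data.Vec.Functional.Properties using (updateAt-updates; updateAt-minimal)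
open import Function.Base using (_∘_; const; flip)
open import Function.Bundles using (Inverse)
open import Function.Definitions using (Injective)
open import Level using (Level; _⊔_)
open import Relation.Binary.Core using (Rel)
open import Relation.Binary.Definitions using (Decidable)
open import Relation.Binary.PropositionalEquality as ≡ using (_≢_)
import Relation.Binary.Reasoning.Setoid as SetoidReasoning
open import Relation.Nullary.Decidable using (Dec; yes; no)
open import Relation.Nullary.Negation using (contradiction)
import Relation.Unary as Unary

-- Nontriviality of a character is only the denial that all its values are 1, and equality in `ℂ` is
-- not decidable, so no argument with value other than 1 can be chosen. Sums are shown to vanish by
-- contradiction instead, which is sound because equality with zero is stable under double negation.
-- Averaging yields the recursion only after multiplication by a power of q, so `ℂ` must also admit
-- cancellation of nonzero factors. Characters take values in the units of `ℂ`, and that `conj`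
-- inverts these values is itself a claim: it holds because the units of a finite field have finite
-- order. The block that is left when a corner is removed may be zero, so the induction on the size
-- has to cover the zero matrix. In each size the nonzero matrices come first and use the smaller
-- size; the zero matrix then uses the rank one value in its own size. The rank is an output of this
-- induction and is compared with the given one at the end, by counting points. For trivial χ the
-- sign arises from the classical Gauss sum, which is -1 and enters once for each corner removed.

module ℂ-ring = CommutativeRing ℂ-commutativeRing

-- Real numbers: apartness from zero and stability of equality with zero

module ℝ-field where
  open RealLemmas

  0ᵣ : ℝ
  0ᵣ = constᵣ 0ℚ

  -- Being nonzero with a witness: a negated equality alone gives no lower bound by which to divide.
  Apart : ℝ → Set
  Apart x = ∃[ δ ] 0ℚ ℚ.< δ × ∃[ N ] ∀ n → N ℕ.≤ n → δ ℚ.≤ ∣ seq x n ∣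

  p-0≡p : ∀ p → p ℚ.- 0ℚ ≡.≡ p
  p-0≡p = ℚ.+-identityʳ

  ≈0-intro : ∀ {x} → (∀ ε → 0ℚ ℚ.< ε → ∃[ N ] ∀ n → N ℕ.≤ n → ∣ seq x n ∣ ℚ.< ε) → x ≈ᵣ 0ᵣ
  ≈0-intro {x} h = mk≈ᵣ λ ε 0<ε → let N , f = h ε 0<ε in N , λ n N≤n →
    ≡.subst (λ p → ∣ p ∣ ℚ.< ε) (≡.sym (p-0≡p (seq x n))) (f n N≤n)

  ≈0-elim : ∀ {x} → x ≈ᵣ 0ᵣ → ∀ ε → 0ℚ ℚ.< ε → ∃[ N ] ∀ n → N ℕ.≤ n → ∣ seq x n ∣ ℚ.< ε
  ≈0-elim {x} x≈0 ε 0<ε = let N , f = close x≈0 ε 0<ε in N , λ n N≤n →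
    ≡.subst (λ p → ∣ p ∣ ℚ.< ε) (p-0≡p (seq x n)) (f n N≤n)

  apart⇒≉0 : ∀ {x} → Apart x → ¬ x ≈ᵣ 0ᵣ
  apart⇒≉0 (δ , 0<δ , N , f) x≈0 =
    let M , g = ≈0-elim x≈0 δ 0<δ
    in ℚ.<-irrefl ≡.refl (ℚ.≤-<-trans (f (N ℕ.⊔ M) (ℕ.m≤m⊔n N M)) (g (N ℕ.⊔ M) (ℕ.m≤n⊔m N M)))

  -- The order of the rationals is decidable, so a single late term can be tested. Either it is
  -- below ε/2 and the tail stays below ε, or the tail keeps the distance ε/4 from 0, against the
  -- hypothesis.
  tight : ∀ {x} → ¬ Apart x → x ≈ᵣ 0ᵣ
  tight {x} ¬apart = ≈0-intro small
    where
    small : ∀ ε → 0ℚ ℚ.< ε → ∃[ N ] ∀ n → N ℕ.≤ n → ∣ seq x n ∣ ℚ.< ε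
    small ε 0<ε with cauchy x (ε ℚ.* ℚ.½ ℚ.* ℚ.½) (half (half 0<ε))
    ... | N , f with ∣ seq x N ∣ ℚ.<? ε ℚ.* ℚ.½
    ...   | yes xN<δ = N , λ n N≤n → ℚ.<-trans
            (abs-+-< (split-bound (seq x n) (seq x N)) xN<δ (f n N N≤n ℕ.≤-refl))
            (≡.subst (ε ℚ.* ℚ.½ ℚ.+ δ/2 ℚ.<_) (half+half ε) (ℚ.+-monoʳ-< (ε ℚ.* ℚ.½) δ/2<δ))
          where
          δ/2 = ε ℚ.* ℚ.½ ℚ.* ℚ.½
          δ/2<δ : δ/2 ℚ.< ε ℚ.* ℚ.½
          δ/2<δ = ≡.subst₂ ℚ._<_ (ℚ.+-identityʳ δ/2) (half+half (ε ℚ.* ℚ.½))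
            (ℚ.+-monoʳ-< δ/2 (half (half 0<ε)))
    ...   | no xN≮δ = ⊥-elim (¬apart (δ/2 , half (half 0<ε) , N , λ n N≤n → ℚ.≮⇒≥ λ xn<δ/2 →
            xN≮δ (≡.subst (∣ seq x N ∣ ℚ.<_) (half+half (ε ℚ.* ℚ.½))
              (abs-+-< (split-bound (seq x N) (seq x n)) xn<δ/2 (f N n ℕ.≤-refl N≤n)))))
          where δ/2 = ε ℚ.* ℚ.½ ℚ.* ℚ.½

  ≈0-stable : ∀ {x} → ¬ ¬ x ≈ᵣ 0ᵣ → x ≈ᵣ 0ᵣ
  ≈0-stable ¬¬x≈0 = tight λ apart → ¬¬x≈0 (apart⇒≉0 apart)

  -- From some index on, δ |y| ≤ |x y| < δ ε, and δ cancels.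
  *-cancelˡ-0 : ∀ {x y} → x *ᵣ y ≈ᵣ 0ᵣ → Apart x → y ≈ᵣ 0ᵣ
  *-cancelˡ-0 {x} {y} xy≈0 (δ , 0<δ , N , f) = ≈0-intro λ ε 0<ε →
    let instance
          δ-pos = ℚ.positive 0<δ
          ε-pos = ℚ.positive 0<ε
        M , g = ≈0-elim xy≈0 (δ ℚ.* ε) (ℚ.positive⁻¹ _ {{ℚ.pos*pos⇒pos δ ε}})
    in N ℕ.⊔ M , λ n h → ℚ.*-cancelˡ-<-nonNeg δ {{ℚ.pos⇒nonNeg δ}} (begin-strict
         δ ℚ.* ∣ seq y n ∣            ≤⟨ ℚ.*-monoʳ-≤-nonNeg ∣ seq y n ∣ {{ℚ.∣-∣-nonNeg (seq y n)}} (f n (≤⊔ˡ h)) ⟩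
         ∣ seq x n ∣ ℚ.* ∣ seq y n ∣  ≡⟨ ℚ.∣p*q∣≡∣p∣*∣q∣ (seq x n) (seq y n) ⟨
         ∣ seq x n ℚ.* seq y n ∣      <⟨ g n (≤⊔ʳ {N} h) ⟩
         δ ℚ.* ε                      ∎)
    where open ℚ.≤-Reasoning

  integral : ∀ {x y} → x *ᵣ y ≈ᵣ 0ᵣ → ¬ y ≈ᵣ 0ᵣ → x ≈ᵣ 0ᵣ
  integral xy≈0 y≉0 = tight λ apart → y≉0 (*-cancelˡ-0 xy≈0 apart)

  0≤p² : ∀ p → 0ℚ ℚ.≤ p ℚ.* p
  0≤p² p = ≡.subst (0ℚ ℚ.≤_) eq (ℚ.nonNegative⁻¹ _ {{nn}})
    where
    instance _ = ℚ.∣-∣-nonNeg p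
    nn = ℚ.nonNeg*nonNeg⇒nonNeg ∣ p ∣ ∣ p ∣
    eq : ∣ p ∣ ℚ.* ∣ p ∣ ≡.≡ p ℚ.* p
    eq with ℚ.∣p∣≡p∨∣p∣≡-p p
    ... | inj₁ e rewrite e = ≡.refl
    ... | inj₂ e rewrite e = solve 1 (λ p → :- p :* :- p := p :* p) ≡.refl p
      where open +-*-Solver

  -- If `x` kept the distance δ from 0, then δ² ≤ x² ≤ x² + y² < δ² at a late index.
  p²+q²≈0⇒p≈0 : ∀ {x y} → x *ᵣ x +ᵣ y *ᵣ y ≈ᵣ 0ᵣ → x ≈ᵣ 0ᵣ
  p²+q²≈0⇒p≈0 {x} {y} h = tight λ (δ , 0<δ , N , f) →
    let instance
          δ-pos = ℚ.positive 0<δ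
          δ-nonNeg = ℚ.pos⇒nonNeg δ
        M , g = ≈0-elim h (δ ℚ.* δ) (ℚ.positive⁻¹ _ {{ℚ.pos*pos⇒pos δ δ}})
        n = N ℕ.⊔ M
        p = seq x n
        q = seq y n
        δ≤p = f n (ℕ.m≤m⊔n N M)
    in ℚ.<-irrefl ≡.refl (begin-strict
         δ ℚ.* δ                    ≤⟨ ℚ.*-monoˡ-≤-nonNeg δ δ≤p ⟩
         δ ℚ.* ∣ p ∣                ≤⟨ ℚ.*-monoʳ-≤-nonNeg ∣ p ∣ {{ℚ.∣-∣-nonNeg p}} δ≤p ⟩
         ∣ p ∣ ℚ.* ∣ p ∣            ≡⟨ ℚ.∣p*q∣≡∣p∣*∣q∣ p p ⟨
         ∣ p ℚ.* p ∣                ≡⟨ ℚ.0≤p⇒∣p∣≡p (0≤p² p) ⟩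
         p ℚ.* p                    ≡⟨ ℚ.+-identityʳ (p ℚ.* p) ⟨
         p ℚ.* p ℚ.+ 0ℚ             ≤⟨ ℚ.+-monoʳ-≤ (p ℚ.* p) (0≤p² q) ⟩
         p ℚ.* p ℚ.+ q ℚ.* q        ≤⟨ p≤∣p∣ (p ℚ.* p ℚ.+ q ℚ.* q) ⟩
         ∣ p ℚ.* p ℚ.+ q ℚ.* q ∣    <⟨ g n (ℕ.m≤n⊔m N M) ⟩
         δ ℚ.* δ                    ∎)
    where
    open ℚ.≤-Reasoning
    p≤∣p∣ : ∀ p → p ℚ.≤ ∣ p ∣
    p≤∣p∣ p with ℚ.≤-total 0ℚ p
    ... | inj₁ 0≤p = ℚ.≤-reflexive (≡.sym (ℚ.0≤p⇒∣p∣≡p 0≤p))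
    ... | inj₂ p≤0 = ℚ.≤-trans p≤0 (ℚ.0≤∣p∣ p)

  ∣_∣² : ℂ → ℝ
  ∣ z ∣² = re z *ᵣ re z +ᵣ im z *ᵣ im z

open ℝ-field using (0ᵣ; ∣_∣²)

-- Complex numbers: absence of zero divisors, and the norm of roots of unity

module ℂ-field where
  open ℝ-field hiding (integral; ≈0-stable)
  open +-*-Solver

  z≈0⇒∣z∣²≈0 : ∀ {z} → z ≈ 0ℂ → ∣ z ∣² ≈ᵣ 0ᵣ
  z≈0⇒∣z∣²≈0 {z} (p , q) = R.trans (R.+-cong (R.*-cong p p) (R.*-cong q q))
    (RealLemmas.≗⇒≈ᵣ λ _ → ≡.refl)
    where module R = CommutativeRing ℝ-commutativeRing

  ∣z∣²≈0⇒z≈0 : ∀ {z} → ∣ z ∣² ≈ᵣ 0ᵣ → z ≈ 0ℂ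
  ∣z∣²≈0⇒z≈0 {z} h = p²+q²≈0⇒p≈0 {re z} {im z} h
                    , p²+q²≈0⇒p≈0 {im z} {re z} (R.trans (R.+-comm _ _) h)
    where module R = CommutativeRing ℝ-commutativeRing

  -- The two-squares identity. The operations act termwise on representatives, so it is checked in
  -- the rationals at each index.
  ∣∣²-* : ∀ z w → ∣ z ∣² *ᵣ ∣ w ∣² ≈ᵣ ∣ z * w ∣²
  ∣∣²-* z w = RealLemmas.≗⇒≈ᵣ λ n → solve 4 (λ a b c d →
      (a :* a :+ b :* b) :* (c :* c :+ d :* d) :=
      (a :* c :+ :- (b :* d)) :* (a :* c :+ :- (b :* d)) :+
      (a :* d :+ b :* c) :* (a :* d :+ b :* c)) ≡.refl
    (seq (re z) n) (seq (im z) n) (seq (re w) n) (seq (im w) n)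

  integral : ∀ {z w} → z * w ≈ 0ℂ → ¬ w ≈ 0ℂ → z ≈ 0ℂ
  integral {z} {w} zw≈0 w≉0 = ∣z∣²≈0⇒z≈0 (ℝ-field.integral
    (R.trans (∣∣²-* z w) (z≈0⇒∣z∣²≈0 zw≈0)) (λ h → w≉0 (∣z∣²≈0⇒z≈0 h)))
    where module R = CommutativeRing ℝ-commutativeRing

  ≈0-stable : ∀ {z} → ¬ ¬ z ≈ 0ℂ → z ≈ 0ℂ
  ≈0-stable ¬¬z≈0 = ℝ-field.≈0-stable (λ h → ¬¬z≈0 λ (p , _) → h p)
                  , ℝ-field.≈0-stable (λ h → ¬¬z≈0 λ (_ , q) → h q)

  ι : ℝ → ℂ
  re (ι x) = x
  im (ι x) = 0ᵣ

  -- Asks for a representative without negative terms, which makes closure under sums and products a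
  -- termwise check.
  NonNegative : ℂ → Set
  NonNegative z = ∃[ x ] (∀ n → 0ℚ ℚ.≤ seq x n) × z ≈ ι x

  ι-+ : ∀ x y → ι x + ι y ≈ ι (x +ᵣ y)
  ι-+ x y = RealLemmas.≗⇒≈ᵣ (λ _ → ≡.refl) , RealLemmas.≗⇒≈ᵣ (λ _ → ≡.refl)

  ι-* : ∀ x y → ι x * ι y ≈ ι (x *ᵣ y)
  ι-* x y =
      RealLemmas.≗⇒≈ᵣ (λ n → solve 2 (λ a b → a :* b :+ :- (con 0ℚ :* con 0ℚ) := a :* b) ≡.refl (seq x n) (seq y n))
    , RealLemmas.≗⇒≈ᵣ (λ n → solve 2 (λ a b → a :* con 0ℚ :+ con 0ℚ :* b := con 0ℚ) ≡.refl (seq x n) (seq y n))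

  0-nonNegative : NonNegative 0ℂ
  0-nonNegative = 0ᵣ , (λ _ → ℚ.≤-refl) , RealLemmas.≗⇒≈ᵣ (λ _ → ≡.refl) , RealLemmas.≗⇒≈ᵣ (λ _ → ≡.refl)

  1-nonNegative : NonNegative 1ℂ
  1-nonNegative = constᵣ 1ℚ , (λ _ → ℚ.nonNegative⁻¹ 1ℚ)
                , RealLemmas.≗⇒≈ᵣ (λ _ → ≡.refl) , RealLemmas.≗⇒≈ᵣ (λ _ → ≡.refl)

  +-nonNegative : ∀ {z w} → NonNegative z → NonNegative w → NonNegative (z + w)
  +-nonNegative (x , 0≤x , z≈x) (y , 0≤y , w≈y) =
    x +ᵣ y , (λ n → ℚ.+-mono-≤ (0≤x n) (0≤y n)) , ℂ-ring.trans (ℂ-ring.+-cong z≈x w≈y) (ι-+ x y)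

  *-nonNegative : ∀ {z w} → NonNegative z → NonNegative w → NonNegative (z * w)
  *-nonNegative (x , 0≤x , z≈x) (y , 0≤y , w≈y) =
    x *ᵣ y
    , (λ n → ℚ.nonNegative⁻¹ _ {{ℚ.nonNeg*nonNeg⇒nonNeg
        (seq x n) {{ℚ.nonNegative (0≤x n)}} (seq y n) {{ℚ.nonNegative (0≤y n)}}}})
    , ℂ-ring.trans (ℂ-ring.*-cong z≈x w≈y) (ι-* x y)

  -- Some representative has all its terms at least 1, which is apartness with the bound 1. This
  -- keeps the order of the field and the geometric sums away from zero.
  1+nonNegative≉0 : ∀ {z} → NonNegative z → ¬ 1ℂ + z ≈ 0ℂ
  1+nonNegative≉0 {z} (x , 0≤x , z≈x) 1+z≈0 = apart⇒≉0
    (1ℚ , RealLemmas.0<1 , 0 , λ n _ → bound n)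
    (re≈ (ℂ-ring.trans (ℂ-ring.+-congˡ (ℂ-ring.sym z≈x)) 1+z≈0))
    where
    bound : ∀ n → 1ℚ ℚ.≤ ∣ 1ℚ ℚ.+ seq x n ∣
    bound n = ≡.subst (1ℚ ℚ.≤_) (≡.sym (ℚ.0≤p⇒∣p∣≡p (ℚ.≤-trans (ℚ.nonNegative⁻¹ 1ℚ) 1≤)))
      1≤
      where
      1≤ : 1ℚ ℚ.≤ 1ℚ ℚ.+ seq x n
      1≤ = ℚ.+-monoʳ-≤ 1ℚ (0≤x n)

  z*conj-z-nonNegative : ∀ z → NonNegative (z * conj z)
  z*conj-z-nonNegative z = ∣ z ∣²
    , (λ n → ℚ.+-mono-≤ (0≤p² (seq (re z) n)) (0≤p² (seq (im z) n)))
    , RealLemmas.≗⇒≈ᵣ (λ n → solve 2 (λ a b → a :* a :+ :- (b :* :- b) := a :* a :+ b :* b) ≡.refl (seq (re z) n) (seq (im z) n))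
    , RealLemmas.≗⇒≈ᵣ (λ n → solve 2 (λ a b → a :* :- b :+ b :* a := con 0ℚ) ≡.refl (seq (re z) n) (seq (im z) n))

  conj-cong : ∀ {z w} → z ≈ w → conj z ≈ conj w
  conj-cong (p , q) = p , R.-‿cong q
    where module R = CommutativeRing ℝ-commutativeRing

  conj-* : ∀ z w → conj (z * w) ≈ conj z * conj w
  conj-* z w =
      RealLemmas.≗⇒≈ᵣ (λ n → solve 4 (λ a b c d → a :* c :+ :- (b :* d) := a :* c :+ :- (:- b :* :- d)) ≡.refl
        (seq (re z) n) (seq (im z) n) (seq (re w) n) (seq (im w) n))
    , RealLemmas.≗⇒≈ᵣ (λ n → solve 4 (λ a b c d → :- (a :* d :+ b :* c) := a :* :- d :+ :- b :* c) ≡.refl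
        (seq (re z) n) (seq (im z) n) (seq (re w) n) (seq (im w) n))

  conj-1 : conj 1ℂ ≈ 1ℂ
  conj-1 = RealLemmas.≗⇒≈ᵣ (λ _ → ≡.refl) , RealLemmas.≗⇒≈ᵣ (λ _ → ≡.refl)

  fromℕ-nonNegative : ∀ n → NonNegative (fromℕ n)
  fromℕ-nonNegative zero    = 0-nonNegative
  fromℕ-nonNegative (suc n) = +-nonNegative 1-nonNegative (fromℕ-nonNegative n)

  -- The sum of the first `m` powers of `w` in Horner form, the cofactor of `w - 1ℂ` in
  -- `w ^ m - 1ℂ`.
  geometric : ℂ → ℕ → ℂ
  geometric w zero    = 0ℂ
  geometric w (suc m) = 1ℂ + w * geometric w m

  geometric-nonNegative : ∀ {w} → NonNegative w → ∀ m → NonNegative (geometric w m)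
  geometric-nonNegative w≥0 zero    = 0-nonNegative
  geometric-nonNegative w≥0 (suc m) = +-nonNegative 1-nonNegative (*-nonNegative w≥0 (geometric-nonNegative w≥0 m))

  module _ where
    open ℂ-ring using (setoid; +-cong; +-congˡ; +-congʳ; *-congˡ; *-congʳ; *-cong; zeroʳ; distribˡ;
      *-identityʳ; -‿inverseʳ; *-assoc; *-comm; +-assoc; +-comm; +-identityʳ; +-identityˡ)
    open SetoidReasoning setoid

    geometric-sum : ∀ w m → (w - 1ℂ) * geometric w m + 1ℂ ≈ w ^ m
    geometric-sum w zero    = ℂ-ring.trans (+-congʳ (zeroʳ _)) (+-identityˡ 1ℂ)
    geometric-sum w (suc m) = begin
      (w - 1ℂ) * (1ℂ + w * geometric w m) + 1ℂ            ≈⟨ +-congʳ (distribˡ _ _ _) ⟩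
      (w - 1ℂ) * 1ℂ + (w - 1ℂ) * (w * geometric w m) + 1ℂ ≈⟨ +-congʳ (+-cong (*-identityʳ _) (ℂ-ring.sym (*-assoc _ _ _))) ⟩
      w - 1ℂ + (w - 1ℂ) * w * geometric w m + 1ℂ          ≈⟨ +-congʳ (+-congˡ (*-congʳ (*-comm _ _))) ⟩
      w - 1ℂ + w * (w - 1ℂ) * geometric w m + 1ℂ          ≈⟨ +-congʳ (+-congˡ (*-assoc _ _ _)) ⟩
      w - 1ℂ + w * ((w - 1ℂ) * geometric w m) + 1ℂ        ≈⟨ +-congʳ (+-comm _ _) ⟩
      w * ((w - 1ℂ) * geometric w m) + (w - 1ℂ) + 1ℂ      ≈⟨ +-assoc _ _ _ ⟩
      w * ((w - 1ℂ) * geometric w m) + (w - 1ℂ + 1ℂ)      ≈⟨ +-congˡ (+-assoc _ _ _) ⟩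
      w * ((w - 1ℂ) * geometric w m) + (w + (- 1ℂ + 1ℂ))  ≈⟨ +-congˡ (+-congˡ (ℂ-ring.-‿inverseˡ 1ℂ)) ⟩
      w * ((w - 1ℂ) * geometric w m) + (w + 0ℂ)           ≈⟨ +-congˡ (+-identityʳ w) ⟩
      w * ((w - 1ℂ) * geometric w m) + w                  ≈⟨ +-congˡ (*-identityʳ w) ⟨
      w * ((w - 1ℂ) * geometric w m) + w * 1ℂ             ≈⟨ distribˡ _ _ _ ⟨
      w * ((w - 1ℂ) * geometric w m + 1ℂ)                 ≈⟨ *-congˡ (geometric-sum w m) ⟩
      w * w ^ m                                           ∎

    x-y≈0⇒x≈y : ∀ {x y} → x - y ≈ 0ℂ → x ≈ y
    x-y≈0⇒x≈y {x} {y} = x∙y⁻¹≈ε⇒x≈y x y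
      where open GroupProperties ℂ-ring.+-group using (x∙y⁻¹≈ε⇒x≈y)

    x≈y⇒x-y≈0 : ∀ {x y} → x ≈ y → x - y ≈ 0ℂ
    x≈y⇒x-y≈0 {x} {y} x≈y = ℂ-ring.trans (+-congʳ x≈y) (-‿inverseʳ y)

    conj-^ : ∀ z m → conj (z ^ m) ≈ conj z ^ m
    conj-^ z zero    = conj-1
    conj-^ z (suc m) = ℂ-ring.trans (conj-* z (z ^ m)) (*-congˡ (conj-^ z m))

    -- The squared norm w is a nonnegative real with w^(m+1) = 1. In the factorization of w^(m+1) -
    -- 1 the geometric sum is 1 plus something nonnegative, so it is the factor w - 1 that vanishes.
    root-of-unity⇒unitary : ∀ z m → z ^ suc m ≈ 1ℂ → z * conj z ≈ 1ℂ
    root-of-unity⇒unitary z m z^m≈1 = x-y≈0⇒x≈y (integral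
      (identityˡ-unique _ 1ℂ (ℂ-ring.trans (geometric-sum w (suc m)) w^m≈1))
      (1+nonNegative≉0 (*-nonNegative w≥0 (geometric-nonNegative w≥0 m))))
      where
      open GroupProperties ℂ-ring.+-group using (identityˡ-unique)
      open CommutativeSemiringExp ℂ-ring.commutativeSemiring using (^-distrib-*)
      w = z * conj z
      w≥0 = z*conj-z-nonNegative z
      w^m≈1 : w ^ suc m ≈ 1ℂ
      w^m≈1 = begin
        (z * conj z) ^ suc m        ≈⟨ ^-distrib-* z (conj z) (suc m) ⟩
        z ^ suc m * conj z ^ suc m  ≈⟨ *-congˡ (conj-^ z (suc m)) ⟨
        z ^ suc m * conj (z ^ suc m) ≈⟨ *-cong z^m≈1 (ℂ-ring.trans (conj-cong z^m≈1) conj-1) ⟩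
        1ℂ * 1ℂ                     ≈⟨ *-identityʳ 1ℂ ⟩
        1ℂ                          ∎

-- Finite sums over lists and indicator functions

module Sums where
  private
    variable
      a b ℓ ℓ′ ℓ₁ ℓ₂ p : Level
      A B C : Set a

  open ℂ-ring using (refl; sym; trans; setoid; +-cong; +-congˡ; +-congʳ; *-congˡ; *-congʳ;
    zeroˡ; zeroʳ; distribˡ; distribʳ; +-identityˡ; +-identityʳ; +-assoc; *-identityˡ; *-identityʳ)
  open CommutativeSemigroupProperties ℂ-ring.+-commutativeSemigroup using (interchange)
  open SetoidReasoning setoid

  ∑-cong : ∀ (xs : List A) {F G : A → ℂ} → (∀ x → F x ≈ G x) → ∑ xs F ≈ ∑ xs G
  ∑-cong []       F≈G = refl
  ∑-cong (x ∷ xs) F≈G = +-cong (F≈G x) (∑-cong xs F≈G)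

  ∑-zero : ∀ (xs : List A) {F : A → ℂ} → (∀ x → F x ≈ 0ℂ) → ∑ xs F ≈ 0ℂ
  ∑-zero []       F≈0 = refl
  ∑-zero (x ∷ xs) F≈0 = trans (+-cong (F≈0 x) (∑-zero xs F≈0)) (+-identityʳ 0ℂ)

  ∑-+ : ∀ (xs : List A) (F G : A → ℂ) → ∑ xs (λ x → F x + G x) ≈ ∑ xs F + ∑ xs G
  ∑-+ []       F G = sym (+-identityʳ 0ℂ)
  ∑-+ (x ∷ xs) F G = trans (+-congˡ (∑-+ xs F G)) (interchange _ _ _ _)

  *-distribˡ-∑ : ∀ z (xs : List A) (F : A → ℂ) → z * ∑ xs F ≈ ∑ xs (λ x → z * F x)
  *-distribˡ-∑ z []       F = zeroʳ z
  *-distribˡ-∑ z (x ∷ xs) F = trans (distribˡ z _ _) (+-congˡ (*-distribˡ-∑ z xs F))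

  *-distribʳ-∑ : ∀ z (xs : List A) (F : A → ℂ) → ∑ xs F * z ≈ ∑ xs (λ x → F x * z)
  *-distribʳ-∑ z []       F = zeroˡ z
  *-distribʳ-∑ z (x ∷ xs) F = trans (distribʳ z _ _) (+-congˡ (*-distribʳ-∑ z xs F))

  ∑-swap : ∀ (xs : List A) (ys : List B) (F : A → B → ℂ) →
           ∑ xs (λ x → ∑ ys (F x)) ≈ ∑ ys (λ y → ∑ xs (λ x → F x y))
  ∑-swap []       ys F = sym (∑-zero ys λ _ → refl)
  ∑-swap (x ∷ xs) ys F = trans (+-congˡ (∑-swap xs ys F)) (sym (∑-+ ys (F x) _))

  ∑-product : ∀ (xs : List A) (ys : List B) (F : A → ℂ) (G : B → ℂ) →
              ∑ xs (λ x → ∑ ys (λ y → F x * G y)) ≈ ∑ xs F * ∑ ys G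
  ∑-product xs ys F G = begin
    ∑ xs (λ x → ∑ ys (λ y → F x * G y))  ≈⟨ ∑-cong xs (λ x → *-distribˡ-∑ (F x) ys G) ⟨
    ∑ xs (λ x → F x * ∑ ys G)            ≈⟨ *-distribʳ-∑ (∑ ys G) xs F ⟨
    ∑ xs F * ∑ ys G                      ∎

  ∑-++ : ∀ (xs ys : List A) (F : A → ℂ) → ∑ (xs ++ ys) F ≈ ∑ xs F + ∑ ys F
  ∑-++ []       ys F = sym (+-identityˡ _)
  ∑-++ (x ∷ xs) ys F = trans (+-congˡ (∑-++ xs ys F)) (sym (+-assoc _ _ _))

  ∑-map : ∀ (f : A → B) (xs : List A) (F : B → ℂ) → ∑ (List.map f xs) F ≈ ∑ xs (F ∘ f)
  ∑-map f []       F = refl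
  ∑-map f (x ∷ xs) F = +-congˡ (∑-map f xs F)

  ∑-cartesianProductWith : ∀ (f : A → B → C) (xs : List A) (ys : List B) (F : C → ℂ) →
    ∑ (cartesianProductWith f xs ys) F ≈ ∑ xs (λ x → ∑ ys (λ y → F (f x y)))
  ∑-cartesianProductWith f []       ys F = refl
  ∑-cartesianProductWith f (x ∷ xs) ys F = trans (∑-++ (List.map (f x) ys) _ F)
    (+-cong (∑-map (f x) ys F) (∑-cartesianProductWith f xs ys F))

  ∑-filter : ∀ {P : A → Set p} (P? : Unary.Decidable P) (xs : List A) {F : A → ℂ} →
             (∀ x → ¬ P x → F x ≈ 0ℂ) → ∑ (filter P? xs) F ≈ ∑ xs F
  ∑-filter P? []       F≈0 = refl
  ∑-filter P? (x ∷ xs) F≈0 with P? x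
  ... | yes _  = +-congˡ (∑-filter P? xs F≈0)
  ... | no ¬Px = trans (∑-filter P? xs F≈0)
    (sym (trans (+-congʳ (F≈0 x ¬Px)) (+-identityˡ _)))

  𝟙 : {P : Set p} → Dec P → ℂ
  𝟙 (yes _) = 1ℂ
  𝟙 (no _)  = 0ℂ

  𝟙-cong : ∀ {P : Set p} {Q : Set ℓ} (d : Dec P) (e : Dec Q) → (P → Q) → (Q → P) → 𝟙 d ≈ 𝟙 e
  𝟙-cong (yes _) (yes _) _   _   = refl
  𝟙-cong (yes p) (no ¬q) P→Q _   = contradiction (P→Q p) ¬q
  𝟙-cong (no ¬p) (yes q) _   Q→P = contradiction (Q→P q) ¬p
  𝟙-cong (no _)  (no _)  _   _   = refl

  𝟙-× : ∀ {P : Set p} {Q : Set ℓ} {R : Set ℓ′} (d : Dec P) (e : Dec Q) (f : Dec R) →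
        (P → Q × R) → (Q → R → P) → 𝟙 d ≈ 𝟙 e * 𝟙 f
  𝟙-× (yes _) (yes _) (yes _) _   _   = sym (*-identityʳ 1ℂ)
  𝟙-× (no ¬p) (yes q) (yes r) _   QRP = contradiction (QRP q r) ¬p
  𝟙-× (yes p) (no ¬q) _       PQR _   = contradiction (proj₁ (PQR p)) ¬q
  𝟙-× (no _)  (no _)  _       _   _   = sym (zeroˡ _)
  𝟙-× (yes p) (yes _) (no ¬r) PQR _   = contradiction (proj₂ (PQR p)) ¬r
  𝟙-× (no _)  (yes _) (no _)  _   _   = sym (zeroʳ _)

  𝟙-yes : ∀ {P : Set p} (d : Dec P) → P → 𝟙 d ≈ 1ℂ
  𝟙-yes (yes _) p = refl
  𝟙-yes (no ¬p) p = contradiction p ¬p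

  𝟙-no : ∀ {P : Set p} (d : Dec P) → ¬ P → 𝟙 d ≈ 0ℂ
  𝟙-no (yes p) ¬p = contradiction p ¬p
  𝟙-no (no _)  _  = refl

  𝟙-*-cong : ∀ {P : Set p} (d : Dec P) {z w} → (P → z ≈ w) → 𝟙 d * z ≈ 𝟙 d * w
  𝟙-*-cong (yes p) z≈w = *-congˡ (z≈w p)
  𝟙-*-cong (no _)  _   = trans (zeroˡ _) (sym (zeroˡ _))

  ∑-tabulate-zero : ∀ {n} (f : Fin n → A) (F : A → ℂ) → (∀ j → F (f j) ≈ 0ℂ) → ∑ (tabulate f) F ≈ 0ℂ
  ∑-tabulate-zero {n = zero}  f F F≈0 = refl
  ∑-tabulate-zero {n = suc n} f F F≈0 =
    trans (+-cong (F≈0 zero) (∑-tabulate-zero (f ∘ suc) F (F≈0 ∘ suc))) (+-identityʳ 0ℂ)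

  ∑-tabulate-single : ∀ {n} (f : Fin n → A) (F : A → ℂ) i →
    F (f i) ≈ 1ℂ → (∀ j → j ≢ i → F (f j) ≈ 0ℂ) → ∑ (tabulate f) F ≈ 1ℂ
  ∑-tabulate-single {n = suc n} f F zero Fi Fj = trans
    (+-cong Fi (∑-tabulate-zero (f ∘ suc) F λ j → Fj (suc j) λ ())) (+-identityʳ 1ℂ)
  ∑-tabulate-single {n = suc n} f F (suc i) Fi Fj = trans
    (+-cong (Fj zero λ ()) (∑-tabulate-single (f ∘ suc) F i Fi λ j j≢i → Fj (suc j) (j≢i ∘ Fin.suc-injective)))
    (+-identityˡ 1ℂ)

  ∑-tabulate-const : ∀ {n} (f : Fin n → A) → ∑ (tabulate f) (λ _ → 1ℂ) ≈ fromℕ n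
  ∑-tabulate-const {n = zero}  f = refl
  ∑-tabulate-const {n = suc n} f = +-congˡ (∑-tabulate-const (f ∘ suc))

  -- The list xs contains every element exactly once, up to _∼_.
  IsEnumeration : {A : Set a} {_∼_ : Rel A ℓ} → Decidable _∼_ → List A → Set a
  IsEnumeration _≟_ xs = ∀ x → ∑ xs (λ y → 𝟙 (x ≟ y)) ≈ 1ℂ

  ∑-𝟙 : {A : Set a} {_∼_ : Rel A ℓ} (_≟_ : Decidable _∼_) (xs : List A) → IsEnumeration _≟_ xs →
        ∀ x (F : A → ℂ) → (∀ {y} → x ∼ y → F x ≈ F y) → ∑ xs (λ y → 𝟙 (x ≟ y) * F y) ≈ F x
  ∑-𝟙 _≟_ xs enum x F F-cong = begin
    ∑ xs (λ y → 𝟙 (x ≟ y) * F y)  ≈⟨ ∑-cong xs (λ y → 𝟙-*-cong (x ≟ y) F-cong) ⟨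
    ∑ xs (λ y → 𝟙 (x ≟ y) * F x)  ≈⟨ *-distribʳ-∑ (F x) xs _ ⟨
    ∑ xs (λ y → 𝟙 (x ≟ y)) * F x  ≈⟨ *-congʳ (enum x) ⟩
    1ℂ * F x                      ≈⟨ *-identityˡ (F x) ⟩
    F x                           ∎

  -- Inserting the indicator of `f x ∼₂ y` and exchanging the sums counts each `y` once. For
  -- equivalence relations the two implications between `f x ∼₂ y` and `g y ∼₁ x` say at once that
  -- `f` and `g` respect equality and are mutually inverse.
  ∑-bijection : {A : Set a} {_∼₁_ : Rel A ℓ₁} (_≟₁_ : Decidable _∼₁_) (xs : List A) → IsEnumeration _≟₁_ xs →
                {B : Set b} {_∼₂_ : Rel B ℓ₂} (_≟₂_ : Decidable _∼₂_) (ys : List B) → IsEnumeration _≟₂_ ys →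
                (f : A → B) (g : B → A) →
                (∀ {x y} → f x ∼₂ y → g y ∼₁ x) → (∀ {x y} → g y ∼₁ x → f x ∼₂ y) →
                ∀ {F : B → ℂ} → (∀ {x y} → x ∼₂ y → F x ≈ F y) → ∑ xs (F ∘ f) ≈ ∑ ys F
  ∑-bijection _≟₁_ xs enum₁ _≟₂_ ys enum₂ f g to from {F} F-cong = begin
    ∑ xs (λ x → F (f x))                              ≈⟨ ∑-cong xs (λ x → ∑-𝟙 _≟₂_ ys enum₂ (f x) F F-cong) ⟨
    ∑ xs (λ x → ∑ ys (λ y → 𝟙 (f x ≟₂ y) * F y))      ≈⟨ ∑-swap xs ys _ ⟩
    ∑ ys (λ y → ∑ xs (λ x → 𝟙 (f x ≟₂ y) * F y))      ≈⟨ ∑-cong ys (λ y → *-distribʳ-∑ (F y) xs _) ⟨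
    ∑ ys (λ y → ∑ xs (λ x → 𝟙 (f x ≟₂ y)) * F y)
      ≈⟨ ∑-cong ys (λ y → *-congʳ (∑-cong xs λ x → 𝟙-cong (f x ≟₂ y) (g y ≟₁ x) to from)) ⟩
    ∑ ys (λ y → ∑ xs (λ x → 𝟙 (g y ≟₁ x)) * F y)      ≈⟨ ∑-cong ys (λ y → *-congʳ (enum₁ (g y))) ⟩
    ∑ ys (λ y → 1ℂ * F y)                             ≈⟨ ∑-cong ys (λ y → *-identityˡ (F y)) ⟩
    ∑ ys F                                            ∎

open Sums

-- Sums over the vectors and matrices over a finite field

module Enumerations {c ℓ₁ ℓ₂} (K : HeytingField c ℓ₁ ℓ₂) {q : ℕ} (enumeration : HasOrder K q) where
  private
    variable
      a ℓ : Level
      A : Set a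

  open GaussSums K enumeration
  open CommutativeRing (fieldRing K) using () renaming (Carrier to k; sym to symₖ; trans to transₖ; refl to reflₖ)
  open ℂ-ring using (refl; sym; trans; setoid; +-identityʳ; *-cong; *-identityʳ; +-congˡ)
  open SetoidReasoning setoid

  pointwise? : {A : Set a} {_∼_ : Rel A ℓ} → Decidable _∼_ → ∀ {n} →
               Decidable (λ (v w : Vector A n) → ∀ i → v i ∼ w i)
  pointwise? _≟_ v w = Fin.all? λ i → v i ≟ w i

  ∑-vectors : ∀ (xs : List A) n (F : Vector A (suc n) → ℂ) →
    ∑ (vectors xs (suc n)) F ≈ ∑ xs (λ x → ∑ (vectors xs n) (λ v → F (x Vector.∷ v)))
  ∑-vectors xs n F = ∑-cartesianProductWith Vector._∷_ xs (vectors xs n) F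

  -- The indicator of equality of vectors is the product of those for head and tail, so the count is
  -- a product of ones.
  vectors-enumeration : {A : Set a} {_∼_ : Rel A ℓ} (_≟_ : Decidable _∼_) (xs : List A) →
    IsEnumeration _≟_ xs → ∀ n → IsEnumeration (pointwise? _≟_ {n}) (vectors xs n)
  vectors-enumeration _≟_ xs enum zero    v = trans (+-identityʳ _) (𝟙-yes (pointwise? _≟_ v Vector.[]) λ ())
  vectors-enumeration _≟_ xs enum (suc n) v = begin
    ∑ (vectors xs (suc n)) (λ w → 𝟙 (pointwise? _≟_ v w))
      ≈⟨ ∑-vectors xs n _ ⟩
    ∑ xs (λ y → ∑ (vectors xs n) (λ w → 𝟙 (pointwise? _≟_ v (y Vector.∷ w))))
      ≈⟨ (∑-cong xs λ y → ∑-cong (vectors xs n) λ w →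
           𝟙-× (pointwise? _≟_ v (y Vector.∷ w)) (v zero ≟ y) (pointwise? _≟_ (v ∘ suc) w)
             (λ h → h zero , h ∘ suc) (λ { h t zero → h ; h t (suc i) → t i })) ⟩
    ∑ xs (λ y → ∑ (vectors xs n) (λ w → 𝟙 (v zero ≟ y) * 𝟙 (pointwise? _≟_ (v ∘ suc) w)))
      ≈⟨ ∑-product xs (vectors xs n) _ _ ⟩
    ∑ xs (λ y → 𝟙 (v zero ≟ y)) * ∑ (vectors xs n) (λ w → 𝟙 (pointwise? _≟_ (v ∘ suc) w))
      ≈⟨ *-cong (enum (v zero)) (vectors-enumeration _≟_ xs enum n (v ∘ suc)) ⟩
    1ℂ * 1ℂ
      ≈⟨ *-identityʳ 1ℂ ⟩
    1ℂ ∎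

  elements-enumeration : IsEnumeration _≟_ elements
  elements-enumeration x = ∑-tabulate-single (Inverse.to enumeration) (λ y → 𝟙 (x ≟ y)) (Inverse.from enumeration x)
    (𝟙-yes (x ≟ _) (symₖ (Inverse.strictlyInverseˡ enumeration x)))
    (λ j j≢i → 𝟙-no (x ≟ _) λ x≈j → j≢i (≡.sym (Inverse.inverseʳ enumeration x≈j)))

  _≟ᵥ_ : ∀ {n} → Decidable (_≈ᵥ_ {n})
  _≟ᵥ_ = pointwise? _≟_

  kⁿ-enumeration : ∀ n → IsEnumeration _≟ᵥ_ (vectors elements n)
  kⁿ-enumeration = vectors-enumeration _≟_ elements elements-enumeration

  matrices-enumeration : ∀ m n → IsEnumeration _≟ₘ_ (matrices m n)
  matrices-enumeration m n = vectors-enumeration _≟ᵥ_ (vectors elements n) (kⁿ-enumeration n) m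

  -- Matrices are listed row by row, so isolating the first column takes an induction on the rows
  -- that moves the column sum past the rest of each row. Averaging will put a condition on
  -- precisely this column.
  ∑-columns : ∀ m n {F : Matrix m (suc n) → ℂ} → (∀ {A B} → A ≈ₘ B → F A ≈ F B) →
    ∑ (matrices m (suc n)) F ≈
    ∑ (vectors elements m) λ v → ∑ (matrices m n) λ A → F (λ i → v i Vector.∷ A i)
  ∑-columns zero n {F} F-cong = trans (+-congˡ refl) (trans (+-identityʳ _)
    (trans (F-cong λ ()) (sym (trans (+-identityʳ _) (+-identityʳ _)))))
  ∑-columns (suc m) n {F} F-cong = begin
    ∑ (matrices (suc m) (suc n)) F
      ≈⟨ ∑-vectors (vectors elements (suc n)) m F ⟩
    ∑ (vectors elements (suc n)) (λ r → ∑ (matrices m (suc n)) λ A → F (r Vector.∷ A))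
      ≈⟨ ∑-vectors elements n _ ⟩
    ∑ elements (λ x → ∑ (vectors elements n) λ r → ∑ (matrices m (suc n)) λ A → F ((x Vector.∷ r) Vector.∷ A))
      ≈⟨ (∑-cong elements λ x → ∑-cong (vectors elements n) λ r → ∑-columns m n λ A≈B →
           F-cong λ { zero j → reflₖ ; (suc i) j → A≈B i j }) ⟩
    ∑ elements (λ x → ∑ (vectors elements n) λ r → ∑ (vectors elements m) λ v → ∑ (matrices m n) λ A →
      F ((x Vector.∷ r) Vector.∷ λ i → v i Vector.∷ A i))
      ≈⟨ (∑-cong elements λ x → ∑-swap (vectors elements n) (vectors elements m) _) ⟩
    ∑ elements (λ x → ∑ (vectors elements m) λ v → ∑ (vectors elements n) λ r → ∑ (matrices m n) λ A →
      F ((x Vector.∷ r) Vector.∷ λ i → v i Vector.∷ A i))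
      ≈⟨ (∑-cong elements λ x → ∑-cong (vectors elements m) λ v → trans
           (∑-vectors (vectors elements n) m _)
           (∑-cong (vectors elements n) λ r → ∑-cong (matrices m n) λ A →
             F-cong λ { zero zero → reflₖ ; zero (suc j) → reflₖ ; (suc i) j → reflₖ })) ⟨
    ∑ elements (λ x → ∑ (vectors elements m) λ v → ∑ (matrices (suc m) n) λ A →
      F (λ i → (x Vector.∷ v) i Vector.∷ A i))
      ≈⟨ ∑-vectors elements m _ ⟨
    ∑ (vectors elements (suc m)) (λ v → ∑ (matrices (suc m) n) λ A → F (λ i → v i Vector.∷ A i)) ∎

-- Matrices and determinants over a commutative ring

module Matrices {c ℓ} (R : CommutativeRing c ℓ) where
  open CommutativeRing R
    renaming (Carrier to k; _≈_ to _≈ₖ_; _+_ to _+ₖ_; _*_ to _*ₖ_; -_ to -ₖ_)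
    hiding (_-_; zero)
  open LinearAlgebra R public
  open SemiringSum semiring public
    using (sum; sum-cong-≋; ∑-comm; ∑-distrib-+; *-distribˡ-sum; *-distribʳ-sum)
  open RawSemiringDefinitions (Semiring.rawSemiring semiring) using () renaming (_^_ to _^ₖ_)
  open RingProperties ring using (-1*x≈-x; -‿involutive)
  open SetoidReasoning setoid

  module Solver = SemiringSolver commutativeSemiring
  open Solver using (solve; _:=_; _:+_; _:*_; con)

  private
    variable
      l m n r : ℕ

  sum-zero : {v : Vector k n} → v ≈ᵥ 0ᵥ → sum v ≈ₖ 0#
  sum-zero {zero}  v≈0 = refl
  sum-zero {suc n} v≈0 = trans (+-cong (v≈0 zero) (sum-zero (v≈0 ∘ suc))) (+-identityʳ 0#)

  sum-linear : ∀ a (v w : Vector k n) → sum (λ i → v i +ₖ a *ₖ w i) ≈ₖ sum v +ₖ a *ₖ sum w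
  sum-linear a v w = trans (∑-distrib-+ v _) (+-congˡ (sym (*-distribˡ-sum a w)))

  sum-1ₘˡ : ∀ i (v : Vector k n) → sum (λ s → 1ₘ i s *ₖ v s) ≈ₖ v i
  sum-1ₘˡ {suc n} zero    v = trans (+-cong (*-identityˡ _) (sum-zero {n} λ s → zeroˡ _)) (+-identityʳ _)
  sum-1ₘˡ (suc i) v = trans (+-cong (zeroˡ _) (sum-1ₘˡ i (v ∘ suc))) (+-identityˡ _)

  1ₘ-sym : ∀ (i j : Fin n) → 1ₘ i j ≡ 1ₘ j i
  1ₘ-sym zero    zero    = ≡.refl
  1ₘ-sym zero    (suc j) = ≡.refl
  1ₘ-sym (suc i) zero    = ≡.refl
  1ₘ-sym (suc i) (suc j) = 1ₘ-sym i j

  sum-1ₘʳ : ∀ i (v : Vector k n) → sum (λ s → v s *ₖ 1ₘ s i) ≈ₖ v i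
  sum-1ₘʳ {n} i v = trans (sum-cong-≋ {n} λ s → trans (*-comm _ _) (*-congʳ (reflexive (1ₘ-sym s i)))) (sum-1ₘˡ i v)

  -- Matrix algebra

  infix 30 _ᵀ

  _ᵀ : Matrix m n → Matrix n m
  (A ᵀ) i j = A j i

  ≈ₘ-refl : {A : Matrix m n} → A ≈ₘ A
  ≈ₘ-refl i j = refl

  ≈ₘ-sym : {A B : Matrix m n} → A ≈ₘ B → B ≈ₘ A
  ≈ₘ-sym A≈B i j = sym (A≈B i j)

  ≈ₘ-trans : {A B E : Matrix m n} → A ≈ₘ B → B ≈ₘ E → A ≈ₘ E
  ≈ₘ-trans A≈B B≈E i j = trans (A≈B i j) (B≈E i j)

  *ₘ-cong : {A A′ : Matrix l m} {B B′ : Matrix m n} → A ≈ₘ A′ → B ≈ₘ B′ → (A *ₘ B) ≈ₘ (A′ *ₘ B′)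
  *ₘ-cong A≈A′ B≈B′ i j = sum-cong-≋ λ s → *-cong (A≈A′ i s) (B≈B′ s j)

  *ₘ-identityˡ : (A : Matrix m n) → (1ₘ *ₘ A) ≈ₘ A
  *ₘ-identityˡ A i j = sum-1ₘˡ i λ s → A s j

  *ₘ-identityʳ : (A : Matrix m n) → (A *ₘ 1ₘ) ≈ₘ A
  *ₘ-identityʳ A i j = sum-1ₘʳ j (A i)

  *ₘ-assoc : (A : Matrix l m) (B : Matrix m n) (E : Matrix n r) → ((A *ₘ B) *ₘ E) ≈ₘ (A *ₘ (B *ₘ E))
  *ₘ-assoc A B E i j = begin
    sum (λ t → sum (λ s → A i s *ₖ B s t) *ₖ E t j)      ≈⟨ sum-cong-≋ (λ t → *-distribʳ-sum (E t j) (λ s → A i s *ₖ B s t)) ⟩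
    sum (λ t → sum (λ s → A i s *ₖ B s t *ₖ E t j))      ≈⟨ ∑-comm (λ t s → A i s *ₖ B s t *ₖ E t j) ⟩
    sum (λ s → sum (λ t → A i s *ₖ B s t *ₖ E t j))
      ≈⟨ sum-cong-≋ (λ s → sum-cong-≋ λ t → *-assoc (A i s) (B s t) (E t j)) ⟩
    sum (λ s → sum (λ t → A i s *ₖ (B s t *ₖ E t j)))    ≈⟨ sum-cong-≋ (λ s → *-distribˡ-sum (A i s) (λ t → B s t *ₖ E t j)) ⟨
    sum (λ s → A i s *ₖ sum (λ t → B s t *ₖ E t j))      ∎

  ᵀ-*ₘ : (A : Matrix l m) (B : Matrix m n) → ((A *ₘ B) ᵀ) ≈ₘ (B ᵀ *ₘ A ᵀ)
  ᵀ-*ₘ A B i j = sum-cong-≋ λ s → *-comm (A j s) (B s i)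

  1ₘ-ᵀ : (1ₘ {n} ᵀ) ≈ₘ 1ₘ
  1ₘ-ᵀ i j = reflexive (1ₘ-sym j i)

  infix 4 _≼_

  -- The rank of A is at most that of B.
  record _≼_ {l m n r} (A : Matrix l m) (B : Matrix n r) : Set (c ⊔ ℓ) where
    constructor factor
    field
      left          : Matrix l n
      right         : Matrix r m
      factorization : A ≈ₘ ((left *ₘ B) *ₘ right)

  ≈⇒≼ : {A B : Matrix m n} → A ≈ₘ B → A ≼ B
  ≈⇒≼ {B = B} A≈B = factor 1ₘ 1ₘ λ i j →
    sym (trans (*ₘ-identityʳ (1ₘ *ₘ B) i j) (trans (*ₘ-identityˡ B i j) (sym (A≈B i j))))

  ≼-trans : ∀ {m′ n′} {A : Matrix l m} {B : Matrix n r} {E : Matrix m′ n′} → A ≼ B → B ≼ E → A ≼ E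
  ≼-trans {A = A} {B} {E} (factor P Q A≈PBQ) (factor P′ Q′ B≈P′EQ′) = factor (P *ₘ P′) (Q′ *ₘ Q) λ i j → begin
    A i j                                          ≈⟨ A≈PBQ i j ⟩
    ((P *ₘ B) *ₘ Q) i j                            ≈⟨ *ₘ-cong (*ₘ-cong (≈ₘ-refl {A = P}) B≈P′EQ′) (≈ₘ-refl {A = Q}) i j ⟩
    ((P *ₘ ((P′ *ₘ E) *ₘ Q′)) *ₘ Q) i j            ≈⟨ *ₘ-cong (*ₘ-assoc P (P′ *ₘ E) Q′) (≈ₘ-refl {A = Q}) i j ⟨
    (((P *ₘ (P′ *ₘ E)) *ₘ Q′) *ₘ Q) i j            ≈⟨ *ₘ-assoc (P *ₘ (P′ *ₘ E)) Q′ Q i j ⟩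
    ((P *ₘ (P′ *ₘ E)) *ₘ (Q′ *ₘ Q)) i j            ≈⟨ *ₘ-cong (*ₘ-assoc P P′ E) (≈ₘ-refl {A = Q′ *ₘ Q}) i j ⟨
    (((P *ₘ P′) *ₘ E) *ₘ (Q′ *ₘ Q)) i j            ∎

  ≼-ᵀ : ∀ {A : Matrix l m} {B : Matrix n r} → A ≼ B → A ᵀ ≼ B ᵀ
  ≼-ᵀ {A = A} {B} (factor P Q A≈PBQ) = factor (Q ᵀ) (P ᵀ) λ i j → begin
    A j i                          ≈⟨ A≈PBQ j i ⟩
    ((P *ₘ B) *ₘ Q) j i            ≈⟨ ᵀ-*ₘ (P *ₘ B) Q i j ⟩
    (Q ᵀ *ₘ (P *ₘ B) ᵀ) i j        ≈⟨ *ₘ-cong (≈ₘ-refl {A = Q ᵀ}) (ᵀ-*ₘ P B) i j ⟩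
    (Q ᵀ *ₘ (B ᵀ *ₘ P ᵀ)) i j      ≈⟨ *ₘ-assoc (Q ᵀ) (B ᵀ) (P ᵀ) i j ⟨
    ((Q ᵀ *ₘ B ᵀ) *ₘ P ᵀ) i j      ∎

  infixr 8 _⊕_

  _⊕_ : k → Matrix m n → Matrix (suc m) (suc n)
  (a ⊕ A) zero    zero    = a
  (a ⊕ A) zero    (suc j) = 0#
  (a ⊕ A) (suc i) zero    = 0#
  (a ⊕ A) (suc i) (suc j) = A i j

  ⊕-cong : ∀ {a b} {A B : Matrix m n} → a ≈ₖ b → A ≈ₘ B → (a ⊕ A) ≈ₘ (b ⊕ B)
  ⊕-cong a≈b A≈B zero    zero    = a≈b
  ⊕-cong a≈b A≈B zero    (suc j) = refl
  ⊕-cong a≈b A≈B (suc i) zero    = refl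
  ⊕-cong a≈b A≈B (suc i) (suc j) = A≈B i j

  ⊕-*ₘ : ∀ a b (A : Matrix l m) (B : Matrix m n) → ((a ⊕ A) *ₘ (b ⊕ B)) ≈ₘ (a *ₖ b) ⊕ (A *ₘ B)
  ⊕-*ₘ {m = m} a b A B zero    zero    = trans (+-congˡ (sum-zero {m} λ s → zeroˡ _)) (+-identityʳ _)
  ⊕-*ₘ {m = m} a b A B zero    (suc j) = trans (+-cong (zeroʳ _) (sum-zero {m} λ s → zeroˡ _)) (+-identityʳ _)
  ⊕-*ₘ {m = m} a b A B (suc i) zero    = trans (+-cong (zeroˡ _) (sum-zero {m} λ s → zeroʳ _)) (+-identityʳ _)
  ⊕-*ₘ a b A B (suc i) (suc j) = trans (+-congʳ (zeroˡ _)) (+-identityˡ _)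

  1⊕1ₘ : 1# ⊕ 1ₘ {n} ≈ₘ 1ₘ
  1⊕1ₘ zero    zero    = refl
  1⊕1ₘ zero    (suc j) = refl
  1⊕1ₘ (suc i) zero    = refl
  1⊕1ₘ (suc i) (suc j) = refl

  -- The scalar `c` makes up for the difference of the corners, so block sums with distinct unit
  -- corners bound each other.
  ⊕-≼ : ∀ {a b c} {A : Matrix l m} {B : Matrix n r} → c *ₖ b ≈ₖ a → A ≼ B → a ⊕ A ≼ b ⊕ B
  ⊕-≼ {a = a} {b} {c} {A} {B} cb≈a (factor P Q A≈PBQ) = factor (c ⊕ P) (1# ⊕ Q) λ i j → begin
    (a ⊕ A) i j                                  ≈⟨ ⊕-cong (sym (trans (*-identityʳ _) cb≈a)) A≈PBQ i j ⟩
    ((c *ₖ b *ₖ 1#) ⊕ ((P *ₘ B) *ₘ Q)) i j       ≈⟨ ⊕-*ₘ (c *ₖ b) 1# (P *ₘ B) Q i j ⟨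
    (((c *ₖ b) ⊕ (P *ₘ B)) *ₘ (1# ⊕ Q)) i j      ≈⟨ *ₘ-cong (⊕-*ₘ c b P B) (≈ₘ-refl {A = 1# ⊕ Q}) i j ⟨
    (((c ⊕ P) *ₘ (b ⊕ B)) *ₘ (1# ⊕ Q)) i j       ∎

  -- Transvections

  transvect : Fin m → Fin m → k → Matrix m n → Matrix m n
  transvect i j c A = updateAt A i λ v s → v s +ₖ c *ₖ A j s

  transvect-row : ∀ i j c (A : Matrix m n) s → transvect i j c A i s ≈ₖ A i s +ₖ c *ₖ A j s
  transvect-row i j c A s = reflexive (≡.cong (λ v → v s) (updateAt-updates i A))

  transvect-other : ∀ i j c (A : Matrix m n) {r} → r ≢ i → transvect i j c A r ≈ᵥ A r
  transvect-other i j c A {r} r≢i s = reflexive (≡.cong (λ v → v s) (updateAt-minimal r i A r≢i))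

  -- Writing transvections as left multiplications is what ties them to `_≼_`.
  transvect-*ₘ : ∀ i j c (A : Matrix m n) → (transvect i j c 1ₘ *ₘ A) ≈ₘ transvect i j c A
  transvect-*ₘ {m} i j c A r s with r Fin.≟ i
  ... | yes ≡.refl = begin
    sum (λ t → transvect i j c 1ₘ i t *ₖ A t s)                ≈⟨ sum-cong-≋ (λ t → *-congʳ (transvect-row i j c 1ₘ t)) ⟩
    sum (λ t → (1ₘ i t +ₖ c *ₖ 1ₘ j t) *ₖ A t s)
      ≈⟨ sum-cong-≋ {m} (λ t → trans (distribʳ _ _ _) (+-congˡ (*-assoc _ _ _))) ⟩
    sum (λ t → 1ₘ i t *ₖ A t s +ₖ c *ₖ (1ₘ j t *ₖ A t s))      ≈⟨ sum-linear c (λ t → 1ₘ i t *ₖ A t s) (λ t → 1ₘ j t *ₖ A t s) ⟩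
    sum (λ t → 1ₘ i t *ₖ A t s) +ₖ c *ₖ sum (λ t → 1ₘ j t *ₖ A t s)
      ≈⟨ +-congʳ (sum-1ₘˡ i λ t → A t s) ⟩
    A i s +ₖ c *ₖ sum (λ t → 1ₘ j t *ₖ A t s)                  ≈⟨ +-congˡ (*-congˡ {c} (sum-1ₘˡ j λ t → A t s)) ⟩
    A i s +ₖ c *ₖ A j s                                        ≈⟨ transvect-row i j c A s ⟨
    transvect i j c A i s                                      ∎
  ... | no r≢i = begin
    sum (λ t → transvect i j c 1ₘ r t *ₖ A t s)                ≈⟨ sum-cong-≋ (λ t → *-congʳ (transvect-other i j c 1ₘ r≢i t)) ⟩
    sum (λ t → 1ₘ r t *ₖ A t s)                                ≈⟨ sum-1ₘˡ r (λ t → A t s) ⟩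
    A r s                                                      ≈⟨ transvect-other i j c A r≢i s ⟨
    transvect i j c A r s                                      ∎

  transvect-cong : ∀ i j {c d} {A B : Matrix m n} → c ≈ₖ d → A ≈ₘ B → transvect i j c A ≈ₘ transvect i j d B
  transvect-cong i j {c} {d} {A} {B} c≈d A≈B r s with r Fin.≟ i
  ... | yes ≡.refl = trans (transvect-row i j c A s)
    (trans (+-cong (A≈B i s) (*-cong c≈d (A≈B j s))) (sym (transvect-row i j d B s)))
  ... | no r≢i = trans (transvect-other i j c A r≢i s)
    (trans (A≈B r s) (sym (transvect-other i j d B r≢i s)))

  transvect-inverse : ∀ {i j} → i ≢ j → ∀ {c d} → c +ₖ d ≈ₖ 0# → (A : Matrix m n) →
                      transvect i j c (transvect i j d A) ≈ₘ A
  transvect-inverse {i = i} {j} i≢j {c} {d} c+d≈0 A r s with r Fin.≟ i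
  ... | yes ≡.refl = begin
    transvect i j c (transvect i j d A) i s              ≈⟨ transvect-row i j c (transvect i j d A) s ⟩
    transvect i j d A i s +ₖ c *ₖ transvect i j d A j s
      ≈⟨ +-cong (transvect-row i j d A s) (*-congˡ {c} (transvect-other i j d A (i≢j ∘ ≡.sym) s)) ⟩
    A i s +ₖ d *ₖ A j s +ₖ c *ₖ A j s
      ≈⟨ solve 4 (λ a b c d → a :+ d :* b :+ c :* b := a :+ (c :+ d) :* b) refl (A i s) (A j s) c d ⟩
    A i s +ₖ (c +ₖ d) *ₖ A j s                           ≈⟨ +-congˡ (trans (*-congʳ c+d≈0) (zeroˡ _)) ⟩
    A i s +ₖ 0#                                          ≈⟨ +-identityʳ _ ⟩
    A i s                                                ∎
  ... | no r≢i = trans (transvect-other i j c _ r≢i s) (transvect-other i j d A r≢i s)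

  transvect-≼ : ∀ i j c (A : Matrix m n) → transvect i j c A ≼ A
  transvect-≼ i j c A = factor (transvect i j c 1ₘ) 1ₘ λ r s →
    sym (trans (*ₘ-identityʳ (transvect i j c 1ₘ *ₘ A) r s) (transvect-*ₘ i j c A r s))

  ≼-transvect : ∀ {i j} → i ≢ j → ∀ c (A : Matrix m n) → A ≼ transvect i j c A
  ≼-transvect {i = i} {j} i≢j c A = ≼-trans
    (≈⇒≼ (≈ₘ-sym (transvect-inverse i≢j (-‿inverseˡ c) A)))
    (transvect-≼ i j (-ₖ c) (transvect i j c A))

  -- Determinants

  sign : Fin n → k
  sign j = (-ₖ 1#) ^ₖ toℕ j

  minor : Matrix (suc m) (suc n) → Fin (suc n) → Matrix m n
  minor A j i = removeAt (A (suc i)) j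

  laplace : Matrix (suc n) (suc n) → Vector k (suc n)
  laplace A j = sign j *ₖ (A zero j *ₖ det (minor A j))

  det-cong : {A B : Matrix n n} → A ≈ₘ B → det A ≈ₖ det B
  det-cong {zero}  A≈B = refl
  det-cong {suc n} A≈B = sum-cong-≋ λ j → *-congˡ {sign j}
    (*-cong (A≈B zero j) (det-cong λ i s → A≈B (suc i) (punchIn j s)))

  -- Three matrices related row by row, rather than updates of one matrix: their minors are then
  -- related in the same way. Row `i` is either the row of expansion or a row of every minor, where
  -- induction applies.
  det-linear : ∀ i {A B E : Matrix n n} c → (∀ s → A i s ≈ₖ B i s +ₖ c *ₖ E i s) →
    (∀ r → r ≢ i → A r ≈ᵥ B r) → (∀ r → r ≢ i → A r ≈ᵥ E r) → det A ≈ₖ det B +ₖ c *ₖ det E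
  det-linear {suc n} i {A} {B} {E} c Aᵢ A≈B A≈E =
    trans (sum-cong-≋ {suc n} (laplace-linear i Aᵢ A≈B A≈E)) (sum-linear c (laplace B) (laplace E))
    where
    laplace-linear : ∀ i → (∀ s → A i s ≈ₖ B i s +ₖ c *ₖ E i s) →
      (∀ r → r ≢ i → A r ≈ᵥ B r) → (∀ r → r ≢ i → A r ≈ᵥ E r) →
      ∀ j → laplace A j ≈ₖ laplace B j +ₖ c *ₖ laplace E j
    laplace-linear zero Aᵢ A≈B A≈E j = begin
      sign j *ₖ (A zero j *ₖ det (minor A j))
        ≈⟨ *-congˡ {sign j} (*-congʳ {det (minor A j)} (Aᵢ j)) ⟩
      sign j *ₖ ((B zero j +ₖ c *ₖ E zero j) *ₖ det (minor A j))
        ≈⟨ solve 5 (λ s b c d m → s :* ((b :+ c :* d) :* m) := s :* (b :* m) :+ c :* (s :* (d :* m))) refl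
             (sign j) (B zero j) c (E zero j) (det (minor A j)) ⟩
      sign j *ₖ (B zero j *ₖ det (minor A j)) +ₖ c *ₖ (sign j *ₖ (E zero j *ₖ det (minor A j)))
        ≈⟨ +-cong
             (*-congˡ {sign j} (*-congˡ {B zero j} (det-cong λ i s → A≈B (suc i) (λ ()) (punchIn j s))))
             (*-congˡ {c} (*-congˡ {sign j} (*-congˡ {E zero j} (det-cong λ i s → A≈E (suc i) (λ ()) (punchIn j s))))) ⟩
      laplace B j +ₖ c *ₖ laplace E j ∎
    laplace-linear (suc i) Aᵢ A≈B A≈E j = begin
      sign j *ₖ (A zero j *ₖ det (minor A j))
        ≈⟨ *-congˡ {sign j} (*-congˡ {A zero j} (det-linear i {minor A j} {minor B j} {minor E j} c
             (λ s → Aᵢ (punchIn j s))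
             (λ r r≢i s → A≈B (suc r) (r≢i ∘ Fin.suc-injective) (punchIn j s))
             (λ r r≢i s → A≈E (suc r) (r≢i ∘ Fin.suc-injective) (punchIn j s)))) ⟩
      sign j *ₖ (A zero j *ₖ (det (minor B j) +ₖ c *ₖ det (minor E j)))
        ≈⟨ solve 5 (λ s a m c d → s :* (a :* (m :+ c :* d)) := s :* (a :* m) :+ c :* (s :* (a :* d))) refl
             (sign j) (A zero j) (det (minor B j)) c (det (minor E j)) ⟩
      sign j *ₖ (A zero j *ₖ det (minor B j)) +ₖ c *ₖ (sign j *ₖ (A zero j *ₖ det (minor E j)))
        ≈⟨ +-cong
             (*-congˡ {sign j} (*-congʳ {det (minor B j)} (A≈B zero (λ ()) j)))
             (*-congˡ {c} (*-congˡ {sign j} (*-congʳ {det (minor E j)} (A≈E zero (λ ()) j)))) ⟩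
      laplace B j +ₖ c *ₖ laplace E j ∎

  -- The terms of the double sum cancel in the pairs (zero , l), (suc l , zero), and so on recursively.
  Alternating : ∀ n → (Fin (suc n) → Fin n → k) → Set ℓ
  Alternating zero    φ = ⊤
  Alternating (suc n) φ =
    (∀ l → φ zero l +ₖ φ (suc l) zero ≈ₖ 0#) × Alternating n (λ j l → φ (suc j) (suc l))

  Alternating-cong : ∀ n {φ χ} → (∀ j l → φ j l ≈ₖ χ j l) → Alternating n φ → Alternating n χ
  Alternating-cong zero    φ≈χ _       = _
  Alternating-cong (suc n) φ≈χ (h , t) =
    (λ l → trans (sym (+-cong (φ≈χ zero l) (φ≈χ (suc l) zero))) (h l)) ,
    Alternating-cong n (λ j l → φ≈χ (suc j) (suc l)) t

  sum-alternating : ∀ n φ → Alternating n φ → sum (λ j → sum (φ j)) ≈ₖ 0#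
  sum-alternating zero    φ _       = +-identityʳ 0#
  sum-alternating (suc n) φ (h , t) = begin
    sum (φ zero) +ₖ sum (λ j → φ (suc j) zero +ₖ sum (λ l → φ (suc j) (suc l)))
      ≈⟨ +-congˡ (∑-distrib-+ (λ j → φ (suc j) zero) (λ j → sum (λ l → φ (suc j) (suc l)))) ⟩
    sum (φ zero) +ₖ (sum (λ j → φ (suc j) zero) +ₖ sum (λ j → sum (λ l → φ (suc j) (suc l))))
      ≈⟨ +-congˡ (+-congˡ (sum-alternating n (λ j l → φ (suc j) (suc l)) t)) ⟩
    sum (φ zero) +ₖ (sum (λ j → φ (suc j) zero) +ₖ 0#)
      ≈⟨ +-congˡ (+-identityʳ _) ⟩
    sum (φ zero) +ₖ sum (λ j → φ (suc j) zero)
      ≈⟨ ∑-distrib-+ (φ zero) (λ j → φ (suc j) zero) ⟨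
    sum (λ l → φ zero l +ₖ φ (suc l) zero)
      ≈⟨ sum-zero h ⟩
    0# ∎

  x+-1*x≈0 : ∀ x → x +ₖ (-ₖ 1#) *ₖ x ≈ₖ 0#
  x+-1*x≈0 x = trans (+-congˡ (-1*x≈-x x)) (-‿inverseʳ x)

  -- The terms of the expansion along two rows `a` and `b`; `g σ` stands for the minor on the
  -- columns selected by `σ`.
  doubleLaplace : ∀ n → (a b : Vector k (suc (suc n))) → ((Fin n → Fin (suc (suc n))) → k) →
                  Fin (suc (suc n)) → Fin (suc n) → k
  doubleLaplace n a b g j l =
    sign j *ₖ (a j *ₖ (sign l *ₖ (b (punchIn j l) *ₖ g (punchIn j ∘ punchIn l))))

  -- The positions (0, l) and (l + 1, 0) delete the same two columns, 0 and l + 1, with opposite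
  -- signs. The minor is an arbitrary function `g` of the surviving columns so that the claim can be
  -- reused once column 0 is set aside.
  laplace-alternating : ∀ n {a b : Vector k (suc (suc n))} → a ≈ᵥ b →
    (g : (Fin n → Fin (suc (suc n))) → k) → (∀ {σ τ} → (∀ x → σ x ≡ τ x) → g σ ≈ₖ g τ) →
    Alternating (suc n) (doubleLaplace n a b g)
  laplace-alternating n {a} {b} a≈b g g-cong = cancel , rest n a≈b g g-cong
    where
    cancel : ∀ l → doubleLaplace n a b g zero l +ₖ doubleLaplace n a b g (suc l) zero ≈ₖ 0#
    cancel l = begin
      1# *ₖ (a zero *ₖ (sign l *ₖ (b (suc l) *ₖ G))) +ₖ
      (-ₖ 1# *ₖ sign l) *ₖ (a (suc l) *ₖ (1# *ₖ (b zero *ₖ G)))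
        ≈⟨ +-cong (*-congˡ {1#} (*-congʳ (a≈b zero))) (*-congˡ { -ₖ 1# *ₖ sign l} (*-congʳ (a≈b (suc l)))) ⟩
      1# *ₖ (b zero *ₖ (sign l *ₖ (b (suc l) *ₖ G))) +ₖ
      (-ₖ 1# *ₖ sign l) *ₖ (b (suc l) *ₖ (1# *ₖ (b zero *ₖ G)))
        ≈⟨ solve 5 (λ m x s y G → con 1 :* (x :* (s :* (y :* G))) :+ (m :* s) :* (y :* (con 1 :* (x :* G)))
             := x :* s :* y :* G :+ m :* (x :* s :* y :* G)) refl (-ₖ 1#) (b zero) (sign l) (b (suc l)) G ⟩
      b zero *ₖ sign l *ₖ b (suc l) *ₖ G +ₖ (-ₖ 1#) *ₖ (b zero *ₖ sign l *ₖ b (suc l) *ₖ G)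
        ≈⟨ x+-1*x≈0 _ ⟩
      0# ∎
      where G = g (suc ∘ punchIn l)
    rest : ∀ n {a b : Vector k (suc (suc n))} → a ≈ᵥ b →
      (g : (Fin n → Fin (suc (suc n))) → k) → (∀ {σ τ} → (∀ x → σ x ≡ τ x) → g σ ≈ₖ g τ) →
      Alternating n λ j l → doubleLaplace n a b g (suc j) (suc l)
    rest zero a≈b g g-cong = _
    -- Column 0 now survives in every minor, whence `lift 1`. Both signs move by one place, which
    -- leaves their product unchanged.
    rest (suc n) {a} {b} a≈b g g-cong = Alternating-cong (suc n) signs
      (laplace-alternating n (a≈b ∘ suc) (g ∘ lift 1) λ σ≗τ → g-cong
        λ { zero → ≡.refl ; (suc x) → ≡.cong suc (σ≗τ x) })
      where
      signs : ∀ j l → doubleLaplace n (a ∘ suc) (b ∘ suc) (g ∘ lift 1) j l ≈ₖ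
                      doubleLaplace (suc n) a b g (suc j) (suc l)
      signs j l = begin
        sign j *ₖ (a (suc j) *ₖ (sign l *ₖ (b (suc (punchIn j l)) *ₖ g (lift 1 (punchIn j ∘ punchIn l)))))
          ≈⟨ *-congˡ {sign j} (*-congˡ {a (suc j)} (*-congˡ {sign l} (*-congˡ {b (suc (punchIn j l))}
               (g-cong λ { zero → ≡.refl ; (suc x) → ≡.refl })))) ⟩
        sign j *ₖ (a (suc j) *ₖ (sign l *ₖ (b (suc (punchIn j l)) *ₖ G)))
          ≈⟨ *-identityˡ _ ⟨
        1# *ₖ (sign j *ₖ (a (suc j) *ₖ (sign l *ₖ (b (suc (punchIn j l)) *ₖ G))))
          ≈⟨ *-congʳ (trans (-1*x≈-x (-ₖ 1#)) (-‿involutive 1#)) ⟨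
        ((-ₖ 1#) *ₖ (-ₖ 1#)) *ₖ (sign j *ₖ (a (suc j) *ₖ (sign l *ₖ (b (suc (punchIn j l)) *ₖ G))))
          ≈⟨ solve 6 (λ m s x t y G → (m :* m) :* (s :* (x :* (t :* (y :* G)))) :=
               (m :* s) :* (x :* ((m :* t) :* (y :* G)))) refl
               (-ₖ 1#) (sign j) (a (suc j)) (sign l) (b (suc (punchIn j l))) G ⟩
        sign (suc j) *ₖ (a (suc j) *ₖ (sign (suc l) *ₖ (b (suc (punchIn j l)) *ₖ G))) ∎
        where G = g (punchIn (suc j) ∘ punchIn (suc l))

  det-first-rows-equal : (A : Matrix (suc (suc n)) (suc (suc n))) →
    A zero ≈ᵥ A (suc zero) → det A ≈ₖ 0#
  det-first-rows-equal {n} A A₀≈A₁ = begin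
    sum (λ j → sign j *ₖ (A zero j *ₖ det (minor A j)))
      ≈⟨ sum-cong-≋ {suc (suc n)} (λ j → trans
           (*-congˡ {sign j} (*-distribˡ-sum (A zero j) (laplace (minor A j))))
           (*-distribˡ-sum (sign j) (λ l → A zero j *ₖ laplace (minor A j) l))) ⟩
    sum (λ j → sum (doubleLaplace n (A zero) (A (suc zero)) g j))
      ≈⟨ sum-alternating (suc n) (doubleLaplace n (A zero) (A (suc zero)) g) (laplace-alternating n A₀≈A₁ g
           (λ σ≗τ → det-cong λ i s → reflexive (≡.cong (A (suc (suc i))) (σ≗τ s)))) ⟩
    0# ∎
    where
    g : (Fin n → Fin (suc (suc n))) → k
    g σ = det λ i s → A (suc (suc i)) (σ s)

  -- Polarization: expand the vanishing determinant whose first two rows both equal the sum of the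
  -- given ones.
  det-first-rows-swap : (A : Matrix (suc (suc n)) (suc (suc n))) →
    det A +ₖ det (A (suc zero) Vector.∷ A zero Vector.∷ (λ i → A (suc (suc i)))) ≈ₖ 0#
  det-first-rows-swap {n} A = begin
    det A +ₖ D v u
      ≈⟨ +-congʳ (det-cong {A = A} {rows u v} λ { zero s → refl ; (suc zero) s → refl ; (suc (suc i)) s → refl }) ⟩
    D u v +ₖ D v u
      ≈⟨ solve 2 (λ x y → x :+ y := (con 0 :+ con 1 :* x) :+ con 1 :* (y :+ con 1 :* con 0)) refl (D u v) (D v u) ⟩
    (0# +ₖ 1# *ₖ D u v) +ₖ 1# *ₖ (D v u +ₖ 1# *ₖ 0#)
      ≈⟨ +-cong (+-congʳ (equal u)) (*-congˡ {1#} (+-congˡ {D v u} (*-congˡ {1#} (equal v)))) ⟨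
    (D u u +ₖ 1# *ₖ D u v) +ₖ 1# *ₖ (D v u +ₖ 1# *ₖ D v v) ≈⟨ +-cong (linear₁ u) (*-congˡ {1#} (linear₁ v)) ⟨
    D u w +ₖ 1# *ₖ D v w                                  ≈⟨ linear₀ ⟨
    D w w                                                 ≈⟨ equal w ⟩
    0#                                                    ∎
    where
    u v w : Vector k (suc (suc n))
    u = A zero
    v = A (suc zero)
    w s = u s +ₖ 1# *ₖ v s
    rows : Vector k (suc (suc n)) → Vector k (suc (suc n)) → Matrix (suc (suc n)) (suc (suc n))
    rows x y = x Vector.∷ y Vector.∷ (λ i → A (suc (suc i)))
    D : Vector k (suc (suc n)) → Vector k (suc (suc n)) → k
    D x y = det (rows x y)
    equal : ∀ x → D x x ≈ₖ 0#
    equal x = det-first-rows-equal (rows x x) λ _ → refl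
    other₀ : ∀ {x x′ y} r → r ≢ zero → rows x y r ≈ᵥ rows x′ y r
    other₀ zero    r≢0 s = contradiction ≡.refl r≢0
    other₀ (suc r) _   s = refl
    other₁ : ∀ {x y y′} r → r ≢ suc zero → rows x y r ≈ᵥ rows x y′ r
    other₁ zero          _   s = refl
    other₁ (suc zero)    r≢1 s = contradiction ≡.refl r≢1
    other₁ (suc (suc r)) _   s = refl
    linear₀ : D w w ≈ₖ D u w +ₖ 1# *ₖ D v w
    linear₀ = det-linear zero {rows w w} {rows u w} {rows v w} 1# (λ s → refl) other₀ other₀
    linear₁ : ∀ x → D x w ≈ₖ D x u +ₖ 1# *ₖ D x v
    linear₁ x = det-linear (suc zero) {rows x w} {rows x u} {rows x v} 1# (λ s → refl) other₁ other₁

  -- Once the first two rows are exchanged, every minor along the first row has its own first row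
  -- equal to a later one. By induction the exchanged determinant vanishes, and the exchange costs
  -- only a sign.
  det-row₀-equal : ∀ j (A : Matrix (suc n) (suc n)) → A zero ≈ᵥ A (suc j) → det A ≈ₖ 0#
  det-row₀-equal zero    A A₀≈A₁ = det-first-rows-equal A A₀≈A₁
  det-row₀-equal (suc {n} j) A A₀≈Aⱼ = begin
    det A             ≈⟨ +-identityʳ _ ⟨
    det A +ₖ 0#       ≈⟨ +-congˡ (sum-zero λ s → trans
                           (*-congˡ {sign s} (trans (*-congˡ {A (suc zero) s}
                             (det-row₀-equal j (minor A′ s) (A₀≈Aⱼ ∘ punchIn s)))
                             (zeroʳ _)))
                           (zeroʳ (sign s))) ⟨
    det A +ₖ det A′   ≈⟨ det-first-rows-swap A ⟩
    0#                ∎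
    where
    A′ : Matrix (suc (suc n)) (suc (suc n))
    A′ = A (suc zero) Vector.∷ A zero Vector.∷ (λ i → A (suc (suc i)))

  det-rows-equal : ∀ {i j} (A : Matrix n n) → i ≢ j → A i ≈ᵥ A j → det A ≈ₖ 0#
  det-rows-equal {i = zero}  {zero}  A i≢j _     = contradiction ≡.refl i≢j
  det-rows-equal {suc n} {zero}  {suc j} A _ Aᵢ≈Aⱼ = det-row₀-equal j A Aᵢ≈Aⱼ
  det-rows-equal {suc n} {suc i} {zero}  A _ Aᵢ≈Aⱼ = det-row₀-equal i A (sym ∘ Aᵢ≈Aⱼ)
  det-rows-equal {i = suc i} {suc j} A i≢j Aᵢ≈Aⱼ = sum-zero λ s → trans
    (*-congˡ {sign s} (trans
      (*-congˡ {A zero s} (det-rows-equal {i = i} {j} (minor A s) (i≢j ∘ ≡.cong suc) (Aᵢ≈Aⱼ ∘ punchIn s)))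
      (zeroʳ (A zero s))))
    (zeroʳ (sign s))

  infix 30 _[_≔_]

  _[_≔_] : Matrix m n → Fin m → Vector k n → Matrix m n
  A [ i ≔ v ] = updateAt A i (const v)

  row-updated : ∀ (A : Matrix m n) i v → (A [ i ≔ v ]) i ≈ᵥ v
  row-updated A i v s = reflexive (≡.cong (λ w → w s) (updateAt-updates i A))

  row-kept : ∀ (A : Matrix m n) i v {r} → r ≢ i → (A [ i ≔ v ]) r ≈ᵥ A r
  row-kept A i v {r} r≢i s = reflexive (≡.cong (λ w → w s) (updateAt-minimal r i A r≢i))

  det-update-linear : ∀ (A : Matrix n n) i a v w → det (A [ i ≔ (λ s → v s +ₖ a *ₖ w s) ]) ≈ₖ
                      det (A [ i ≔ v ]) +ₖ a *ₖ det (A [ i ≔ w ])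
  det-update-linear A i a v w = det-linear i a
    (λ s → trans (row-updated A i _ s) (sym (+-cong (row-updated A i v s) (*-congˡ {a} (row-updated A i w s)))))
    (λ r r≢i s → trans (row-kept A i _ r≢i s) (sym (row-kept A i v r≢i s)))
    (λ r r≢i s → trans (row-kept A i _ r≢i s) (sym (row-kept A i w r≢i s)))

  update-cong : ∀ (A : Matrix m n) i {v w} → v ≈ᵥ w → A [ i ≔ v ] ≈ₘ A [ i ≔ w ]
  update-cong A i {v} {w} v≈w r s with r Fin.≟ i
  ... | yes ≡.refl = trans (row-updated A i v s) (trans (v≈w s) (sym (row-updated A i w s)))
  ... | no r≢i     = trans (row-kept A i v r≢i s) (sym (row-kept A i w r≢i s))

  update-self : ∀ (A : Matrix m n) i → A [ i ≔ A i ] ≈ₘ A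
  update-self A i r s with r Fin.≟ i
  ... | yes ≡.refl = row-updated A i (A i) s
  ... | no r≢i     = row-kept A i (A i) r≢i s

  -- As rows, 0 = 0 + (-1) 0, so by linearity the determinant x satisfies x = x - x.
  det-update-0 : ∀ (A : Matrix n n) i → det (A [ i ≔ 0ᵥ ]) ≈ₖ 0#
  det-update-0 A i = begin
    x                            ≈⟨ det-cong (update-cong A i λ s → sym (trans (+-identityˡ _) (zeroʳ (-ₖ 1#)))) ⟩
    det (A [ i ≔ (λ s → 0# +ₖ (-ₖ 1#) *ₖ 0#) ])  ≈⟨ det-update-linear A i (-ₖ 1#) 0ᵥ 0ᵥ ⟩
    x +ₖ (-ₖ 1#) *ₖ x            ≈⟨ x+-1*x≈0 x ⟩
    0#                           ∎
    where x = det (A [ i ≔ 0ᵥ ])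

  det-update-combination : ∀ (A : Matrix n n) i (a : Vector k m) (b : Matrix m n) →
    det (A [ i ≔ combination a b ]) ≈ₖ sum (λ s → a s *ₖ det (A [ i ≔ b s ]))
  det-update-combination {m = zero}  A i a b = det-update-0 A i
  det-update-combination {m = suc m} A i a b = begin
    det (A [ i ≔ combination a b ])
      ≈⟨ det-cong (update-cong A i λ s → +-comm (a zero *ₖ b zero s) (combination (a ∘ suc) (b ∘ suc) s)) ⟩
    det (A [ i ≔ (λ s → combination (a ∘ suc) (b ∘ suc) s +ₖ a zero *ₖ b zero s) ])
      ≈⟨ det-update-linear A i (a zero) (combination (a ∘ suc) (b ∘ suc)) (b zero) ⟩
    det (A [ i ≔ combination (a ∘ suc) (b ∘ suc) ]) +ₖ a zero *ₖ det (A [ i ≔ b zero ])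
      ≈⟨ trans (+-comm _ _) (+-congˡ (det-update-combination A i (a ∘ suc) (b ∘ suc))) ⟩
    a zero *ₖ det (A [ i ≔ b zero ]) +ₖ sum (λ s → a (suc s) *ₖ det (A [ i ≔ b (suc s) ])) ∎

  det-update-row : ∀ (A : Matrix n n) {i j} → i ≢ j → det (A [ i ≔ A j ]) ≈ₖ 0#
  det-update-row A {i} {j} i≢j = det-rows-equal {i = i} {j} (A [ i ≔ A j ]) i≢j
    λ s → trans (row-updated A i (A j) s) (sym (row-kept A i (A j) (i≢j ∘ ≡.sym) s))

  -- Each summand of the correction has a repeated row. The index map `σ` lets this serve a single
  -- transvection as well as the addition of all lower rows to the first.
  det-add-combination : ∀ (A : Matrix n n) i (a : Vector k m) (σ : Fin m → Fin n) → (∀ s → i ≢ σ s) →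
    det (A [ i ≔ (λ s → A i s +ₖ combination a (A ∘ σ) s) ]) ≈ₖ det A
  det-add-combination A i a σ i≢σ = begin
    det (A [ i ≔ (λ s → A i s +ₖ combination a (A ∘ σ) s) ])
      ≈⟨ det-cong (update-cong A i λ s → +-congˡ (*-identityˡ (combination a (A ∘ σ) s))) ⟨
    det (A [ i ≔ (λ s → A i s +ₖ 1# *ₖ combination a (A ∘ σ) s) ])
      ≈⟨ det-update-linear A i 1# (A i) (combination a (A ∘ σ)) ⟩
    det (A [ i ≔ A i ]) +ₖ 1# *ₖ det (A [ i ≔ combination a (A ∘ σ) ])
      ≈⟨ +-cong (det-cong (update-self A i)) (trans (*-identityˡ _) (trans
           (det-update-combination A i a (A ∘ σ))
           (sum-zero λ s → trans (*-congˡ {a s} (det-update-row A (i≢σ s))) (zeroʳ (a s))))) ⟩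
    det A +ₖ 0#
      ≈⟨ +-identityʳ _ ⟩
    det A ∎

  det-transvect : ∀ {i j} → i ≢ j → ∀ a (A : Matrix n n) → det (transvect i j a A) ≈ₖ det A
  det-transvect {i = i} {j} i≢j a A = begin
    det (transvect i j a A)                                          ≈⟨ det-cong rows ⟩
    det (A [ i ≔ (λ s → A i s +ₖ combination (λ _ → a) (A ∘ σ) s) ])  ≈⟨ det-add-combination A i (λ _ → a) σ (λ _ → i≢j) ⟩
    det A                                                            ∎
    where
    σ : Fin 1 → _
    σ _ = j
    rows : transvect i j a A ≈ₘ A [ i ≔ (λ s → A i s +ₖ combination (λ _ → a) (A ∘ σ) s) ]
    rows r s with r Fin.≟ i
    ... | yes ≡.refl = trans (transvect-row i j a A s) (trans (+-congˡ (sym (+-identityʳ _))) (sym (row-updated A i _ s)))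
    ... | no r≢i = trans (transvect-other i j a A r≢i s) (sym (row-kept A i _ r≢i s))

  det-scale-row₀ : ∀ a v (A : Matrix n (suc n)) →
    det ((λ s → a *ₖ v s) Vector.∷ A) ≈ₖ a *ₖ det (v Vector.∷ A)
  det-scale-row₀ {n} a v A = trans
    (sum-cong-≋ {suc n} λ j → solve 4 (λ s a v m → s :* ((a :* v) :* m) := a :* (s :* (v :* m))) refl (sign j) a (v j) (M j))
    (sym (*-distribˡ-sum {suc n} a (λ j → sign j *ₖ (v j *ₖ M j))))
    where
    M : Fin (suc n) → k
    M j = det λ i → removeAt (A i) j

  det-row₀-single : (A : Matrix (suc n) (suc n)) → (∀ j → A zero (suc j) ≈ₖ 0#) →
    det A ≈ₖ A zero zero *ₖ det (λ i j → A (suc i) (suc j))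
  det-row₀-single A A₀≈0 = trans
    (+-cong (*-identityˡ _) (sum-zero λ j →
      trans (*-congˡ {sign (suc j)} (trans (*-congʳ (A₀≈0 j)) (zeroˡ _))) (zeroʳ (sign (suc j)))))
    (+-identityʳ _)

  det-⊕ : ∀ a (A : Matrix n n) → det (a ⊕ A) ≈ₖ a *ₖ det A
  det-⊕ a A = trans (det-row₀-single (a ⊕ A) (λ _ → refl))
    (*-congˡ {a} (det-cong {A = λ i j → (a ⊕ A) (suc i) (suc j)} {A} λ i j → refl))

  -- Expanding the minors (0, j + 1) along their first column gives a double sum
  -- symmetric under transposition.
  det-ᵀ-step : (∀ (A : Matrix n n) → det (A ᵀ) ≈ₖ det A) →
    (∀ (A : Matrix (suc n) (suc n)) → det (A ᵀ) ≈ₖ det A) →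
    (A : Matrix (suc (suc n)) (suc (suc n))) → det (A ᵀ) ≈ₖ det A
  det-ᵀ-step {n} det-ᵀₙ det-ᵀₙ₊₁ A = begin
    1# *ₖ (A zero zero *ₖ det (minor (A ᵀ) zero)) +ₖ sum (λ i → laplace (A ᵀ) (suc i))
      ≈⟨ +-cong (*-congˡ {1#} (*-congˡ {A zero zero} (det-ᵀₙ₊₁ (minor A zero)))) (double (A ᵀ)) ⟩
    1# *ₖ (A zero zero *ₖ det (minor A zero)) +ₖ sum (λ i → sum (λ j → term (A ᵀ) i j))
      ≈⟨ +-congˡ (∑-comm (term (A ᵀ))) ⟩
    1# *ₖ (A zero zero *ₖ det (minor A zero)) +ₖ sum (λ j → sum (λ i → term (A ᵀ) i j))
      ≈⟨ +-congˡ (sum-cong-≋ {suc n} λ j → sum-cong-≋ {suc n} λ i → term-ᵀ i j) ⟩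
    1# *ₖ (A zero zero *ₖ det (minor A zero)) +ₖ sum (λ j → sum (λ i → term A j i))
      ≈⟨ +-congˡ (double A) ⟨
    1# *ₖ (A zero zero *ₖ det (minor A zero)) +ₖ sum (λ j → laplace A (suc j)) ∎
    where
    M : Matrix (suc (suc n)) (suc (suc n)) → Fin (suc n) → Fin (suc n) → k
    M B j i = det λ r s → B (suc (punchIn i r)) (suc (punchIn j s))
    term : Matrix (suc (suc n)) (suc (suc n)) → Fin (suc n) → Fin (suc n) → k
    term B j i = sign (suc j) *ₖ (B zero (suc j) *ₖ (sign i *ₖ (B (suc i) zero *ₖ M B j i)))
    double : ∀ B → sum (λ j → laplace B (suc j)) ≈ₖ sum (λ j → sum (λ i → term B j i))
    double B = sum-cong-≋ {suc n} λ j → begin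
      sign (suc j) *ₖ (B zero (suc j) *ₖ det (minor B (suc j)))
        ≈⟨ *-congˡ {sign (suc j)} (*-congˡ {B zero (suc j)} (trans (sym (det-ᵀₙ₊₁ (minor B (suc j))))
             (sum-cong-≋ {suc n} λ i → *-congˡ {sign i} (*-congˡ {B (suc i) zero}
               (det-ᵀₙ (λ r s → B (suc (punchIn i r)) (suc (punchIn j s)))))))) ⟩
      sign (suc j) *ₖ (B zero (suc j) *ₖ sum (λ i → sign i *ₖ (B (suc i) zero *ₖ M B j i)))
        ≈⟨ trans (*-congˡ {sign (suc j)} (*-distribˡ-sum (B zero (suc j)) λ i → sign i *ₖ (B (suc i) zero *ₖ M B j i)))
             (*-distribˡ-sum (sign (suc j)) λ i → B zero (suc j) *ₖ (sign i *ₖ (B (suc i) zero *ₖ M B j i))) ⟩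
      sum (λ i → term B j i) ∎
    term-ᵀ : ∀ i j → term (A ᵀ) i j ≈ₖ term A j i
    term-ᵀ i j = trans
      (*-congˡ {sign (suc i)} (*-congˡ {A (suc i) zero} (*-congˡ {sign j} (*-congˡ {A zero (suc j)}
        (det-ᵀₙ (λ r s → A (suc (punchIn i r)) (suc (punchIn j s))))))))
      (solve 6 (λ m s t x y d → (m :* s) :* (x :* (t :* (y :* d))) := (m :* t) :* (y :* (s :* (x :* d)))) refl
        (-ₖ 1#) (sign i) (sign j) (A (suc i) zero) (A zero (suc j)) (M A j i))

  det-ᵀ : (A : Matrix n n) → det (A ᵀ) ≈ₖ det A
  det-ᵀ {zero}        A = refl
  det-ᵀ {suc zero}    A = refl
  det-ᵀ {suc (suc n)} A = det-ᵀ-step det-ᵀ det-ᵀ A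

  det-col₀-single : (A : Matrix (suc n) (suc n)) → (∀ i → A (suc i) zero ≈ₖ 0#) →
    det A ≈ₖ A zero zero *ₖ det (λ i j → A (suc i) (suc j))
  det-col₀-single A A₀≈0 = trans (sym (det-ᵀ A)) (trans (det-row₀-single (A ᵀ) A₀≈0)
    (*-congˡ {A zero zero} (det-ᵀ λ i j → A (suc i) (suc j))))

  -- The cofactor, written with row `i` replaced by a unit vector, so that Cramer's rule reduces to
  -- linearity in that row.
  adjugate : Matrix n n → Matrix n n
  adjugate A j i = det (A [ i ≔ 1ₘ j ])

  -- Linearity collapses the entry to the determinant of `A` with row `i` replaced by row `r`:
  -- either nothing changes or a row is repeated.
  *ₘ-adjugate : ∀ (A : Matrix n n) r i → (A *ₘ adjugate A) r i ≈ₖ det A *ₖ 1ₘ r i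
  *ₘ-adjugate A r i = trans (sym (trans
      (det-cong (update-cong A i (λ s → sym (sum-1ₘʳ s (A r)))))
      (det-update-combination A i (A r) 1ₘ)))
    replaced
    where
    replaced : det (A [ i ≔ A r ]) ≈ₖ det A *ₖ 1ₘ r i
    replaced with i Fin.≟ r
    ... | yes ≡.refl = trans (det-cong (update-self A i)) (sym (trans (*-congˡ {det A} (1ₘ-diagonal i)) (*-identityʳ _)))
      where
      1ₘ-diagonal : ∀ {n} (i : Fin n) → 1ₘ i i ≈ₖ 1#
      1ₘ-diagonal zero    = refl
      1ₘ-diagonal (suc i) = 1ₘ-diagonal i
    ... | no i≢r = trans (det-update-row A i≢r) (sym (trans (*-congˡ {det A} (1ₘ-off-diagonal (i≢r ∘ ≡.sym))) (zeroʳ _)))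
      where
      1ₘ-off-diagonal : ∀ {n} {i j : Fin n} → i ≢ j → 1ₘ i j ≈ₖ 0#
      1ₘ-off-diagonal {i = zero}  {zero}  i≢j = contradiction ≡.refl i≢j
      1ₘ-off-diagonal {i = zero}  {suc j} i≢j = refl
      1ₘ-off-diagonal {i = suc i} {zero}  i≢j = refl
      1ₘ-off-diagonal {i = suc i} {suc j} i≢j = 1ₘ-off-diagonal (i≢j ∘ ≡.cong suc)

  right-inverse : ∀ {x} (A : Matrix n n) → x *ₖ det A ≈ₖ 1# → ∃[ B ] (A *ₘ B) ≈ₘ 1ₘ
  right-inverse {x = x} A xd≈1 = (λ j i → x *ₖ adjugate A j i) , λ r i → begin
    sum (λ j → A r j *ₖ (x *ₖ adjugate A j i))
      ≈⟨ sum-cong-≋ (λ j → solve 3 (λ a x d → a :* (x :* d) := x :* (a :* d)) refl (A r j) x (adjugate A j i)) ⟩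
    sum (λ j → x *ₖ (A r j *ₖ adjugate A j i))  ≈⟨ *-distribˡ-sum x (λ j → A r j *ₖ adjugate A j i) ⟨
    x *ₖ (A *ₘ adjugate A) r i                  ≈⟨ *-congˡ {x} (*ₘ-adjugate A r i) ⟩
    x *ₖ (det A *ₖ 1ₘ r i)                      ≈⟨ *-assoc _ _ _ ⟨
    x *ₖ det A *ₖ 1ₘ r i                        ≈⟨ *-congʳ xd≈1 ⟩
    1# *ₖ 1ₘ r i                                ≈⟨ *-identityˡ _ ⟩
    1ₘ r i                                      ∎

  -- A right inverse of the transpose gives a left inverse, and by associativity it coincides with
  -- the right inverse.
  det-unit⇒invertible : ∀ {x} (A : Matrix n n) → x *ₖ det A ≈ₖ 1# → IsInvertible A
  det-unit⇒invertible {n = n} {x} A xd≈1 = B , BA≈1 , AB≈1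
    where
    B E : Matrix n n
    B = proj₁ (right-inverse A xd≈1)
    E = proj₁ (right-inverse (A ᵀ) (trans (*-congˡ {x} (det-ᵀ A)) xd≈1)) ᵀ
    AB≈1 : (A *ₘ B) ≈ₘ 1ₘ
    AB≈1 = proj₂ (right-inverse A xd≈1)
    EA≈1 : (E *ₘ A) ≈ₘ 1ₘ
    EA≈1 i j = trans (sym (ᵀ-*ₘ (A ᵀ) (E ᵀ) i j)) (trans
      (proj₂ (right-inverse (A ᵀ) (trans (*-congˡ {x} (det-ᵀ A)) xd≈1)) j i) (1ₘ-ᵀ i j))
    E≈B : E ≈ₘ B
    E≈B i j = begin
      E i j                   ≈⟨ *ₘ-identityʳ E i j ⟨
      (E *ₘ 1ₘ) i j           ≈⟨ *ₘ-cong (≈ₘ-refl {A = E}) AB≈1 i j ⟨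
      (E *ₘ (A *ₘ B)) i j     ≈⟨ *ₘ-assoc E A B i j ⟨
      ((E *ₘ A) *ₘ B) i j     ≈⟨ *ₘ-cong EA≈1 (≈ₘ-refl {A = B}) i j ⟩
      (1ₘ *ₘ B) i j           ≈⟨ *ₘ-identityˡ B i j ⟩
      B i j                   ∎
    BA≈1 : (B *ₘ A) ≈ₘ 1ₘ
    BA≈1 = ≈ₘ-trans (*ₘ-cong (≈ₘ-sym E≈B) (≈ₘ-refl {A = A})) EA≈1

  ⊕-· : ∀ a (U : Matrix m n) (X : Matrix (suc m) (suc n)) →
        a ⊕ U · X ≈ₖ a *ₖ X zero zero +ₖ U · (λ i j → X (suc i) (suc j))
  ⊕-· {m} {n} a U X = +-cong
    (trans (+-congˡ (sum-zero {n} λ j → zeroˡ (X zero (suc j)))) (+-identityʳ _))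
    (sum-cong-≋ {m} λ i → trans (+-congʳ (zeroˡ (X (suc i) zero))) (+-identityˡ _))

  -- The first row of `a ⊕ U` is supported at its corner, so a combination of lower rows added to
  -- the first is felt only through their entries in column 0.
  ⊕-·-shift : ∀ a (U : Matrix m n) t v (M : Matrix m (suc n)) →
    a ⊕ U · ((λ s → v s +ₖ combination t M s) Vector.∷ M) ≈ₖ
    a ⊕ U · (v Vector.∷ M) +ₖ sum (λ i → t i *ₖ (a *ₖ M i zero))
  ⊕-·-shift a U t v M = begin
    a ⊕ U · ((λ s → v s +ₖ combination t M s) Vector.∷ M)
      ≈⟨ ⊕-· a U ((λ s → v s +ₖ combination t M s) Vector.∷ M) ⟩
    a *ₖ (v zero +ₖ combination t M zero) +ₖ Z
      ≈⟨ solve 4 (λ a v w z → a :* (v :+ w) :+ z := (a :* v :+ z) :+ a :* w) refl a (v zero) (combination t M zero) Z ⟩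
    a *ₖ v zero +ₖ Z +ₖ a *ₖ combination t M zero
      ≈⟨ +-cong (sym (⊕-· a U (v Vector.∷ M))) (trans
           (*-distribˡ-sum a (λ i → t i *ₖ M i zero)) (sum-cong-≋ λ i →
             solve 3 (λ a t m → a :* (t :* m) := t :* (a :* m)) refl a (t i) (M i zero))) ⟩
    a ⊕ U · (v Vector.∷ M) +ₖ sum (λ i → t i *ₖ (a *ₖ M i zero)) ∎
    where Z = U · (λ i j → M i (suc j))

funToFin-cong : ∀ {m n} {f g : Fin m → Fin n} → (∀ i → f i ≡ g i) → funToFin f ≡ funToFin g
funToFin-cong {zero}  f≗g = ≡.refl
funToFin-cong {suc m} f≗g = ≡.cong₂ combine (f≗g zero) (funToFin-cong (f≗g ∘ suc))

-- Elimination and rank over a finite field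

module Field {c ℓ₁ ℓ₂} (K : HeytingField c ℓ₁ ℓ₂) {q : ℕ} (enumeration : HasOrder K q) where
  open CommutativeRing (fieldRing K)
    renaming (Carrier to k; _≈_ to _≈ₖ_; _+_ to _+ₖ_; _*_ to _*ₖ_; -_ to -ₖ_)
    hiding (_-_; zero)
  open Matrices (fieldRing K)
  open GaussSums K enumeration using (IsUnit; isUnit?; _≟_)
  open HeytingField K using (#⇒invertible; invertible⇒#; tight; #-irrefl)
  open Inverse enumeration using (to; from; from-cong; strictlyInverseˡ; strictlyInverseʳ)
  open SetoidReasoning setoid

  private
    variable
      m n r s u : ℕ

  unit-resp : ∀ {a b} → a ≈ₖ b → IsUnit a → IsUnit b
  unit-resp a≈b (x , xa≈1 , ax≈1) =
    x , trans (*-congˡ (sym a≈b)) xa≈1 , trans (*-congʳ (sym a≈b)) ax≈1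

  -- Tightness reduces the claim to excluding apartness from 0, which would make `a` minus 0
  -- invertible.
  nonunit⇒≈0 : ∀ {a} → ¬ IsUnit a → a ≈ₖ 0#
  nonunit⇒≈0 {a} ¬unit = proj₁ (tight a 0#) λ a#0 → ¬unit (unit-resp
    (trans (+-congˡ -0#≈0#) (+-identityʳ a)) (#⇒invertible a#0))
    where open RingProperties ring using (-0#≈0#)

  1≉0 : ¬ 1# ≈ₖ 0#
  1≉0 1≈0 = #-irrefl refl (invertible⇒# {0#} {0#}
    (0# , trans (zeroˡ _) (sym 1≈0) , trans (zeroʳ _) (sym 1≈0)))

  unit⇒≉0 : ∀ {a} → IsUnit a → ¬ a ≈ₖ 0#
  unit⇒≉0 (x , xa≈1 , _) a≈0 = 1≉0 (trans (sym xa≈1) (trans (*-congˡ a≈0) (zeroʳ x)))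

  -- Elimination by transvections of rows and columns

  infix 4 _∼_

  -- Generated by moves that preserve both the determinant and the sum `S`; scaling a row would in
  -- general change both. Column transvections arise by conjugation with `transposed`.
  data _∼_ {n} : Matrix n n → Matrix n n → Set (c ⊔ ℓ₁) where
    ≈⇒∼         : ∀ {U V} → U ≈ₘ V → U ∼ V
    transvected : ∀ i j → i ≢ j → ∀ a U → U ∼ transvect i j a U
    transposed  : ∀ {U V} → U ∼ V → U ᵀ ∼ V ᵀ
    ∼-trans     : ∀ {U V W} → U ∼ V → V ∼ W → U ∼ W

  ∼⇒≼ : {U V : Matrix n n} → U ∼ V → U ≼ V × V ≼ U
  ∼⇒≼ (≈⇒∼ U≈V)              = ≈⇒≼ U≈V , ≈⇒≼ (≈ₘ-sym U≈V)
  ∼⇒≼ (transvected i j i≢j a U)  = ≼-transvect i≢j a U , transvect-≼ i j a U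
  ∼⇒≼ (transposed {U} {V} U∼V) = let U≼V , V≼U = ∼⇒≼ U∼V in ≼-ᵀ {A = U} {V} U≼V , ≼-ᵀ {A = V} {U} V≼U
  ∼⇒≼ (∼-trans U∼V V∼W)      =
    let U≼V , V≼U = ∼⇒≼ U∼V
        V≼W , W≼V = ∼⇒≼ V∼W
    in ≼-trans U≼V V≼W , ≼-trans W≼V V≼U

  ∼⇒det≈ : {U V : Matrix n n} → U ∼ V → det U ≈ₖ det V
  ∼⇒det≈ (≈⇒∼ U≈V)              = det-cong U≈V
  ∼⇒det≈ (transvected i j i≢j a U)  = sym (det-transvect i≢j a U)
  ∼⇒det≈ (transposed {U} {V} U∼V) = trans (det-ᵀ U) (trans (∼⇒det≈ U∼V) (sym (det-ᵀ V)))
  ∼⇒det≈ (∼-trans U∼V V∼W)      = trans (∼⇒det≈ U∼V) (∼⇒det≈ V∼W)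

  -- A nonunit entry is zero, so adding the row of the unit to the first row copies the unit there,
  -- without the sign that an exchange of rows would cost.
  pivot-row : ∀ (U : Matrix (suc n) (suc n)) i j → IsUnit (U i j) → ∃[ V ] U ∼ V × IsUnit (V zero j)
  pivot-row U zero    j unit = U , ≈⇒∼ ≈ₘ-refl , unit
  pivot-row U (suc i) j unit with isUnit? (U zero j)
  ... | yes unit₀ = U , ≈⇒∼ ≈ₘ-refl , unit₀
  ... | no ¬unit₀ = transvect zero (suc i) 1# U , transvected zero (suc i) (λ ()) 1# U , unit-resp (begin
    U (suc i) j                         ≈⟨ +-identityˡ _ ⟨
    0# +ₖ U (suc i) j                   ≈⟨ +-cong (nonunit⇒≈0 ¬unit₀) (*-identityˡ _) ⟨
    U zero j +ₖ 1# *ₖ U (suc i) j       ≈⟨ transvect-row zero (suc i) 1# U j ⟨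
    transvect zero (suc i) 1# U zero j  ∎) unit

  pivot : ∀ (U : Matrix (suc n) (suc n)) i j → IsUnit (U i j) → ∃[ V ] U ∼ V × IsUnit (V zero zero)
  pivot U i j unit =
    let V , U∼V , unit′ = pivot-row U i j unit
        W , V∼W , unit″ = pivot-row (V ᵀ) j zero unit′
    in W ᵀ , ∼-trans U∼V (transposed V∼W) , unit″

  -- Keeping the first row preserves the pivot and, when the lemma is applied to a transpose, also a
  -- column cleared earlier.
  clear-rows : ∀ (U : Matrix (suc n) (suc n)) → IsUnit (U zero zero) → ∀ is →
    ∃[ V ] U ∼ V × V zero ≈ᵥ U zero × (∀ {i} → i ∈ is → V (suc i) zero ≈ₖ 0#)
  clear-rows U unit []       = U , ≈⇒∼ ≈ₘ-refl , (λ _ → refl) , λ ()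
  clear-rows U unit@(x , xa≈1 , _) (i ∷ is) with clear-rows U unit is
  ... | V , U∼V , V₀≈U₀ , V≈0 = W , ∼-trans U∼V (transvected (suc i) zero (λ ()) b V)
      , (λ s → trans (transvect-other (suc i) zero b V (λ ()) s) (V₀≈U₀ s)) , W≈0
    where
    b = -ₖ (V (suc i) zero *ₖ x)
    W = transvect (suc i) zero b V
    cleared : W (suc i) zero ≈ₖ 0#
    cleared = begin
      W (suc i) zero                                   ≈⟨ transvect-row (suc i) zero b V zero ⟩
      V (suc i) zero +ₖ b *ₖ V zero zero               ≈⟨ +-congˡ (-‿distribˡ-* _ _) ⟨
      V (suc i) zero +ₖ -ₖ (V (suc i) zero *ₖ x *ₖ V zero zero)
        ≈⟨ +-congˡ (-‿cong (trans (*-assoc _ _ _) (trans (*-congˡ (trans (*-congˡ (V₀≈U₀ zero)) xa≈1)) (*-identityʳ _)))) ⟩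
      V (suc i) zero +ₖ -ₖ V (suc i) zero              ≈⟨ -‿inverseʳ _ ⟩
      0#                                               ∎
      where open RingProperties ring using (-‿distribˡ-*)
    W≈0 : ∀ {r} → r ∈ i ∷ is → W (suc r) zero ≈ₖ 0#
    W≈0 {r} r∈ with r Fin.≟ i
    W≈0 _            | yes ≡.refl = cleared
    W≈0 (here r≡i)   | no r≢i = contradiction r≡i r≢i
    W≈0 (there r∈is) | no r≢i =
      trans (transvect-other (suc i) zero b V (r≢i ∘ Fin.suc-injective) zero) (V≈0 r∈is)

  clear-column : ∀ (U : Matrix (suc n) (suc n)) → IsUnit (U zero zero) →
    ∃[ V ] U ∼ V × V zero ≈ᵥ U zero × (∀ i → V (suc i) zero ≈ₖ 0#)
  clear-column {n} U unit =
    let V , U∼V , V₀≈U₀ , V≈0 = clear-rows U unit (List.allFin n)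
    in V , U∼V , V₀≈U₀ , λ i → V≈0 (∈-allFin i)

  eliminate : ∀ (U : Matrix (suc n) (suc n)) → ¬ U ≈ₘ 0ₘ → ∃₂ λ a V → IsUnit a × U ∼ a ⊕ V
  eliminate U U≉0 with Fin.any? (λ i → Fin.any? λ j → isUnit? (U i j))
  ... | no ¬unit = contradiction (λ i j → nonunit⇒≈0 λ unit → ¬unit (i , j , unit)) U≉0
  ... | yes (i , j , unit) =
    let V , U∼V , unitV = pivot U i j unit
        W , V∼W , W₀≈V₀ , W≈0 = clear-column V unitV
        X , W∼X , X₀≈W₀ , X≈0 = clear-column (W ᵀ) (unit-resp (sym (W₀≈V₀ zero)) unitV)
    in X zero zero , (λ i j → X (suc j) (suc i))
     , unit-resp (sym (trans (X₀≈W₀ zero) (W₀≈V₀ zero))) unitV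
     , ∼-trans U∼V (∼-trans V∼W (∼-trans (transposed W∼X) (≈⇒∼ λ
         { zero    zero    → refl
         ; zero    (suc j) → X≈0 j
         ; (suc i) zero    → trans (X₀≈W₀ (suc i)) (W≈0 i)
         ; (suc i) (suc j) → refl
         })))

  -- Rank

  -- Injectivity of the linear map, phrased with one-column matrices so that it passes through
  -- associativity of `_*ₘ_`.
  Monic : Matrix m n → Set (c ⊔ ℓ₁)
  Monic {m} {n} A = ∀ (X : Matrix n 1) → (A *ₘ X) ≈ₘ 0ₘ → X ≈ₘ 0ₘ

  *ₘ-zeroʳ : (A : Matrix m n) {B : Matrix n r} → B ≈ₘ 0ₘ → (A *ₘ B) ≈ₘ 0ₘ
  *ₘ-zeroʳ A B≈0 i j = sum-zero λ s → trans (*-congˡ {A i s} (B≈0 s j)) (zeroʳ (A i s))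

  monic-1ₘ : ∀ n → Monic (1ₘ {n})
  monic-1ₘ n X 1X≈0 = ≈ₘ-trans (≈ₘ-sym (*ₘ-identityˡ X)) 1X≈0

  monic-factorʳ : (A : Matrix m n) (B : Matrix n r) → Monic (A *ₘ B) → Monic B
  monic-factorʳ A B monic X BX≈0 = monic X (≈ₘ-trans (*ₘ-assoc A B X) (*ₘ-zeroʳ A BX≈0))

  monic-cong : {A B : Matrix m n} → A ≈ₘ B → Monic A → Monic B
  monic-cong A≈B monic X BX≈0 = monic X (≈ₘ-trans (*ₘ-cong A≈B (≈ₘ-refl {A = X})) BX≈0)

  independent⇒monic : (b : Vector (Vector k n) m) → LinearlyIndependent b → Monic (flip b)
  independent⇒monic {m = m} b indep X bX≈0 i zero =
    indep (λ s → X s zero) (λ j → trans (sum-cong-≋ {m} λ s → *-comm (X s zero) (b s j)) (bX≈0 j zero)) i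
  independent⇒monic b indep X bX≈0 i (suc ())

  from-injective : ∀ {x y} → from x ≡ from y → x ≈ₖ y
  from-injective {x} {y} eq = trans (sym (strictlyInverseˡ x))
    (trans (reflexive (≡.cong to eq)) (strictlyInverseˡ y))

  1<q : 1 ℕ.< q
  1<q = bound (from 0#) (from 1#) λ eq → 1≉0 (sym (from-injective eq))
    where
    bound : ∀ {q} (i j : Fin q) → i ≢ j → 1 ℕ.< q
    bound {suc zero}    zero zero i≢j = contradiction ≡.refl i≢j
    bound {suc (suc q)} _    _    _   = s≤s (s≤s z≤n)

  -- A monic m × n matrix embeds the qⁿ columns of height n into the qᵐ columns of height m.
  monic⇒≤ : (A : Matrix m n) → Monic A → n ℕ.≤ m
  monic⇒≤ {m} {n} A monic = ℕ.≮⇒≥ λ m<n →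
    ℕ.<⇒≱ (ℕ.^-monoʳ-< q 1<q m<n) (Fin.injective⇒≤ encode-injective)
    where
    decode : Fin (q ℕ.^ n) → Matrix n 1
    decode x i _ = to (finToFun x i)
    encode : Fin (q ℕ.^ n) → Fin (q ℕ.^ m)
    encode x = funToFin λ i → from ((A *ₘ decode x) i zero)
    encode-injective : Injective _≡_ _≡_ encode
    encode-injective {x} {y} eq = ≡.trans (≡.sym (Fin.funToFin-finToFin {n} x))
      (≡.trans (funToFin-cong same) (Fin.funToFin-finToFin {n} y))
      where
      image : ∀ i → (A *ₘ decode x) i zero ≈ₖ (A *ₘ decode y) i zero
      image i = from-injective (≡.trans (≡.sym (Fin.finToFun-funToFin (λ i → from ((A *ₘ decode x) i zero)) i))
        (≡.trans (≡.cong (λ z → finToFun z i) eq) (Fin.finToFun-funToFin (λ i → from ((A *ₘ decode y) i zero)) i)))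
      D : Matrix n 1
      D i j = decode x i j +ₖ (-ₖ 1#) *ₖ decode y i j
      AD≈0 : (A *ₘ D) ≈ₘ 0ₘ
      AD≈0 i (suc ())
      AD≈0 i zero = begin
        sum (λ s → A i s *ₖ (decode x s zero +ₖ (-ₖ 1#) *ₖ decode y s zero))
          ≈⟨ sum-cong-≋ (λ s → Solver.solve 4 (λ a x m y → a Solver.:* (x Solver.:+ m Solver.:* y) Solver.:=
               a Solver.:* x Solver.:+ m Solver.:* (a Solver.:* y)) refl (A i s) (decode x s zero) (-ₖ 1#) (decode y s zero)) ⟩
        sum (λ s → A i s *ₖ decode x s zero +ₖ (-ₖ 1#) *ₖ (A i s *ₖ decode y s zero))
          ≈⟨ sum-linear (-ₖ 1#) (λ s → A i s *ₖ decode x s zero) (λ s → A i s *ₖ decode y s zero) ⟩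
        (A *ₘ decode x) i zero +ₖ (-ₖ 1#) *ₖ (A *ₘ decode y) i zero
          ≈⟨ +-congʳ (image i) ⟩
        (A *ₘ decode y) i zero +ₖ (-ₖ 1#) *ₖ (A *ₘ decode y) i zero
          ≈⟨ x+-1*x≈0 _ ⟩
        0# ∎
      same : ∀ i → finToFun x i ≡ finToFun y i
      same i = ≡.trans (≡.sym (strictlyInverseʳ (finToFun x i))) (≡.trans (from-cong (begin
        decode x i zero   ≈⟨ +-identityʳ _ ⟨
        decode x i zero +ₖ 0#  ≈⟨ +-congˡ (x+-1*x≈0 (decode y i zero)) ⟨
        decode x i zero +ₖ (decode y i zero +ₖ (-ₖ 1#) *ₖ decode y i zero)
          ≈⟨ trans (sym (+-assoc _ _ _)) (trans (+-congʳ (+-comm _ _)) (+-assoc _ _ _)) ⟩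
        decode y i zero +ₖ D i zero ≈⟨ +-congˡ (monic D AD≈0 i zero) ⟩
        decode y i zero +ₖ 0#  ≈⟨ +-identityʳ _ ⟩
        decode y i zero   ∎)) (strictlyInverseʳ (finToFun y i)))

  -- In a factorization of an identity matrix the right factor is injective, so it cannot map into a
  -- smaller space.
  1ₘ≼1ₘ⇒≤ : 1ₘ {r} ≼ 1ₘ {s} → r ℕ.≤ s
  1ₘ≼1ₘ⇒≤ {r} {s} (factor P Q 1≈P1Q) =
    monic⇒≤ Q (monic-factorʳ (P *ₘ 1ₘ) Q (monic-cong 1≈P1Q (monic-1ₘ r)))

  -- The basis is `U *ₘ A`, so its injective matrix factors through dimension `r`, which gives u ≤
  -- r. Conversely, expressing the columns of `U` in the basis factors `U`, and with it the identity
  -- of size `r`, through dimension `u`.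
  rank-unique : (U : Matrix m n) → 1ₘ {r} ≼ U → U ≼ 1ₘ {r} → HasRank U u → u ≡ r
  rank-unique {m} {n} {r} {u} U 1≼U (factor P Q U≈P1Q) (b , b∈ , indep , spans) =
    ℕ.≤-antisym (monic⇒≤ (Q *ₘ A) (monic-factorʳ (P *ₘ 1ₘ) (Q *ₘ A)
      (monic-cong flip-b≈ (independent⇒monic b indep)))) (1ₘ≼1ₘ⇒≤ (≼-trans 1≼U U≼1))
    where
    A : Matrix n u
    A s t = proj₁ (b∈ t) s
    flip-b≈ : flip b ≈ₘ ((P *ₘ 1ₘ) *ₘ (Q *ₘ A))
    flip-b≈ i t = begin
      b t i                              ≈⟨ proj₂ (b∈ t) i ⟩
      sum (λ s → A s t *ₖ U i s)         ≈⟨ sum-cong-≋ (λ s → *-comm (A s t) (U i s)) ⟩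
      (U *ₘ A) i t                       ≈⟨ *ₘ-cong U≈P1Q (≈ₘ-refl {A = A}) i t ⟩
      (((P *ₘ 1ₘ) *ₘ Q) *ₘ A) i t        ≈⟨ *ₘ-assoc (P *ₘ 1ₘ) Q A i t ⟩
      ((P *ₘ 1ₘ) *ₘ (Q *ₘ A)) i t        ∎
    column∈ : ∀ j → columnSpace U (flip U j)
    column∈ j = 1ₘ j , λ i → sym (sum-1ₘˡ j (U i))
    E : Matrix u n
    E t j = proj₁ (spans (flip U j) (column∈ j)) t
    U≼1 : U ≼ 1ₘ {u}
    U≼1 = factor (flip b) E λ i j → begin
      U i j                              ≈⟨ proj₂ (spans (flip U j) (column∈ j)) i ⟩
      sum (λ t → E t j *ₖ b t i)         ≈⟨ sum-cong-≋ (λ t → *-comm (E t j) (b t i)) ⟩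
      (flip b *ₘ E) i j                  ≈⟨ *ₘ-cong (*ₘ-identityʳ (flip b)) (≈ₘ-refl {A = E}) i j ⟨
      ((flip b *ₘ 1ₘ) *ₘ E) i j          ∎

open ℂ-field using (integral; ≈0-stable; x-y≈0⇒x≈y; x≈y⇒x-y≈0; conj-cong; conj-*; conj-1;
  root-of-unity⇒unitary; 1+nonNegative≉0; fromℕ-nonNegative)

-- Cancellation and vanishing in the complex numbers

module _ where
  open ℂ-ring using (sym; trans; *-comm; *-identityˡ)
  open RingProperties ℂ-ring.ring using ([y-z]x≈yx-zx)

  *-cancelˡ : ∀ {x y z} → ¬ x ≈ 0ℂ → x * y ≈ x * z → y ≈ z
  *-cancelˡ {x} {y} {z} x≉0 xy≈xz = x-y≈0⇒x≈y (integral (trans ([y-z]x≈yx-zx x y z)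
    (x≈y⇒x-y≈0 (trans (*-comm y x) (trans xy≈xz (*-comm x z))))) x≉0)

  -- If `z` were nonzero, it could be cancelled from `φ x * z ≈ z` for every `x`, and all values of
  -- `φ` would be 1. Stability of equality with zero turns this into a proof.
  fixed-by-nontrivial⇒≈0 : ∀ {a} {A : Set a} (φ : A → ℂ) {z} → ¬ (∀ x → φ x ≈ 1ℂ) →
    (∀ x → φ x * z ≈ z) → z ≈ 0ℂ
  fixed-by-nontrivial⇒≈0 φ {z} nontrivial fixed = ≈0-stable λ z≉0 → nontrivial λ x →
    x-y≈0⇒x≈y (integral (trans ([y-z]x≈yx-zx z (φ x) 1ℂ)
      (x≈y⇒x-y≈0 (trans (fixed x) (sym (*-identityˡ z))))) z≉0)

  ^-≉0 : ∀ {z} → ¬ z ≈ 0ℂ → ∀ n → ¬ z ^ n ≈ 0ℂ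
  ^-≉0 z≉0 zero    = 1+nonNegative≉0 (fromℕ-nonNegative 0) ∘ trans (ℂ-ring.+-identityʳ 1ℂ)
  ^-≉0 z≉0 (suc n) = λ zzⁿ≈0 → z≉0 (integral zzⁿ≈0 (^-≉0 z≉0 n))

module ℂ-solver = SemiringSolver ℂ-ring.commutativeSemiring

-- Characters, orthogonality and the evaluation of the sums

module Evaluate {c ℓ₁ ℓ₂} (K : HeytingField c ℓ₁ ℓ₂) {q : ℕ} (enumeration : HasOrder K q)
  (ψ : AdditiveCharacter (fieldRing K)) (ψ-nontrivial : ¬ IsTrivial ψ)
  (χ : MultiplicativeCharacter (fieldRing K)) where

  private
    module F = CommutativeRing (fieldRing K)
  open F using (0#; 1#) renaming (Carrier to k; _≈_ to _≈ₖ_; _+_ to _+ₖ_; _*_ to _*ₖ_; -_ to -ₖ_)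
  open RawSemiringDefinitions (Semiring.rawSemiring F.semiring) using () renaming (_^_ to _^ₖ_)
  open Matrices (fieldRing K)
  open Field K enumeration
  open GaussSums K enumeration
    using (elements; vectors; matrices; IsUnit; isUnit?; isInvertible?; _≟_; _≟ₘ_;
           extend; _⟨_⟩₊; _⟨_⟩ₓ; gaussSum; gaussSumGL)
  open Enumerations K enumeration
  open ℂ-ring using (refl; sym; trans; setoid; +-cong; +-congˡ; +-congʳ; *-cong; *-congˡ; *-congʳ;
    *-comm; *-assoc; *-identityˡ; *-identityʳ; zeroˡ; zeroʳ; +-identityˡ; +-identityʳ; +-comm; +-assoc;
    -‿inverseˡ; -‿inverseʳ)
  open CommutativeSemigroupProperties ℂ-ring.*-commutativeSemigroup using (interchange; x∙yz≈y∙xz)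
  open SetoidReasoning setoid
  open ℂ-solver using (solve; _:=_; _:*_; con)

  private
    variable
      m n : ℕ

  -- Characters

  private
    module Ψ = GroupHomomorphism ψ
    module X = GroupHomomorphism χ

  ψ-cong : ∀ {x y} → x ≈ₖ y → ψ ⟨ x ⟩₊ ≈ ψ ⟨ y ⟩₊
  ψ-cong = Ψ.⟦⟧-cong

  ψ-+ : ∀ x y → ψ ⟨ x +ₖ y ⟩₊ ≈ ψ ⟨ x ⟩₊ * ψ ⟨ y ⟩₊
  ψ-+ = Ψ.homo

  ψ-0 : ∀ {x} → x ≈ₖ 0# → ψ ⟨ x ⟩₊ ≈ 1ℂ
  ψ-0 x≈0 = trans (ψ-cong x≈0) Ψ.ε-homo

  extend-cong : ∀ {x y} (d : Dec (IsUnit x)) (e : Dec (IsUnit y)) → x ≈ₖ y → extend χ x d ≈ extend χ y e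
  extend-cong (yes u) (yes v) x≈y = X.⟦⟧-cong x≈y
  extend-cong (yes u) (no ¬v) x≈y = contradiction (unit-resp x≈y u) ¬v
  extend-cong (no ¬u) (yes v) x≈y = contradiction (unit-resp (F.sym x≈y) v) ¬u
  extend-cong (no _)  (no _)  x≈y = refl

  χ-cong : ∀ {x y} → x ≈ₖ y → χ ⟨ x ⟩ₓ ≈ χ ⟨ y ⟩ₓ
  χ-cong {x} {y} = extend-cong (isUnit? x) (isUnit? y)

  χ-unit : ∀ {x} (u : IsUnit x) → χ ⟨ x ⟩ₓ ≈ proj₁ (X.⟦ x , u ⟧)
  χ-unit {x} u = extend-cong (isUnit? x) (yes u) F.refl

  χ-nonunit : ∀ {x} → ¬ IsUnit x → χ ⟨ x ⟩ₓ ≈ 0ℂ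
  χ-nonunit {x} ¬u = extend-cong (isUnit? x) (no ¬u) F.refl

  χ-0 : ∀ {x} → x ≈ₖ 0# → χ ⟨ x ⟩ₓ ≈ 0ℂ
  χ-0 x≈0 = χ-nonunit λ u → unit⇒≉0 u x≈0

  unit-factorˡ : ∀ {x y} → IsUnit (x *ₖ y) → IsUnit x
  unit-factorˡ {x} {y} (z , _ , xyz≈1) =
    y *ₖ z , F.trans (F.*-comm _ _) xyz≈1′ , xyz≈1′
    where xyz≈1′ = F.trans (F.sym (F.*-assoc x y z)) xyz≈1

  -- Multiplicativity survives the extension by zero because a product is a unit only if both
  -- factors are.
  χ-* : ∀ x y → χ ⟨ x *ₖ y ⟩ₓ ≈ χ ⟨ x ⟩ₓ * χ ⟨ y ⟩ₓ
  χ-* x y = cases (isUnit? x) (isUnit? y)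
    where
    cases : Dec (IsUnit x) → Dec (IsUnit y) → χ ⟨ x *ₖ y ⟩ₓ ≈ χ ⟨ x ⟩ₓ * χ ⟨ y ⟩ₓ
    cases (no ¬u) _       = trans (χ-nonunit (¬u ∘ unit-factorˡ)) (sym (trans (*-congʳ (χ-nonunit ¬u)) (zeroˡ _)))
    cases (yes u) (no ¬v) = trans (χ-nonunit (¬v ∘ unit-factorˡ ∘ unit-resp (F.*-comm x y)))
      (sym (trans (*-congˡ (χ-nonunit ¬v)) (zeroʳ _)))
    cases (yes u) (yes v) = trans (χ-unit (proj₂ (Group._∙_ (fieldRing K ˣ) (x , u) (y , v))))
      (trans (X.homo (x , u) (y , v)) (sym (*-cong (χ-unit u) (χ-unit v))))

  χ-1 : χ ⟨ 1# ⟩ₓ ≈ 1ℂ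
  χ-1 = trans (χ-unit (proj₂ (Group.ε (fieldRing K ˣ)))) X.ε-homo

  χ-^ : ∀ x m → χ ⟨ x ^ₖ m ⟩ₓ ≈ χ ⟨ x ⟩ₓ ^ m
  χ-^ x zero    = χ-1
  χ-^ x (suc m) = trans (χ-* x (x ^ₖ m)) (*-congˡ (χ-^ x m))

  -- Among the q + 1 powers with exponents 0 to q two coincide, and the one with the smaller
  -- exponent cancels.
  unit-power : ∀ {x} → IsUnit x → ∃[ m ] x ^ₖ suc m ≈ₖ 1#
  unit-power {x} (y , yx≈1 , _) =
    let i , j , i<j , eq = Fin.pigeonhole (ℕ.n<1+n q) (λ i → Inverse.from enumeration (x ^ₖ toℕ i))
        -- The difference of the exponents less one, so that `suc d` is visibly positive.
        d = toℕ j ∸ suc (toℕ i)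
        j≡i+d = ≡.trans (≡.sym (ℕ.m+[n∸m]≡n i<j)) (≡.sym (ℕ.+-suc (toℕ i) d))
    in d , F.sym (cancel (toℕ i) (F.trans (from-injective eq) (F.reflexive (≡.cong (x ^ₖ_) j≡i+d))))
    where
    cancel : ∀ i {d} → x ^ₖ i ≈ₖ x ^ₖ (i ℕ.+ d) → 1# ≈ₖ x ^ₖ d
    cancel zero    eq = eq
    cancel (suc i) {d} eq = cancel i (F.trans (F.sym (undo (x ^ₖ i)))
      (F.trans (F.*-congˡ {y} eq) (undo (x ^ₖ (i ℕ.+ d)))))
      where
      undo : ∀ z → y *ₖ (x *ₖ z) ≈ₖ z
      undo z = F.trans (F.sym (F.*-assoc y x z)) (F.trans (F.*-congʳ yx≈1) (F.*-identityˡ z))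

  -- A unit of the field is a root of unity, hence so is its image under `χ`. This is what lets
  -- `conj` stand for the inverse.
  χ-unitary : ∀ {x} → IsUnit x → χ ⟨ x ⟩ₓ * conj (χ ⟨ x ⟩ₓ) ≈ 1ℂ
  χ-unitary {x} u = let m , xᵐ≈1 = unit-power u in
    root-of-unity⇒unitary (χ ⟨ x ⟩ₓ) m (trans (sym (χ-^ x (suc m))) (trans (χ-cong xᵐ≈1) χ-1))

  -- Orthogonality

  ∑ₖ : (k → ℂ) → ℂ
  ∑ₖ = ∑ elements

  ∑ᵥ : ∀ n → (Vector k n → ℂ) → ℂ
  ∑ᵥ n = ∑ (vectors elements n)

  ∑ₘ : ∀ m n → (Matrix m n → ℂ) → ℂ
  ∑ₘ m n = ∑ (matrices m n)

  ∑ₖ-scale : ∀ {a} → IsUnit a → ∀ {f : k → ℂ} → (∀ {x y} → x ≈ₖ y → f x ≈ f y) →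
             ∑ₖ (λ x → f (a *ₖ x)) ≈ ∑ₖ f
  ∑ₖ-scale {a} (b , ba≈1 , ab≈1) = ∑-bijection _≟_ elements elements-enumeration _≟_ elements elements-enumeration
    (a *ₖ_) (b *ₖ_)
    (λ {x} {y} ax≈y → F.trans (F.*-congˡ (F.sym ax≈y)) (undo ba≈1 x))
    (λ {x} {y} by≈x → F.trans (F.*-congˡ (F.sym by≈x)) (undo ab≈1 y))
    where
    undo : ∀ {a b} → b *ₖ a ≈ₖ 1# → ∀ x → b *ₖ (a *ₖ x) ≈ₖ x
    undo ba≈1 x = F.trans (F.sym (F.*-assoc _ _ x)) (F.trans (F.*-congʳ ba≈1) (F.*-identityˡ x))

  undo-shift : ∀ {x y a b} → b +ₖ a ≈ₖ 0# → x +ₖ a ≈ₖ y → y +ₖ b ≈ₖ x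
  undo-shift {x} {y} {a} {b} b+a≈0 x+a≈y = F.trans (F.+-congʳ (F.sym x+a≈y)) (F.trans (F.+-assoc x a b)
    (F.trans (F.+-congˡ (F.trans (F.+-comm a b) b+a≈0)) (F.+-identityʳ x)))

  ∑ᵥ-shift : ∀ (w : Vector k n) {f : Vector k n → ℂ} → (∀ {v v′} → v ≈ᵥ v′ → f v ≈ f v′) →
             ∑ᵥ n (λ v → f (λ i → v i +ₖ w i)) ≈ ∑ᵥ n f
  ∑ᵥ-shift {n} w = ∑-bijection _≟ᵥ_ (vectors elements n) (kⁿ-enumeration n) _≟ᵥ_ (vectors elements n) (kⁿ-enumeration n)
    (λ v i → v i +ₖ w i) (λ v i → v i +ₖ -ₖ w i)
    (λ h i → undo-shift (F.-‿inverseˡ (w i)) (h i))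
    (λ h i → undo-shift (F.-‿inverseʳ (w i)) (h i))

  -- Translation by `a` permutes the field and multiplies the sum by `ψ ⟨ a ⟩₊`.
  ∑ψ≈0 : ∑ₖ (ψ ⟨_⟩₊) ≈ 0ℂ
  ∑ψ≈0 = fixed-by-nontrivial⇒≈0 (ψ ⟨_⟩₊) ψ-nontrivial λ a → begin
    ψ ⟨ a ⟩₊ * ∑ₖ (ψ ⟨_⟩₊)             ≈⟨ *-distribˡ-∑ (ψ ⟨ a ⟩₊) elements (ψ ⟨_⟩₊) ⟩
    ∑ₖ (λ x → ψ ⟨ a ⟩₊ * ψ ⟨ x ⟩₊)     ≈⟨ ∑-cong elements (λ x → trans (*-comm _ _) (sym (ψ-+ x a))) ⟩
    ∑ₖ (λ x → ψ ⟨ x +ₖ a ⟩₊)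
      ≈⟨ ∑-bijection _≟_ elements elements-enumeration _≟_ elements elements-enumeration
           (_+ₖ a) (_+ₖ -ₖ a) (undo-shift (F.-‿inverseˡ a)) (undo-shift (F.-‿inverseʳ a)) ψ-cong ⟩
    ∑ₖ (ψ ⟨_⟩₊)                        ∎

  Q : ℂ
  Q = fromℕ q

  ∑ₖ-const : ∑ₖ (λ _ → 1ℂ) ≈ Q
  ∑ₖ-const = ∑-tabulate-const (Inverse.to enumeration)

  ∑ψ-scaled : ∀ a → ∑ₖ (λ x → ψ ⟨ x *ₖ a ⟩₊) ≈ Q * 𝟙 (0# ≟ a)
  ∑ψ-scaled a = cases (isUnit? a)
    where
    cases : Dec (IsUnit a) → ∑ₖ (λ x → ψ ⟨ x *ₖ a ⟩₊) ≈ Q * 𝟙 (0# ≟ a)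
    cases (yes u) = begin
      ∑ₖ (λ x → ψ ⟨ x *ₖ a ⟩₊)  ≈⟨ ∑-cong elements (λ x → ψ-cong (F.*-comm x a)) ⟩
      ∑ₖ (λ x → ψ ⟨ a *ₖ x ⟩₊)  ≈⟨ ∑ₖ-scale u ψ-cong ⟩
      ∑ₖ (ψ ⟨_⟩₊)               ≈⟨ ∑ψ≈0 ⟩
      0ℂ                        ≈⟨ zeroʳ Q ⟨
      Q * 0ℂ                    ≈⟨ *-congˡ (𝟙-no (0# ≟ a) (unit⇒≉0 u ∘ F.sym)) ⟨
      Q * 𝟙 (0# ≟ a)            ∎
    cases (no ¬u) = begin
      ∑ₖ (λ x → ψ ⟨ x *ₖ a ⟩₊)  ≈⟨ ∑-cong elements (λ x → ψ-0 (F.trans (F.*-congˡ (nonunit⇒≈0 ¬u)) (F.zeroʳ x))) ⟩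
      ∑ₖ (λ _ → 1ℂ)             ≈⟨ ∑ₖ-const ⟩
      Q                         ≈⟨ *-identityʳ Q ⟨
      Q * 1ℂ                    ≈⟨ *-congˡ (𝟙-yes (0# ≟ a) (F.sym (nonunit⇒≈0 ¬u))) ⟨
      Q * 𝟙 (0# ≟ a)            ∎

  infixl 7 _∙ᵥ_

  _∙ᵥ_ : Vector k n → Vector k n → k
  v ∙ᵥ w = sum λ i → v i *ₖ w i

  -- The sum factors over the coordinates, each factor being q or 0 according to whether that
  -- coordinate of `v` vanishes.
  ∑ψ-dot : ∀ n (v : Vector k n) → ∑ᵥ n (λ t → ψ ⟨ t ∙ᵥ v ⟩₊) ≈ Q ^ n * 𝟙 (0ᵥ ≟ᵥ v)
  ∑ψ-dot zero    v = trans (+-identityʳ _) (trans (ψ-0 F.refl)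
    (sym (trans (*-identityˡ _) (𝟙-yes (0ᵥ ≟ᵥ v) λ ()))))
  ∑ψ-dot (suc n) v = begin
    ∑ᵥ (suc n) (λ t → ψ ⟨ t ∙ᵥ v ⟩₊)
      ≈⟨ ∑-vectors elements n _ ⟩
    ∑ₖ (λ x → ∑ᵥ n λ t → ψ ⟨ x *ₖ v zero +ₖ t ∙ᵥ (v ∘ suc) ⟩₊)
      ≈⟨ (∑-cong elements λ x → ∑-cong (vectors elements n) λ t → ψ-+ (x *ₖ v zero) (t ∙ᵥ (v ∘ suc))) ⟩
    ∑ₖ (λ x → ∑ᵥ n λ t → ψ ⟨ x *ₖ v zero ⟩₊ * ψ ⟨ t ∙ᵥ (v ∘ suc) ⟩₊)
      ≈⟨ ∑-product elements (vectors elements n) (λ x → ψ ⟨ x *ₖ v zero ⟩₊) (λ t → ψ ⟨ t ∙ᵥ (v ∘ suc) ⟩₊) ⟩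
    ∑ₖ (λ x → ψ ⟨ x *ₖ v zero ⟩₊) * ∑ᵥ n (λ t → ψ ⟨ t ∙ᵥ (v ∘ suc) ⟩₊)
      ≈⟨ *-cong (∑ψ-scaled (v zero)) (∑ψ-dot n (v ∘ suc)) ⟩
    (Q * 𝟙 (0# ≟ v zero)) * (Q ^ n * 𝟙 (0ᵥ ≟ᵥ (v ∘ suc)))
      ≈⟨ interchange Q (𝟙 (0# ≟ v zero)) (Q ^ n) (𝟙 (0ᵥ ≟ᵥ (v ∘ suc))) ⟩
    Q ^ suc n * (𝟙 (0# ≟ v zero) * 𝟙 (0ᵥ ≟ᵥ (v ∘ suc)))
      ≈⟨ *-congˡ (𝟙-× (0ᵥ ≟ᵥ v) (0# ≟ v zero) (0ᵥ ≟ᵥ (v ∘ suc))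
           (λ h → h zero , h ∘ suc) (λ { h t zero → h ; h t (suc i) → t i })) ⟨
    Q ^ suc n * 𝟙 (0ᵥ ≟ᵥ v) ∎

  ∑ᵥ-const : ∀ n z → ∑ᵥ n (λ _ → z) ≈ Q ^ n * z
  ∑ᵥ-const zero    z = trans (+-identityʳ z) (sym (*-identityˡ z))
  ∑ᵥ-const (suc n) z = begin
    ∑ᵥ (suc n) (λ _ → z)                  ≈⟨ ∑-vectors elements n _ ⟩
    ∑ₖ (λ _ → ∑ᵥ n λ _ → z)               ≈⟨ ∑-cong elements (λ _ → trans (∑ᵥ-const n z) (sym (*-identityˡ _))) ⟩
    ∑ₖ (λ _ → 1ℂ * (Q ^ n * z))           ≈⟨ *-distribʳ-∑ (Q ^ n * z) elements (λ _ → 1ℂ) ⟨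
    ∑ₖ (λ _ → 1ℂ) * (Q ^ n * z)           ≈⟨ *-congʳ ∑ₖ-const ⟩
    Q * (Q ^ n * z)                       ≈⟨ *-assoc Q (Q ^ n) z ⟨
    Q ^ suc n * z                         ∎

  -- Makes the powers of `Q` introduced by averaging cancellable.
  Q≉0 : ¬ Q ≈ 0ℂ
  Q≉0 = positive 1<q
    where
    positive : ∀ {q} → 1 ℕ.< q → ¬ fromℕ q ≈ 0ℂ
    positive {suc q} _ = 1+nonNegative≉0 (fromℕ-nonNegative q)

  -- Gauss sums over all matrices

  ·-cong : {U V X Y : Matrix m n} → U ≈ₘ V → X ≈ₘ Y → U · X ≈ₖ V · Y
  ·-cong U≈V X≈Y = sum-cong-≋ λ i → sum-cong-≋ λ j → F.*-cong (U≈V i j) (X≈Y i j)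

  ·-comm : (U X : Matrix m n) → U · X ≈ₖ X · U
  ·-comm U X = sum-cong-≋ λ i → sum-cong-≋ λ j → F.*-comm (U i j) (X i j)

  ·-ᵀ : (U X : Matrix n n) → U ᵀ · X ≈ₖ U · X ᵀ
  ·-ᵀ U X = ∑-comm λ i j → U j i *ₖ X i j

  ·-0 : (X : Matrix m n) → 0ₘ · X ≈ₖ 0#
  ·-0 {m} {n} X = sum-zero {m} λ i → sum-zero {n} λ j → F.zeroˡ (X i j)

  sum-perturb : ∀ i {v w : Vector k n} {x} → v i ≈ₖ w i +ₖ x → (∀ {r} → r ≢ i → v r ≈ₖ w r) →
                sum v ≈ₖ sum w +ₖ x
  sum-perturb {suc n} zero    {v} {w} {x} vᵢ v≈w = F.trans (F.+-cong vᵢ (sum-cong-≋ {n} λ r → v≈w λ ()))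
    (F.trans (F.+-assoc _ _ _) (F.trans (F.+-congˡ (F.+-comm _ _)) (F.sym (F.+-assoc _ _ _))))
  sum-perturb {suc n} (suc i) {v} {w} {x} vᵢ v≈w = F.trans
    (F.+-cong (v≈w λ ()) (sum-perturb i vᵢ λ r≢i → v≈w (r≢i ∘ Fin.suc-injective)))
    (F.sym (F.+-assoc _ _ _))

  transvect-· : ∀ i j a (U X : Matrix m n) → transvect i j a U · X ≈ₖ U · X +ₖ a *ₖ (U j ∙ᵥ X i)
  transvect-· {m} {n} i j a U X = sum-perturb i
    (F.trans (sum-cong-≋ {n} λ s → F.trans (F.*-congʳ (transvect-row i j a U s))
      (F.trans (F.distribʳ _ _ _) (F.+-congˡ (F.*-assoc _ _ _))))
      (sum-linear a (λ s → U i s *ₖ X i s) (λ s → U j s *ₖ X i s)))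
    (λ {r} r≢i → sum-cong-≋ {n} λ s → F.*-congʳ (transvect-other i j a U r≢i s))

  opaque
    term : Matrix n n → Matrix n n → ℂ
    term U X = χ ⟨ det X ⟩ₓ * ψ ⟨ U · X ⟩₊

    term≈ : (U X : Matrix n n) → term U X ≈ χ ⟨ det X ⟩ₓ * ψ ⟨ U · X ⟩₊
    term≈ U X = refl

  term-cong-det : {U V X Y : Matrix n n} → det X ≈ₖ det Y → U · X ≈ₖ V · Y → term U X ≈ term V Y
  term-cong-det {U = U} {V} {X} {Y} detX≈detY U·X≈V·Y = trans (term≈ U X)
    (trans (*-cong (χ-cong detX≈detY) (ψ-cong U·X≈V·Y)) (sym (term≈ V Y)))

  term-cong : {U V X Y : Matrix n n} → U ≈ₘ V → X ≈ₘ Y → term U X ≈ term V Y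
  term-cong U≈V X≈Y = term-cong-det (det-cong X≈Y) (·-cong U≈V X≈Y)

  S : Matrix n n → ℂ
  S {n} U = ∑ₘ n n (term U)

  gaussSumGL≈S : (U : Matrix n n) → gaussSumGL U χ ψ ≈ S U
  gaussSumGL≈S {n} U = trans
    (∑-filter isInvertible? (matrices n n) λ X ¬inv →
      trans (*-congʳ (χ-nonunit λ (x , xd≈1 , _) → ¬inv (det-unit⇒invertible X xd≈1))) (zeroˡ _))
    (∑-cong (matrices n n) λ X → sym (term≈ U X))

  S-cong : {U V : Matrix n n} → U ≈ₘ V → S U ≈ S V
  S-cong {n} U≈V = ∑-cong (matrices n n) λ X → term-cong U≈V (≈ₘ-refl {A = X})

  S-bijection : (U V : Matrix n n) (f g : Matrix n n → Matrix n n) →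
    (∀ {X Y} → f X ≈ₘ Y → g Y ≈ₘ X) → (∀ {X Y} → g Y ≈ₘ X → f X ≈ₘ Y) →
    (∀ X → term U X ≈ term V (f X)) → S U ≈ S V
  S-bijection {n} U V f g to from eq = trans (∑-cong (matrices n n) eq)
    (∑-bijection _≟ₘ_ (matrices n n) (matrices-enumeration n n) _≟ₘ_ (matrices n n) (matrices-enumeration n n)
      f g to from (term-cong (≈ₘ-refl {A = V})))

  S-ᵀ : (U : Matrix n n) → S (U ᵀ) ≈ S U
  S-ᵀ U = S-bijection (U ᵀ) U _ᵀ _ᵀ (λ h i j → F.sym (h j i)) (λ h i j → F.sym (h j i))
    λ X → term-cong-det (F.sym (det-ᵀ X)) (·-ᵀ U X)

  -- For the pairing, adding `a` times row `j` to row `i` is adjoint to adding `a` times row `i` to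
  -- row `j`; hence the exchanged indices in the substitution.
  S-transvect : ∀ {i j} → i ≢ j → ∀ a (U : Matrix n n) → S (transvect i j a U) ≈ S U
  S-transvect {i = i} {j} i≢j a U = S-bijection (transvect i j a U) U
    (transvect j i a) (transvect j i (-ₖ a))
    (λ h → ≈ₘ-trans (transvect-cong j i F.refl (≈ₘ-sym h)) (transvect-inverse j≢i (F.-‿inverseˡ a) _))
    (λ h → ≈ₘ-trans (transvect-cong j i F.refl (≈ₘ-sym h)) (transvect-inverse j≢i (F.-‿inverseʳ a) _))
    λ X → term-cong-det (F.sym (det-transvect j≢i a X)) (adjoint X)
    where
    j≢i = i≢j ∘ ≡.sym
    adjoint : ∀ X → transvect i j a U · X ≈ₖ U · transvect j i a X
    adjoint X = F.trans (transvect-· i j a U X) (F.trans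
      (F.+-cong (·-comm U X) (F.*-congˡ (sum-cong-≋ λ s → F.*-comm (U j s) (X i s))))
      (F.trans (F.sym (transvect-· j i a X U)) (·-comm (transvect j i a X) U)))

  ∼⇒S≈ : {U V : Matrix n n} → U ∼ V → S U ≈ S V
  ∼⇒S≈ (≈⇒∼ U≈V)                  = S-cong U≈V
  ∼⇒S≈ (transvected i j i≢j a U)  = sym (S-transvect i≢j a U)
  ∼⇒S≈ (transposed {U} {V} U∼V)   = trans (S-ᵀ U) (trans (∼⇒S≈ U∼V) (sym (S-ᵀ V)))
  ∼⇒S≈ (∼-trans U∼V V∼W)          = trans (∼⇒S≈ U∼V) (∼⇒S≈ V∼W)

  -- The recursion

  G : ℂ
  G = gaussSum χ ψ

  G≈∑ₖ : G ≈ ∑ₖ λ x → χ ⟨ x ⟩ₓ * ψ ⟨ x ⟩₊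
  G≈∑ₖ = ∑-filter isUnit? elements λ x ¬u → trans (*-congʳ (χ-nonunit ¬u)) (zeroˡ _)

  -- Inserting a factor 1 as the value of `χ` at `a` times its conjugate makes the summand a
  -- function of `a *ₖ x`, and multiplication by `a` permutes the field.
  twisted-gaussSum : ∀ {a} → IsUnit a →
    ∑ₖ (λ x → χ ⟨ x ⟩ₓ * ψ ⟨ a *ₖ x ⟩₊) ≈ conj (χ ⟨ a ⟩ₓ) * G
  twisted-gaussSum {a} u = begin
    ∑ₖ (λ x → χ ⟨ x ⟩ₓ * ψ ⟨ a *ₖ x ⟩₊)
      ≈⟨ ∑-cong elements untwist ⟨
    ∑ₖ (λ x → conj (χ ⟨ a ⟩ₓ) * (χ ⟨ a *ₖ x ⟩ₓ * ψ ⟨ a *ₖ x ⟩₊))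
      ≈⟨ ∑ₖ-scale u (λ x≈y → *-congˡ (*-cong (χ-cong x≈y) (ψ-cong x≈y))) ⟩
    ∑ₖ (λ x → conj (χ ⟨ a ⟩ₓ) * (χ ⟨ x ⟩ₓ * ψ ⟨ x ⟩₊))
      ≈⟨ *-distribˡ-∑ (conj (χ ⟨ a ⟩ₓ)) elements _ ⟨
    conj (χ ⟨ a ⟩ₓ) * ∑ₖ (λ x → χ ⟨ x ⟩ₓ * ψ ⟨ x ⟩₊)
      ≈⟨ *-congˡ G≈∑ₖ ⟨
    conj (χ ⟨ a ⟩ₓ) * G ∎
    where
    untwist : ∀ x → conj (χ ⟨ a ⟩ₓ) * (χ ⟨ a *ₖ x ⟩ₓ * ψ ⟨ a *ₖ x ⟩₊) ≈ χ ⟨ x ⟩ₓ * ψ ⟨ a *ₖ x ⟩₊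
    untwist x = begin
      conj (χ ⟨ a ⟩ₓ) * (χ ⟨ a *ₖ x ⟩ₓ * ψ ⟨ a *ₖ x ⟩₊)          ≈⟨ *-congˡ (*-congʳ (χ-* a x)) ⟩
      conj (χ ⟨ a ⟩ₓ) * (χ ⟨ a ⟩ₓ * χ ⟨ x ⟩ₓ * ψ ⟨ a *ₖ x ⟩₊)    ≈⟨ *-congˡ (*-assoc _ _ _) ⟩
      conj (χ ⟨ a ⟩ₓ) * (χ ⟨ a ⟩ₓ * (χ ⟨ x ⟩ₓ * ψ ⟨ a *ₖ x ⟩₊))  ≈⟨ *-assoc _ _ _ ⟨
      conj (χ ⟨ a ⟩ₓ) * χ ⟨ a ⟩ₓ * (χ ⟨ x ⟩ₓ * ψ ⟨ a *ₖ x ⟩₊)    ≈⟨ *-congʳ (trans (*-comm _ _) (χ-unitary u)) ⟩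
      1ℂ * (χ ⟨ x ⟩ₓ * ψ ⟨ a *ₖ x ⟩₊)                            ≈⟨ *-identityˡ _ ⟩
      χ ⟨ x ⟩ₓ * ψ ⟨ a *ₖ x ⟩₊                                   ∎

  module _ {a} (unit : IsUnit a) (U : Matrix n n) where

    column₀ : Matrix n (suc n) → Vector k n
    column₀ M i = a *ₖ M i zero

    -- The determinant ignores the added rows while the pairing records them: the phase is a
    -- character of `t` determined by column 0 of `M`.
    term-shift : ∀ t v M → term (a ⊕ U) ((λ s → v s +ₖ combination t M s) Vector.∷ M) ≈
                 term (a ⊕ U) (v Vector.∷ M) * ψ ⟨ t ∙ᵥ column₀ M ⟩₊
    term-shift t v M = begin
      term (a ⊕ U) M′                                        ≈⟨ term≈ (a ⊕ U) M′ ⟩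
      χ ⟨ det M′ ⟩ₓ * ψ ⟨ a ⊕ U · M′ ⟩₊
        ≈⟨ *-cong (χ-cong det-eq) (trans (ψ-cong (⊕-·-shift a U t v M)) (ψ-+ (a ⊕ U · (v Vector.∷ M)) (t ∙ᵥ column₀ M))) ⟩
      χ ⟨ det (v Vector.∷ M) ⟩ₓ * (ψ ⟨ a ⊕ U · (v Vector.∷ M) ⟩₊ * ψ ⟨ t ∙ᵥ column₀ M ⟩₊)
        ≈⟨ *-assoc _ _ _ ⟨
      χ ⟨ det (v Vector.∷ M) ⟩ₓ * ψ ⟨ a ⊕ U · (v Vector.∷ M) ⟩₊ * ψ ⟨ t ∙ᵥ column₀ M ⟩₊
        ≈⟨ *-congʳ (term≈ (a ⊕ U) (v Vector.∷ M)) ⟨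
      term (a ⊕ U) (v Vector.∷ M) * ψ ⟨ t ∙ᵥ column₀ M ⟩₊    ∎
      where
      M′ : Matrix (suc n) (suc n)
      M′ = (λ s → v s +ₖ combination t M s) Vector.∷ M
      det-eq : det M′ ≈ₖ det (v Vector.∷ M)
      det-eq = F.trans (det-cong {A = M′} {(v Vector.∷ M) [ zero ≔ (λ s → v s +ₖ combination t M s) ]}
          λ { zero s → F.refl ; (suc i) s → F.refl })
        (det-add-combination (v Vector.∷ M) zero t suc λ _ ())

    -- For fixed lower rows, translation by a combination of them permutes the possible first rows,
    -- so each `t` gives another expression for the same sum.
    S-shift : ∀ t → S (a ⊕ U) ≈
      ∑ᵥ (suc n) λ v → ∑ₘ n (suc n) λ M → term (a ⊕ U) (v Vector.∷ M) * ψ ⟨ t ∙ᵥ column₀ M ⟩₊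
    S-shift t = begin
      S (a ⊕ U)
        ≈⟨ ∑-vectors (vectors elements (suc n)) n _ ⟩
      ∑ᵥ (suc n) (λ v → ∑ₘ n (suc n) λ M → term (a ⊕ U) (v Vector.∷ M))
        ≈⟨ ∑-swap (vectors elements (suc n)) (matrices n (suc n)) _ ⟩
      ∑ₘ n (suc n) (λ M → ∑ᵥ (suc n) λ v → term (a ⊕ U) (v Vector.∷ M))
        ≈⟨ (∑-cong (matrices n (suc n)) λ M → ∑ᵥ-shift (combination t M) λ {v} {v′} v≈v′ →
             term-cong (≈ₘ-refl {A = a ⊕ U}) λ { zero → v≈v′ ; (suc i) j → F.refl }) ⟨
      ∑ₘ n (suc n) (λ M → ∑ᵥ (suc n) λ v → term (a ⊕ U) ((λ s → v s +ₖ combination t M s) Vector.∷ M))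
        ≈⟨ (∑-cong (matrices n (suc n)) λ M → ∑-cong (vectors elements (suc n)) λ v → term-shift t v M) ⟩
      ∑ₘ n (suc n) (λ M → ∑ᵥ (suc n) λ v → term (a ⊕ U) (v Vector.∷ M) * ψ ⟨ t ∙ᵥ column₀ M ⟩₊)
        ≈⟨ ∑-swap (matrices n (suc n)) (vectors elements (suc n)) _ ⟩
      ∑ᵥ (suc n) (λ v → ∑ₘ n (suc n) λ M → term (a ⊕ U) (v Vector.∷ M) * ψ ⟨ t ∙ᵥ column₀ M ⟩₊) ∎

    -- Orthogonality in `t` turns the phases into the indicator that column 0 vanishes below the
    -- corner.
    S-average : Q ^ n * S (a ⊕ U) ≈
      ∑ᵥ (suc n) λ v → ∑ₘ n (suc n) λ M → term (a ⊕ U) (v Vector.∷ M) * (Q ^ n * 𝟙 (0ᵥ ≟ᵥ column₀ M))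
    S-average = begin
      Q ^ n * S (a ⊕ U)
        ≈⟨ ∑ᵥ-const n (S (a ⊕ U)) ⟨
      ∑ᵥ n (λ t → S (a ⊕ U))
        ≈⟨ ∑-cong (vectors elements n) S-shift ⟩
      ∑ᵥ n (λ t → ∑ᵥ (suc n) λ v → ∑ₘ n (suc n) λ M → term (a ⊕ U) (v Vector.∷ M) * ψ ⟨ t ∙ᵥ column₀ M ⟩₊)
        ≈⟨ ∑-swap (vectors elements n) (vectors elements (suc n)) _ ⟩
      ∑ᵥ (suc n) (λ v → ∑ᵥ n λ t → ∑ₘ n (suc n) λ M → term (a ⊕ U) (v Vector.∷ M) * ψ ⟨ t ∙ᵥ column₀ M ⟩₊)
        ≈⟨ (∑-cong (vectors elements (suc n)) λ v → trans
             (∑-swap (vectors elements n) (matrices n (suc n)) _)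
             (∑-cong (matrices n (suc n)) λ M → trans
               (sym (*-distribˡ-∑ (term (a ⊕ U) (v Vector.∷ M)) (vectors elements n) (λ t → ψ ⟨ t ∙ᵥ column₀ M ⟩₊)))
               (*-congˡ (∑ψ-dot n (column₀ M))))) ⟩
      ∑ᵥ (suc n) (λ v → ∑ₘ n (suc n) λ M → term (a ⊕ U) (v Vector.∷ M) * (Q ^ n * 𝟙 (0ᵥ ≟ᵥ column₀ M))) ∎

    block : k → Vector k n → Vector k n → Matrix n n → Matrix (suc n) (suc n)
    block x r v X = (x Vector.∷ r) Vector.∷ λ i → v i Vector.∷ X i

    -- Zeros below the corner make the matrix block triangular, so neither its determinant nor its
    -- pairing with `a ⊕ U` sees the rest `r` of the first row.
    term-block : ∀ x r X → term (a ⊕ U) (block x r 0ᵥ X) ≈ (χ ⟨ x ⟩ₓ * ψ ⟨ a *ₖ x ⟩₊) * term U X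
    term-block x r X = begin
      term (a ⊕ U) B
        ≈⟨ term≈ (a ⊕ U) B ⟩
      χ ⟨ det B ⟩ₓ * ψ ⟨ a ⊕ U · B ⟩₊
        ≈⟨ *-cong (trans (χ-cong (det-col₀-single B λ _ → F.refl)) (χ-* x (det X)))
                  (trans (ψ-cong (⊕-· a U B)) (ψ-+ (a *ₖ x) (U · X))) ⟩
      (χ ⟨ x ⟩ₓ * χ ⟨ det X ⟩ₓ) * (ψ ⟨ a *ₖ x ⟩₊ * ψ ⟨ U · X ⟩₊)
        ≈⟨ interchange (χ ⟨ x ⟩ₓ) (χ ⟨ det X ⟩ₓ) (ψ ⟨ a *ₖ x ⟩₊) (ψ ⟨ U · X ⟩₊) ⟩
      (χ ⟨ x ⟩ₓ * ψ ⟨ a *ₖ x ⟩₊) * (χ ⟨ det X ⟩ₓ * ψ ⟨ U · X ⟩₊)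
        ≈⟨ *-congˡ (term≈ U X) ⟨
      (χ ⟨ x ⟩ₓ * ψ ⟨ a *ₖ x ⟩₊) * term U X ∎
      where
      B = block x r 0ᵥ X

    -- Since `a` is a unit, a multiple of `v` by it vanishes only with `v`, and the indicator
    -- selects the zero column.
    column-supported : ∀ (F : Vector k n → ℂ) → (∀ {v w} → v ≈ᵥ w → F v ≈ F w) →
      ∑ᵥ n (λ v → F v * (Q ^ n * 𝟙 (0ᵥ ≟ᵥ λ i → a *ₖ v i))) ≈ Q ^ n * F 0ᵥ
    column-supported F F-cong = begin
      ∑ᵥ n (λ v → F v * (Q ^ n * 𝟙 (0ᵥ ≟ᵥ λ i → a *ₖ v i)))
        ≈⟨ (∑-cong (vectors elements n) λ v → trans (*-comm _ _) (trans (*-assoc _ _ _)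
             (*-congˡ (*-congʳ (𝟙-cong (0ᵥ ≟ᵥ λ i → a *ₖ v i) (0ᵥ ≟ᵥ v) (λ h i → F.sym (cancel (F.sym (h i))))
               (λ h i → F.sym (F.trans (F.*-congˡ (F.sym (h i))) (F.zeroʳ a)))))))) ⟩
      ∑ᵥ n (λ v → Q ^ n * (𝟙 (0ᵥ ≟ᵥ v) * F v))
        ≈⟨ *-distribˡ-∑ (Q ^ n) (vectors elements n) _ ⟨
      Q ^ n * ∑ᵥ n (λ v → 𝟙 (0ᵥ ≟ᵥ v) * F v)
        ≈⟨ *-congˡ (∑-𝟙 _≟ᵥ_ (vectors elements n) (kⁿ-enumeration n) 0ᵥ F F-cong) ⟩
      Q ^ n * F 0ᵥ ∎
      where
      cancel : ∀ {x} → a *ₖ x ≈ₖ 0# → x ≈ₖ 0#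
      cancel {x} ax≈0 = let b , ba≈1 , _ = unit in F.trans (F.sym (F.trans (F.sym (F.*-assoc b a x))
        (F.trans (F.*-congʳ ba≈1) (F.*-identityˡ x)))) (F.trans (F.*-congˡ ax≈0) (F.zeroʳ b))

    S-⊕ : S (a ⊕ U) ≈ (conj (χ ⟨ a ⟩ₓ) * G) * (Q ^ n * S U)
    S-⊕ = *-cancelˡ (^-≉0 Q≉0 n) (begin
      Q ^ n * S (a ⊕ U)
        ≈⟨ S-average ⟩
      ∑ᵥ (suc n) (λ v → ∑ₘ n (suc n) λ M → term (a ⊕ U) (v Vector.∷ M) * (Q ^ n * 𝟙 (0ᵥ ≟ᵥ column₀ M)))
        ≈⟨ ∑-vectors elements n _ ⟩
      ∑ₖ (λ x → ∑ᵥ n λ r → ∑ₘ n (suc n) λ M →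
        term (a ⊕ U) ((x Vector.∷ r) Vector.∷ M) * (Q ^ n * 𝟙 (0ᵥ ≟ᵥ column₀ M)))
        ≈⟨ (∑-cong elements λ x → ∑-cong (vectors elements n) λ r → ∑-columns n n λ {A} {B} A≈B → *-cong
             (term-cong (≈ₘ-refl {A = a ⊕ U}) λ { zero j → F.refl ; (suc i) j → A≈B i j })
             (*-congˡ (𝟙-cong (0ᵥ ≟ᵥ column₀ A) (0ᵥ ≟ᵥ column₀ B)
               (λ h i → F.trans (h i) (F.*-congˡ (A≈B i zero)))
               (λ h i → F.trans (h i) (F.*-congˡ (F.sym (A≈B i zero))))))) ⟩
      ∑ₖ (λ x → ∑ᵥ n λ r → ∑ᵥ n λ v → ∑ₘ n n λ X →
        term (a ⊕ U) (block x r v X) * (Q ^ n * 𝟙 (0ᵥ ≟ᵥ λ i → a *ₖ v i)))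
        ≈⟨ (∑-cong elements λ x → ∑-cong (vectors elements n) λ r → ∑-cong (vectors elements n) λ v →
             *-distribʳ-∑ (Q ^ n * 𝟙 (0ᵥ ≟ᵥ λ i → a *ₖ v i)) (matrices n n) (λ X → term (a ⊕ U) (block x r v X))) ⟨
      ∑ₖ (λ x → ∑ᵥ n λ r → ∑ᵥ n λ v →
        ∑ₘ n n (λ X → term (a ⊕ U) (block x r v X)) * (Q ^ n * 𝟙 (0ᵥ ≟ᵥ λ i → a *ₖ v i)))
        ≈⟨ (∑-cong elements λ x → ∑-cong (vectors elements n) λ r → column-supported
             (λ v → ∑ₘ n n λ X → term (a ⊕ U) (block x r v X)) λ v≈w → ∑-cong (matrices n n) λ X →
               term-cong (≈ₘ-refl {A = a ⊕ U}) λ { zero j → F.refl ; (suc i) zero → v≈w i ; (suc i) (suc j) → F.refl }) ⟩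
      ∑ₖ (λ x → ∑ᵥ n λ r → Q ^ n * ∑ₘ n n λ X → term (a ⊕ U) (block x r 0ᵥ X))
        ≈⟨ (∑-cong elements λ x → ∑-cong (vectors elements n) λ r → *-congˡ (trans
             (∑-cong (matrices n n) (term-block x r))
             (sym (*-distribˡ-∑ (χ ⟨ x ⟩ₓ * ψ ⟨ a *ₖ x ⟩₊) (matrices n n) (term U))))) ⟩
      ∑ₖ (λ x → ∑ᵥ n λ r → Q ^ n * ((χ ⟨ x ⟩ₓ * ψ ⟨ a *ₖ x ⟩₊) * S U))
        -- The free row `r` contributes the power of `Q` that remains in the result; the other one
        -- stems from the averaging and is cancelled.
        ≈⟨ (∑-cong elements λ x → trans (∑ᵥ-const n _) (*-congˡ (x∙yz≈y∙xz _ _ _))) ⟩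
      ∑ₖ (λ x → Q ^ n * ((χ ⟨ x ⟩ₓ * ψ ⟨ a *ₖ x ⟩₊) * (Q ^ n * S U)))
        ≈⟨ *-distribˡ-∑ (Q ^ n) elements _ ⟨
      Q ^ n * ∑ₖ (λ x → (χ ⟨ x ⟩ₓ * ψ ⟨ a *ₖ x ⟩₊) * (Q ^ n * S U))
        ≈⟨ *-congˡ (*-distribʳ-∑ (Q ^ n * S U) elements _) ⟨
      Q ^ n * (∑ₖ (λ x → χ ⟨ x ⟩ₓ * ψ ⟨ a *ₖ x ⟩₊) * (Q ^ n * S U))
        ≈⟨ *-congˡ (*-congʳ (twisted-gaussSum unit)) ⟩
      Q ^ n * ((conj (χ ⟨ a ⟩ₓ) * G) * (Q ^ n * S U)) ∎)

  -- The zero matrix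

  S-zero-nontrivial : ¬ IsTrivial χ → S (0ₘ {suc n} {suc n}) ≈ 0ℂ
  S-zero-nontrivial {n} χ-nontrivial = fixed-by-nontrivial⇒≈0 (λ x → proj₁ (X.⟦ x ⟧)) χ-nontrivial fixed
    where
    O : Matrix (suc n) (suc n)
    O = 0ₘ
    fixed : ∀ x → proj₁ (X.⟦ x ⟧) * S O ≈ S O
    fixed (a , unit@(b , ba≈1 , ab≈1)) = begin
      proj₁ (X.⟦ a , unit ⟧) * S O
        ≈⟨ *-congʳ (χ-unit unit) ⟨
      χ ⟨ a ⟩ₓ * S O
        ≈⟨ *-distribˡ-∑ (χ ⟨ a ⟩ₓ) (matrices (suc n) (suc n)) (term O) ⟩
      ∑ₘ (suc n) (suc n) (λ X → χ ⟨ a ⟩ₓ * term O X)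
        ≈⟨ ∑-cong (matrices (suc n) (suc n)) term-scale ⟨
      ∑ₘ (suc n) (suc n) (λ X → term O (scale a X))
        ≈⟨ ∑-bijection _≟ₘ_ (matrices (suc n) (suc n)) (matrices-enumeration (suc n) (suc n))
             _≟ₘ_ (matrices (suc n) (suc n)) (matrices-enumeration (suc n) (suc n))
             (scale a) (scale b) (inverse ba≈1) (inverse ab≈1) (term-cong (≈ₘ-refl {A = O})) ⟩
      S O ∎
      where
      scale : k → Matrix (suc n) (suc n) → Matrix (suc n) (suc n)
      scale a X = (λ s → a *ₖ X zero s) Vector.∷ (X ∘ suc)
      inverse : ∀ {a b} → b *ₖ a ≈ₖ 1# → ∀ {X Y} → scale a X ≈ₘ Y → scale b Y ≈ₘ X
      inverse {a} {b} ba≈1 {X} h zero    j = F.trans (F.*-congˡ (F.sym (h zero j)))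
        (F.trans (F.sym (F.*-assoc b a (X zero j))) (F.trans (F.*-congʳ ba≈1) (F.*-identityˡ (X zero j))))
      inverse ba≈1 h (suc i) j = F.sym (h (suc i) j)
      term-scale : ∀ X → term O (scale a X) ≈ χ ⟨ a ⟩ₓ * term O X
      term-scale X = begin
        term O (scale a X)
          ≈⟨ term≈ O (scale a X) ⟩
        χ ⟨ det (scale a X) ⟩ₓ * ψ ⟨ O · scale a X ⟩₊
          ≈⟨ *-cong (χ-cong (F.trans (det-scale-row₀ a (X zero) (X ∘ suc))
               (F.*-congˡ {a} (det-cong {A = X zero Vector.∷ (X ∘ suc)} {X} λ { zero j → F.refl ; (suc i) j → F.refl }))))
               (ψ-cong (F.trans (·-0 (scale a X)) (F.sym (·-0 X)))) ⟩
        χ ⟨ a *ₖ det X ⟩ₓ * ψ ⟨ O · X ⟩₊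
          ≈⟨ *-congʳ (χ-* a (det X)) ⟩
        χ ⟨ a ⟩ₓ * χ ⟨ det X ⟩ₓ * ψ ⟨ O · X ⟩₊
          ≈⟨ *-assoc _ _ _ ⟩
        χ ⟨ a ⟩ₓ * (χ ⟨ det X ⟩ₓ * ψ ⟨ O · X ⟩₊)
          ≈⟨ *-congˡ (term≈ O X) ⟨
        χ ⟨ a ⟩ₓ * term O X ∎

  firstRow : Vector k (suc n) → Matrix (suc n) (suc n)
  firstRow v = v Vector.∷ 0ₘ

  firstRow-· : ∀ (v : Vector k (suc n)) X → firstRow v · X ≈ₖ v ∙ᵥ X zero
  firstRow-· {n} v X = F.trans (F.+-congˡ (·-0 (X ∘ suc))) (F.+-identityʳ (v ∙ᵥ X zero))

  -- Orthogonality leaves only matrices with zero first row, hence zero determinant.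
  ∑-firstRow : ∑ᵥ (suc n) (λ v → S (firstRow v)) ≈ 0ℂ
  ∑-firstRow {n} = begin
    ∑ᵥ (suc n) (λ v → S (firstRow v))
      ≈⟨ (∑-cong (vectors elements (suc n)) λ v → ∑-cong (matrices (suc n) (suc n)) λ X →
           trans (term≈ (firstRow v) X) (*-congˡ (ψ-cong (firstRow-· v X)))) ⟩
    ∑ᵥ (suc n) (λ v → ∑ₘ (suc n) (suc n) λ X → χ ⟨ det X ⟩ₓ * ψ ⟨ v ∙ᵥ X zero ⟩₊)
      ≈⟨ ∑-swap (vectors elements (suc n)) (matrices (suc n) (suc n)) _ ⟩
    ∑ₘ (suc n) (suc n) (λ X → ∑ᵥ (suc n) λ v → χ ⟨ det X ⟩ₓ * ψ ⟨ v ∙ᵥ X zero ⟩₊)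
      ≈⟨ (∑-zero (matrices (suc n) (suc n)) λ X → trans
           (sym (*-distribˡ-∑ (χ ⟨ det X ⟩ₓ) (vectors elements (suc n)) (λ v → ψ ⟨ v ∙ᵥ X zero ⟩₊)))
           (trans (*-congˡ (∑ψ-dot (suc n) (X zero))) (vanish X (0ᵥ ≟ᵥ X zero)))) ⟩
    0ℂ ∎
    where
    vanish : ∀ X (d : Dec (0ᵥ ≈ᵥ X zero)) → χ ⟨ det X ⟩ₓ * (Q ^ suc n * 𝟙 d) ≈ 0ℂ
    vanish X (yes 0≈X₀) = trans (*-congʳ (χ-0 (F.trans
      (det-row₀-single X λ j → F.sym (0≈X₀ (suc j))) (F.trans (F.*-congʳ (F.sym (0≈X₀ zero))) (F.zeroˡ _)))))
      (zeroˡ _)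
    vanish X (no _) = trans (*-congˡ (zeroʳ _)) (zeroʳ _)

  -- With `z` the common value at the nonzero rows, vanishing of the total determines the value at
  -- the zero row. The factored form is the one that extends the product `Π n` by a factor.
  S-zero : ∀ z → (∀ v → ¬ 0ᵥ ≈ᵥ v → S (firstRow {n} v) ≈ z) → S (0ₘ {suc n} {suc n}) ≈ - 1ℂ * ((Q ^ suc n - 1ℂ) * z)
  S-zero {n} z S≈z = begin
    S O                                            ≈⟨ S-zero≈z-Qⁿz ⟩
    z - Q ^ suc n * z                               ≈⟨ +-congʳ (*-identityˡ z) ⟨
    1ℂ * z - Q ^ suc n * z                          ≈⟨ [y-z]x≈yx-zx z 1ℂ (Q ^ suc n) ⟨
    (1ℂ - Q ^ suc n) * z                            ≈⟨ *-congʳ (⁻¹-anti-homo-// (Q ^ suc n) 1ℂ) ⟨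
    - (Q ^ suc n - 1ℂ) * z                          ≈⟨ *-congʳ (-1*x≈-x _) ⟨
    (- 1ℂ * (Q ^ suc n - 1ℂ)) * z                   ≈⟨ *-assoc _ _ _ ⟩
    - 1ℂ * ((Q ^ suc n - 1ℂ) * z)                   ∎
    where
    open RingProperties ℂ-ring.ring using ([y-z]x≈yx-zx; -1*x≈-x; ⁻¹-anti-homo-//; +-inverseˡ-unique)
    O : Matrix (suc n) (suc n)
    O = 0ₘ
    -- The excess of the zero row over the common value: all rows contribute `z`, and the zero row
    -- adds `d`.
    d = S O - z
    split : ∀ v → S (firstRow v) ≈ z + 𝟙 (0ᵥ ≟ᵥ v) * d
    split v = cases (0ᵥ ≟ᵥ v)
      where
      cases : (e : Dec (0ᵥ ≈ᵥ v)) → S (firstRow v) ≈ z + 𝟙 e * d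
      cases (yes 0≈v) = begin
        S (firstRow v)  ≈⟨ S-cong {U = firstRow v} {O} (λ { zero j → F.sym (0≈v j) ; (suc i) j → F.refl }) ⟩
        S O            ≈⟨ +-identityˡ _ ⟨
        0ℂ + S O       ≈⟨ +-congʳ (-‿inverseʳ z) ⟨
        z - z + S O    ≈⟨ trans (+-assoc _ _ _) (+-congˡ (+-comm _ _)) ⟩
        z + d           ≈⟨ +-congˡ (*-identityˡ d) ⟨
        z + 1ℂ * d      ∎
      cases (no 0≉v) = trans (S≈z v 0≉v) (sym (trans (+-congˡ (zeroˡ d)) (+-identityʳ z)))
    total : Q ^ suc n * z + d ≈ 0ℂ
    total = begin
      Q ^ suc n * z + d
        ≈⟨ +-cong (∑ᵥ-const (suc n) z) (∑-𝟙 _≟ᵥ_ (vectors elements (suc n)) (kⁿ-enumeration (suc n)) 0ᵥ (λ _ → d) (λ _ → refl)) ⟨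
      ∑ᵥ (suc n) (λ _ → z) + ∑ᵥ (suc n) (λ v → 𝟙 (0ᵥ ≟ᵥ v) * d)
        ≈⟨ ∑-+ (vectors elements (suc n)) (λ _ → z) (λ v → 𝟙 (0ᵥ ≟ᵥ v) * d) ⟨
      ∑ᵥ (suc n) (λ v → z + 𝟙 (0ᵥ ≟ᵥ v) * d)
        ≈⟨ ∑-cong (vectors elements (suc n)) split ⟨
      ∑ᵥ (suc n) (λ v → S (firstRow v))
        ≈⟨ ∑-firstRow ⟩
      0ℂ ∎
    S-zero≈z-Qⁿz : S O ≈ z - Q ^ suc n * z
    S-zero≈z-Qⁿz = begin
      S O                      ≈⟨ +-identityʳ _ ⟨
      S O + 0ℂ                 ≈⟨ +-congˡ (-‿inverseˡ z) ⟨
      S O + (- z + z)          ≈⟨ +-assoc _ _ _ ⟨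
      d + z                     ≈⟨ +-comm _ _ ⟩
      z + d                     ≈⟨ +-congˡ (+-inverseˡ-unique d (Q ^ suc n * z) (trans (+-comm _ _) total)) ⟩
      z - Q ^ suc n * z         ∎

  -- The evaluation

  -- The sum of `ψ` over the whole field vanishes, and for trivial `χ` only its term at 0, which is
  -- 1, is missing.
  G-trivial : IsTrivial χ → G ≈ - 1ℂ
  G-trivial χ-trivial = +-inverseˡ-unique G 1ℂ (begin
    G + 1ℂ
      ≈⟨ +-cong G≈∑ₖ (sym (trans (∑-𝟙 _≟_ elements elements-enumeration 0# (ψ ⟨_⟩₊) ψ-cong) (ψ-0 F.refl))) ⟩
    ∑ₖ (λ x → χ ⟨ x ⟩ₓ * ψ ⟨ x ⟩₊) + ∑ₖ (λ x → 𝟙 (0# ≟ x) * ψ ⟨ x ⟩₊)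
      ≈⟨ ∑-+ elements (λ x → χ ⟨ x ⟩ₓ * ψ ⟨ x ⟩₊) (λ x → 𝟙 (0# ≟ x) * ψ ⟨ x ⟩₊) ⟨
    ∑ₖ (λ x → χ ⟨ x ⟩ₓ * ψ ⟨ x ⟩₊ + 𝟙 (0# ≟ x) * ψ ⟨ x ⟩₊)
      ≈⟨ ∑-cong elements (λ x → cases x (isUnit? x)) ⟩
    ∑ₖ (ψ ⟨_⟩₊)
      ≈⟨ ∑ψ≈0 ⟩
    0ℂ ∎)
    where
    open RingProperties ℂ-ring.ring using (+-inverseˡ-unique)
    cases : ∀ x → Dec (IsUnit x) → χ ⟨ x ⟩ₓ * ψ ⟨ x ⟩₊ + 𝟙 (0# ≟ x) * ψ ⟨ x ⟩₊ ≈ ψ ⟨ x ⟩₊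
    cases x (yes u) = trans (+-cong
      (trans (*-congʳ (trans (χ-unit u) (χ-trivial (x , u)))) (*-identityˡ _))
      (trans (*-congʳ (𝟙-no (0# ≟ x) (unit⇒≉0 u ∘ F.sym))) (zeroˡ _))) (+-identityʳ _)
    cases x (no ¬u) = trans (+-cong
      (trans (*-congʳ (χ-nonunit ¬u)) (zeroˡ _))
      (trans (*-congʳ (𝟙-yes (0# ≟ x) (F.sym (nonunit⇒≈0 ¬u)))) (*-identityˡ _))) (+-identityˡ _)

  Π : ℕ → ℂ
  Π m = ∏ {m} λ i → Q ^ suc (toℕ i) - 1ℂ

  -- `∏` unfolds at its first factor, whereas the new factor comes last.
  Π-suc : ∀ m → Π (suc m) ≈ Π m * (Q ^ suc m - 1ℂ)
  Π-suc m = trans (sum-init-last (λ (i : Fin (suc m)) → Q ^ suc (toℕ i) - 1ℂ)) (ℂ-ring.reflexive (≡.cong₂ _*_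
    (sum-cong-≗ {m} λ i → ≡.cong (λ j → Q ^ suc j - 1ℂ) (Fin.toℕ-inject₁ i))
    (≡.cong (λ j → Q ^ suc j - 1ℂ) (Fin.toℕ-fromℕ m))))
    where open MonoidSum ℂ-ring.*-monoid using (sum-init-last; sum-cong-≗)

  -- Pascal's rule: the exponents `n` of the recursion accumulate to the binomial coefficient.
  Q^[1+n]C2 : ∀ n → Q ^ (suc n C 2) ≈ Q ^ n * Q ^ (n C 2)
  Q^[1+n]C2 n = trans (ℂ-ring.reflexive (≡.cong (Q ^_) (≡.trans (≡.sym (nCk+nC[k+1]≡[n+1]C[k+1] n 1))
    (≡.cong (ℕ._+ n C 2) (nC1≡n n))))) (SemiringExp.^-homo-* ℂ-ring.semiring Q n (n C 2))

  value : ℕ → ℕ → ℂ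
  value n r = (- 1ℂ) ^ r * Q ^ (n C 2) * Π (n ∸ r)

  -- A corner contributes the Gauss sum -1 and the factor `Q ^ n`, while the difference of size and
  -- rank stays the same.
  value-suc : ∀ n r → - 1ℂ * (Q ^ n * value n r) ≈ value (suc n) (suc r)
  value-suc n r = begin
    - 1ℂ * (Q ^ n * ((- 1ℂ) ^ r * Q ^ (n C 2) * Π (n ∸ r)))
      ≈⟨ rearrange (- 1ℂ) (Q ^ n) ((- 1ℂ) ^ r) (Q ^ (n C 2)) (Π (n ∸ r)) ⟩
    - 1ℂ * (- 1ℂ) ^ r * (Q ^ n * Q ^ (n C 2)) * Π (n ∸ r)       ≈⟨ *-congʳ (*-congˡ (Q^[1+n]C2 n)) ⟨
    (- 1ℂ) ^ suc r * Q ^ (suc n C 2) * Π (n ∸ r)                ∎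
    where
    rearrange : ∀ a b c d e → a * (b * (c * d * e)) ≈ a * c * (b * d) * e
    rearrange = solve 5 (λ a b c d e → a :* (b :* (c :* d :* e)) := a :* c :* (b :* d) :* e) refl

  -- The sign from `S-zero` cancels that of rank one, and its other factor completes `Π n` to
  -- `Π (suc n)`.
  value-zero : ∀ n → - 1ℂ * ((Q ^ suc n - 1ℂ) * value (suc n) 1) ≈ value (suc n) 0
  value-zero n = begin
    - 1ℂ * ((Q ^ suc n - 1ℂ) * (- 1ℂ * 1ℂ * Q ^ (suc n C 2) * Π n))
      ≈⟨ rearrange (- 1ℂ) (Q ^ suc n - 1ℂ) (Q ^ (suc n C 2)) (Π n) ⟩
    - 1ℂ * - 1ℂ * (Q ^ (suc n C 2) * (Π n * (Q ^ suc n - 1ℂ)))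
      ≈⟨ *-cong (trans (-1*x≈-x (- 1ℂ)) (-‿involutive 1ℂ)) (*-congˡ (sym (Π-suc n))) ⟩
    1ℂ * (Q ^ (suc n C 2) * Π (suc n))
      ≈⟨ *-assoc _ _ _ ⟨
    1ℂ * Q ^ (suc n C 2) * Π (suc n) ∎
    where
    open RingProperties ℂ-ring.ring using (-1*x≈-x; -‿involutive)
    rearrange : ∀ m x y z → m * (x * (m * 1ℂ * y * z)) ≈ m * m * (y * (z * x))
    rearrange = solve 4 (λ m x y z → m :* (x :* (m :* con 1 :* y :* z)) := m :* m :* (y :* (z :* x))) refl

  -- The induction hypothesis. The rank is recorded by an identity matrix that bounds `U` and is
  -- bounded by it, because such bounds pass directly through elimination and block sums, unlike a
  -- basis of the column space.
  record Evaluation (U : Matrix n n) : Set (c ⊔ ℓ₁) where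
    field
      rank       : ℕ
      lower      : 1ₘ {rank} ≼ U
      upper      : U ≼ 1ₘ {rank}
      full       : rank ≡ n → S U ≈ conj (χ ⟨ det U ⟩ₓ) * Q ^ (n C 2) * G ^ n
      trivial    : IsTrivial χ → S U ≈ value n rank
      nontrivial : rank < n → ¬ IsTrivial χ → S U ≈ 0ℂ

  ∼-evaluation : {U V : Matrix n n} → U ∼ V → Evaluation V → Evaluation U
  ∼-evaluation U∼V E = record
    { rank       = rank
    ; lower      = ≼-trans lower (proj₂ (∼⇒≼ U∼V))
    ; upper      = ≼-trans (proj₁ (∼⇒≼ U∼V)) upper
    ; full       = λ r≡n → trans (∼⇒S≈ U∼V) (trans (full r≡n)
                     (*-congʳ (*-congʳ (conj-cong (χ-cong (F.sym (∼⇒det≈ U∼V)))))))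
    ; trivial    = λ t → trans (∼⇒S≈ U∼V) (trivial t)
    ; nontrivial = λ r<n t → trans (∼⇒S≈ U∼V) (nontrivial r<n t)
    }
    where open Evaluation E

  ⊕-evaluation : ∀ {a} → IsUnit a → {U : Matrix n n} → Evaluation U → Evaluation (a ⊕ U)
  ⊕-evaluation {n} {a} unit@(b , ba≈1 , _) {U} E = record
    { rank       = suc rank
    ; lower      = ≼-trans (≈⇒≼ (≈ₘ-sym 1⊕1ₘ)) (⊕-≼ {c = b} ba≈1 lower)
    ; upper      = ≼-trans (⊕-≼ {c = a} (F.*-identityʳ a) upper) (≈⇒≼ 1⊕1ₘ)
    ; full       = λ { ≡.refl → begin
        S (a ⊕ U)
          ≈⟨ S-⊕ unit U ⟩
        (conj (χ ⟨ a ⟩ₓ) * G) * (Q ^ n * S U)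
          ≈⟨ *-congˡ (*-congˡ (full ≡.refl)) ⟩
        (conj (χ ⟨ a ⟩ₓ) * G) * (Q ^ n * (conj (χ ⟨ det U ⟩ₓ) * Q ^ (n C 2) * G ^ n))
          ≈⟨ rearrange (conj (χ ⟨ a ⟩ₓ)) G (Q ^ n) (conj (χ ⟨ det U ⟩ₓ)) (Q ^ (n C 2)) (G ^ n) ⟩
        (conj (χ ⟨ a ⟩ₓ) * conj (χ ⟨ det U ⟩ₓ)) * (Q ^ n * Q ^ (n C 2)) * G ^ suc n
          ≈⟨ *-congʳ (*-cong (trans (conj-cong (trans (χ-cong (det-⊕ a U)) (χ-* a (det U)))) (conj-* _ _)) (Q^[1+n]C2 n)) ⟨
        conj (χ ⟨ det (a ⊕ U) ⟩ₓ) * Q ^ (suc n C 2) * G ^ suc n ∎ }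
    ; trivial    = λ t → begin
        S (a ⊕ U)                              ≈⟨ S-⊕ unit U ⟩
        (conj (χ ⟨ a ⟩ₓ) * G) * (Q ^ n * S U)
          ≈⟨ *-cong (*-cong (trans (conj-cong (trans (χ-unit unit) (t (a , unit)))) conj-1) (G-trivial t)) (*-congˡ (trivial t)) ⟩
        (1ℂ * - 1ℂ) * (Q ^ n * value n rank)   ≈⟨ *-congʳ (*-identityˡ (- 1ℂ)) ⟩
        - 1ℂ * (Q ^ n * value n rank)          ≈⟨ value-suc n rank ⟩
        value (suc n) (suc rank)               ∎
    ; nontrivial = λ { (s≤s r<n) t → trans (S-⊕ unit U)
        (trans (*-congˡ (trans (*-congˡ (nontrivial r<n t)) (zeroʳ _))) (zeroʳ _)) }
    }
    where
    open Evaluation E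
    rearrange : ∀ a g x d y h → (a * g) * (x * (d * y * h)) ≈ (a * d) * (x * y) * (g * h)
    rearrange = solve 6 (λ a g x d y h → (a :* g) :* (x :* (d :* y :* h)) := (a :* d) :* (x :* y) :* (g :* h)) refl

  nonzero-evaluation : (∀ (U : Matrix n n) → Evaluation U) →
    (U : Matrix (suc n) (suc n)) → ¬ U ≈ₘ 0ₘ → Evaluation U
  nonzero-evaluation evaluate U U≉0 =
    let a , V , unit , U∼a⊕V = eliminate U U≉0
    in ∼-evaluation U∼a⊕V (⊕-evaluation unit (evaluate V))

  -- An outer product of the first unit vector with `v`, hence a factorization through dimension
  -- one.
  firstRow-≼ : (v : Vector k (suc n)) → firstRow v ≼ 1ₘ {1}
  firstRow-≼ {n} v = factor P V λ
    { zero    j → F.sym (F.trans (F.+-identityʳ _) (F.trans (F.*-congʳ (*ₘ-identityʳ P zero zero)) (F.*-identityˡ (v j))))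
    ; (suc i) j → F.sym (F.trans (F.+-identityʳ _) (F.trans (F.*-congʳ (*ₘ-identityʳ P (suc i) zero)) (F.zeroˡ (v j))))
    }
    where
    P : Matrix (suc n) 1
    P i _ = 1ₘ i zero
    V : Matrix 1 (suc n)
    V _ = v

  -- An evaluation brings a rank of its own. The outer product bounds it by 1, and a factorization
  -- through size 0 would force `v` to vanish.
  firstRow-rank : (v : Vector k (suc n)) → ¬ 0ᵥ ≈ᵥ v → (E : Evaluation (firstRow v)) → Evaluation.rank E ≡ 1
  firstRow-rank v 0≉v E = ℕ.≤-antisym (1ₘ≼1ₘ⇒≤ (≼-trans lower (firstRow-≼ v))) (positive rank upper)
    where
    open Evaluation E
    positive : ∀ r → firstRow v ≼ 1ₘ {r} → 1 ≤ r
    positive zero    (factor _ _ v≈0) = contradiction (λ j → F.sym (v≈0 zero j)) 0≉v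
    positive (suc r) _ = s≤s z≤n

  zero-evaluation : (∀ (U : Matrix (suc n) (suc n)) → ¬ U ≈ₘ 0ₘ → Evaluation U) → Evaluation (0ₘ {suc n} {suc n})
  zero-evaluation {n} evaluate = record
    { rank       = 0
    ; lower      = factor (λ ()) (λ _ ()) λ ()
    ; upper      = factor (λ _ ()) (λ ()) λ _ _ → F.refl
    ; full       = λ ()
    ; trivial    = λ t → trans (S-zero (value (suc n) 1) (rank-one t)) (value-zero n)
    ; nontrivial = λ _ → S-zero-nontrivial
    }
    where
    rank-one : IsTrivial χ → ∀ v → ¬ 0ᵥ ≈ᵥ v → S (firstRow v) ≈ value (suc n) 1
    rank-one t v 0≉v = trans (Evaluation.trivial E t)
      (ℂ-ring.reflexive (≡.cong (value (suc n)) (firstRow-rank v 0≉v E)))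
      where E = evaluate (firstRow v) λ h → 0≉v λ j → F.sym (h zero j)

  -- The one matrix of size 0 has determinant 1 and pairing 0, so the sum is 1.
  empty-evaluation : (U : Matrix 0 0) → Evaluation U
  empty-evaluation U = record
    { rank       = 0
    ; lower      = factor (λ ()) (λ ()) λ ()
    ; upper      = factor (λ ()) (λ ()) λ ()
    ; full       = λ _ → trans S≈1 (sym (trans (*-identityʳ _) (trans (*-identityʳ _) (trans (conj-cong χ-1) conj-1))))
    ; trivial    = λ _ → trans S≈1 (sym (trans (*-identityʳ _) (*-identityʳ _)))
    ; nontrivial = λ ()
    }
    where
    S≈1 : S U ≈ 1ℂ
    S≈1 = trans (+-identityʳ _) (trans (term≈ U _) (trans (*-cong χ-1 (ψ-0 F.refl)) (*-identityʳ 1ℂ)))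

  evaluate : ∀ n (U : Matrix n n) → Evaluation U
  evaluate zero    U = empty-evaluation U
  evaluate (suc n) U = cases (U ≟ₘ 0ₘ)
    where
    nonzero = nonzero-evaluation (evaluate n)
    cases : Dec (U ≈ₘ 0ₘ) → Evaluation U
    cases (yes U≈0) = ∼-evaluation (≈⇒∼ U≈0) (zero-evaluation nonzero)
    cases (no U≉0)  = nonzero U U≉0

theorem2p1 : ∀ {c ℓ₁ ℓ₂} (q : ℕ) → IsPrimePower q →
    (K : HeytingField c ℓ₁ ℓ₂) (enumeration : HasOrder K q) →
    let open GaussSums K enumeration in
    ∀ (n : ℕ) → 1 ≤ n →
    (ψ : Additive) → ¬ IsTrivial ψ →
    (χ : Multiplicative) →
    (U : Matrix n n) → ¬ (U ≈ₘ 0ₘ) →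
    (u : ℕ) → HasRank U u →
    (u ≡ n →
    gaussSumGL U χ ψ ≈ conj (χ ⟨ det U ⟩ₓ) * fromℕ q ^ (n C 2) * gaussSum χ ψ ^ n)
    × (IsTrivial χ →
    gaussSumGL U χ ψ ≈
    (- 1ℂ) ^ u * fromℕ q ^ (n C 2) * ∏ {n ∸ u} (λ i → fromℕ q ^ suc (toℕ i) - 1ℂ))
    × (u < n → ¬ IsTrivial χ → gaussSumGL U χ ψ ≈ 0ℂ)
theorem2p1 q _ K enumeration n _ ψ ψ-nontrivial χ U _ u U-rank =
    (λ u≡n → trans G≈S (full (≡.trans r≡u u≡n)))
  , (λ t → trans G≈S (trans (trivial t) (reflexive (≡.cong (value n) r≡u))))
  , (λ u<n t → trans G≈S (nontrivial (≡.subst (_< n) (≡.sym r≡u) u<n) t))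
  where
  open ℂ-ring using (trans; reflexive)
  open Evaluate K enumeration ψ ψ-nontrivial χ
  open Evaluation (evaluate n U)
  G≈S = gaussSumGL≈S U
  -- Here the rank found by elimination meets the one given by a basis of the column space.
  r≡u : rank ≡ u
  r≡u = ≡.sym (Field.rank-unique K enumeration U lower upper U-rank)
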